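{- Let $\ell \geq 2$ and $s \geq 1$ be integers, and let $p_n/q_n$ ($n \ge 0$) be the $n$th convergent of the regular continued fraction of $$s e^{1/(\ell s)} = [s, \ell - 1, 1, 2s-1, 3\ell - 1, 1, 2s-1, 5\ell - 1, 1, 2s-1, \dots, (2k-1)\ell - 1, 1, 2s-1, \dots].$$ Then $$\sum_{n \geq 0} \left|p_n - s e^{1/(\ell s)} q_n\right| = e^{1/(\ell s)} \sqrt{\frac{\pi s}{\ell}}\, \operatorname{erf}\!\left(1/\sqrt{\ell s}\right).$$ Moreover, let $s \geq 1$ be an integer and let $p_n^*/q_n^*$ ($n\ge 0$) be the $n$th convergent of the regular continued fraction of $$s e^{1/s} = [s+1, 2s-1, 2, 1, 2s-1, 4, 1, \dots, 2s-1, 2k, 1, \dots].$$ Then $$\sum_{n \geq 0} \left|p_n^* - s e^{1/s} q_n^*\right| = e^{1/s} \sqrt{\pi s}\, \operatorname{erf}\!\left(1/\sqrt{s}\right) + s\left(1-e^{1/s}\right) - 1.$$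
   Context: The error function is $\operatorname{erf}(x) = \frac{2}{\sqrt{\pi}}\int_0^x e^{ -t^2}\,dt$. For a real number $\alpha$ with regular continued fraction $[a_0,a_1,a_2,\dots]$, the $n$th convergent is $p_n/q_n = [a_0,\dots,a_n]$ in lowest terms, with $q_n>0$ (equivalently $p_{ -1}=1,q_{ -1}=0,p_0=a_0,q_0=1$, $p_n=a_np_{n-1}+p_{n-2}$, $q_n=a_nq_{n-1}+q_{n-2}$). -}

module Defs where

open import Data.Nat.Base as ℕ using (ℕ; zero; suc)
import Data.Nat.Properties as ℕ
open import Data.Integer.Base as ℤ using (ℤ; +_)
import Data.Integer.Properties as ℤ
open import Data.Rational.Base as ℚ using (ℚ; 0ℚ; 1ℚ; ½)
import Data.Rational.Properties as ℚ
open import Data.Rational.Solver using (module +-*-Solver)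
import Data.Rational.Unnormalised.Base as ℚᵘ
import Data.Rational.Unnormalised.Properties as ℚᵘ
open import Data.Product.Base using (∃; _×_; _,_; proj₁; proj₂)
open import Data.Sum.Base using (_⊎_; inj₁; inj₂)
open import Relation.Binary.PropositionalEquality
  using (_≡_; refl; sym; trans; cong; cong₂; subst)
open import Relation.Nullary.Decidable using (yes; no)
open import Relation.Nullary.Negation using (contradiction)

module RationalLemmas where

  open import Data.Rational.Base
  open import Data.Rational.Properties using (≤-refl; ≤-trans; ≤-reflexive; <⇒≤; +-mono-≤)
  open +-*-Solver

  ℕ→ℚ : ℕ → ℚ
  ℕ→ℚ n = + n / 1

  by-diff : ∀ {p q} r → 0ℚ ≤ r → p + r ≡ q → p ≤ q
  by-diff {p} r 0≤r refl =
    ≤-trans (≤-reflexive (sym (ℚ.+-identityʳ p))) (ℚ.+-monoʳ-≤ p 0≤r)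

  diff-nonneg : ∀ {p q} → p ≤ q → 0ℚ ≤ q - p
  diff-nonneg {p} {q} p≤q =
    ≤-trans (≤-reflexive (sym (ℚ.+-inverseʳ p))) (ℚ.+-monoˡ-≤ (- p) p≤q)

  +-nonneg : ∀ {p q} → 0ℚ ≤ p → 0ℚ ≤ q → 0ℚ ≤ p + q
  +-nonneg 0≤p 0≤q = ≤-trans (≤-reflexive refl) (+-mono-≤ 0≤p 0≤q)

  *-nonneg : ∀ {p q} → 0ℚ ≤ p → 0ℚ ≤ q → 0ℚ ≤ p * q
  *-nonneg {p} {q} 0≤p 0≤q = ℚ.nonNegative⁻¹ (p * q)
    {{ℚ.nonNeg*nonNeg⇒nonNeg p {{ℚ.nonNegative 0≤p}} q {{ℚ.nonNegative 0≤q}}}}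

  *-positive : ∀ {p q} → 0ℚ < p → 0ℚ < q → 0ℚ < p * q
  *-positive {p} {q} 0<p 0<q = ℚ.positive⁻¹ (p * q)
    {{ℚ.pos*pos⇒pos p {{ℚ.positive 0<p}} q {{ℚ.positive 0<q}}}}

  *-monoʳ : ∀ {p q} r → 0ℚ ≤ r → p ≤ q → p * r ≤ q * r
  *-monoʳ r 0≤r = ℚ.*-monoʳ-≤-nonNeg r {{ℚ.nonNegative 0≤r}}

  *-monoˡ : ∀ {p q} r → 0ℚ ≤ r → p ≤ q → r * p ≤ r * q
  *-monoˡ r 0≤r = ℚ.*-monoˡ-≤-nonNeg r {{ℚ.nonNegative 0≤r}}

  *-mono : ∀ {p q r s} → 0ℚ ≤ q → 0ℚ ≤ r → p ≤ q → r ≤ s → p * r ≤ q * s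
  *-mono {q = q} {r} 0≤q 0≤r p≤q r≤s = ≤-trans (*-monoʳ r 0≤r p≤q) (*-monoˡ q 0≤q r≤s)

  square-mono⁻¹ : ∀ {p q} → 0ℚ ≤ q → p * p ≤ q * q → p ≤ q
  square-mono⁻¹ {p} {q} 0≤q pp≤qq with p ℚ.≤? q
  ... | yes p≤q = p≤q
  ... | no  p≰q = contradiction (ℚ.<-≤-trans qq<pp pp≤qq) (ℚ.<-irrefl refl)
    where
    q<p = ℚ.≰⇒> p≰q
    qq<pp : q * q < p * p
    qq<pp = ℚ.≤-<-trans (*-monoˡ q 0≤q (<⇒≤ q<p))
              (ℚ.*-monoˡ-<-pos p {{ℚ.positive (ℚ.≤-<-trans 0≤q q<p)}} q<p)

  0<1 : 0ℚ < 1ℚ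
  0<1 = ℚ.positive⁻¹ 1ℚ

  0≤1 : 0ℚ ≤ 1ℚ
  0≤1 = <⇒≤ 0<1

  0≤½ : 0ℚ ≤ ½
  0≤½ = ℚ.nonNegative⁻¹ ½

  half : ℚ → ℚ
  half p = ½ * p

  half-pos : ∀ {p} → 0ℚ < p → 0ℚ < half p
  half-pos = *-positive (ℚ.positive⁻¹ ½)

  half+half : ∀ p → half p + half p ≡ p
  half+half = solve 1 (λ p → con ½ :* p :+ con ½ :* p := p) refl

  p+-nonneg : ∀ {p q} → 0ℚ ≤ q → p ≤ p + q
  p+-nonneg {q = q} 0≤q = by-diff q 0≤q refl

  nonneg+p : ∀ {p q} → 0ℚ ≤ q → p ≤ q + p
  nonneg+p {p} {q} 0≤q = by-diff q 0≤q (ℚ.+-comm p q)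

  p≤∣p∣ : ∀ p → p ≤ ∣ p ∣
  p≤∣p∣ p with ℚ.≤-total 0ℚ p
  ... | inj₁ 0≤p = ≤-reflexive (sym (ℚ.0≤p⇒∣p∣≡p 0≤p))
  ... | inj₂ p≤0 = ≤-trans p≤0 (ℚ.0≤∣p∣ p)

  ∣-∣-lub : ∀ {p q} → p ≤ q → - p ≤ q → ∣ p ∣ ≤ q
  ∣-∣-lub {p} p≤q -p≤q with ℚ.∣p∣≡p∨∣p∣≡-p p
  ... | inj₁ eq = ≤-trans (≤-reflexive eq) p≤q
  ... | inj₂ eq = ≤-trans (≤-reflexive eq) -p≤q

  dist-sym : ∀ p q → ∣ p - q ∣ ≡ ∣ q - p ∣
  dist-sym p q = trans (sym (ℚ.∣-p∣≡∣p∣ (p - q)))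
    (cong ∣_∣ (solve 2 (λ p q → :- (p :- q) := q :- p) refl p q))

  dist-lub : ∀ {p q r} → p ≤ q + r → q ≤ p + r → ∣ p - q ∣ ≤ r
  dist-lub {p} {q} {r} h k = ∣-∣-lub
    (by-diff ((q + r) - p) (diff-nonneg h)
      (solve 3 (λ p q r → p :- q :+ ((q :+ r) :- p) := r) refl p q r))
    (by-diff ((p + r) - q) (diff-nonneg k)
      (solve 3 (λ p q r → :- (p :- q) :+ ((p :+ r) :- q) := r) refl p q r))

  dist-upper : ∀ {p q r} → ∣ p - q ∣ ≤ r → p ≤ q + r
  dist-upper {p} {q} {r} h = by-diff (r - (p - q)) (diff-nonneg (≤-trans (p≤∣p∣ _) h))
    (solve 3 (λ p q r → p :+ (r :- (p :- q)) := q :+ r) refl p q r)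

  triangle : ∀ {p q r s t} → ∣ p - q ∣ ≤ s → ∣ q - r ∣ ≤ t → ∣ p - r ∣ ≤ s + t
  triangle {p} {q} {r} h k =
    ≤-trans (≤-reflexive (cong ∣_∣ (solve 3 (λ p q r → p :- r := (p :- q) :+ (q :- r)) refl p q r)))
    (≤-trans (ℚ.∣p+q∣≤∣p∣+∣q∣ (p - q) (q - r)) (+-mono-≤ h k))

  ∣+∣-≤ : ∀ {p q s t} → ∣ p ∣ ≤ s → ∣ q ∣ ≤ t → ∣ p + q ∣ ≤ s + t
  ∣+∣-≤ {p} {q} h k = ≤-trans (ℚ.∣p+q∣≤∣p∣+∣q∣ p q) (+-mono-≤ h k)

  ∣-∣-≤ : ∀ {p q s t} → ∣ p ∣ ≤ s → ∣ q ∣ ≤ t → ∣ p - q ∣ ≤ s + t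
  ∣-∣-≤ {p} {q} h k = ≤-trans (ℚ.∣p-q∣≤∣p∣+∣q∣ p q) (+-mono-≤ h k)

  ∣*∣-≤ : ∀ {p q s t} → ∣ p ∣ ≤ s → ∣ q ∣ ≤ t → ∣ p * q ∣ ≤ s * t
  ∣*∣-≤ {p} {q} h k = ≤-trans (≤-reflexive (ℚ.∣p*q∣≡∣p∣*∣q∣ p q))
    (*-mono (≤-trans (ℚ.0≤∣p∣ p) h) (ℚ.0≤∣p∣ q) h k)

  ∣∣-lipschitz : ∀ p q → ∣ ∣ p ∣ - ∣ q ∣ ∣ ≤ ∣ p - q ∣
  ∣∣-lipschitz p q = dist-lub (half-triangle p q)
    (≤-trans (half-triangle q p) (≤-reflexive (cong (λ z → ∣ p ∣ + z) (dist-sym q p))))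
    where
    half-triangle : ∀ p q → ∣ p ∣ ≤ ∣ q ∣ + ∣ p - q ∣
    half-triangle p q = ≤-trans
      (≤-reflexive (cong ∣_∣ (solve 2 (λ p q → p := q :+ (p :- q)) refl p q)))
      (ℚ.∣p+q∣≤∣p∣+∣q∣ q (p - q))

  ⊔-lipschitz : ∀ c p q → ∣ (p ⊔ c) - (q ⊔ c) ∣ ≤ ∣ p - q ∣
  ⊔-lipschitz c p q = dist-lub (one-sided p q)
    (≤-trans (one-sided q p) (≤-reflexive (cong (λ z → (p ⊔ c) + z) (dist-sym q p))))
    where
    one-sided : ∀ p q → p ⊔ c ≤ (q ⊔ c) + ∣ p - q ∣
    one-sided p q = ℚ.⊔-lub
      (≤-trans (dist-upper {p} {q} ≤-refl) (ℚ.+-monoˡ-≤ ∣ p - q ∣ (ℚ.p≤p⊔q q c)))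
      (≤-trans (ℚ.p≤q⊔p q c) (p+-nonneg (ℚ.0≤∣p∣ (p - q))))

  product-dist : ∀ {p q p′ q′ B C s t} → ∣ p ∣ ≤ B → ∣ q′ ∣ ≤ C →
                 ∣ p - p′ ∣ ≤ s → ∣ q - q′ ∣ ≤ t → ∣ p * q - p′ * q′ ∣ ≤ B * t + s * C
  product-dist {p} {q} {p′} {q′} hp hq hs ht = ≤-trans
    (≤-reflexive (cong ∣_∣ (solve 4 (λ p q p′ q′ →
      p :* q :- p′ :* q′ := p :* (q :- q′) :+ (p :- p′) :* q′) refl p q p′ q′)))
    (∣+∣-≤ (∣*∣-≤ hp ht) (∣*∣-≤ hs hq))

  inverse : ∀ {p} → 0ℚ < p → ∃ λ q → 0ℚ < q × p * q ≡ 1ℚ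
  inverse {p} 0<p = (1/ p) {{nz}} , ℚ.positive⁻¹ _ {{ℚ.1/pos⇒pos p {{ps}}}} , ℚ.*-inverseʳ p {{nz}}
    where
    ps = ℚ.positive 0<p
    nz = ℚ.pos⇒nonZero p {{ps}}

  shrink : ∀ B {ε} → 0ℚ ≤ B → 0ℚ < ε → ∃ λ δ → 0ℚ < δ × B * δ ≤ ε
  shrink B {ε} 0≤B 0<ε with inverse (ℚ.<-≤-trans 0<1 (p+-nonneg {1ℚ} 0≤B))
  ... | (c , 0<c , eq) = c * ε , *-positive 0<c 0<ε ,
    by-diff (c * ε) (<⇒≤ (*-positive 0<c 0<ε))
      (trans (solve 3 (λ B c e → B :* (c :* e) :+ c :* e := ((con 1ℚ :+ B) :* c) :* e) refl B c ε)
        (trans (cong (_* ε) eq) (ℚ.*-identityˡ ε)))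

  toℚᵘ-/ : ∀ i d → toℚᵘ (i / suc d) ℚᵘ.≃ ℚᵘ.mkℚᵘ i d
  toℚᵘ-/ i d = ℚ.toℚᵘ-fromℚᵘ (ℚᵘ.mkℚᵘ i d)

  ℕ→ℚ-+ : ∀ m n → ℕ→ℚ (m ℕ.+ n) ≡ ℕ→ℚ m + ℕ→ℚ n
  ℕ→ℚ-+ m n = ℚ.toℚᵘ-injective (ℚᵘ.≃-trans (toℚᵘ-/ (+ (m ℕ.+ n)) 0)
    (ℚᵘ.≃-trans (ℚᵘ.*≡* eq)
    (ℚᵘ.≃-sym (ℚᵘ.≃-trans (ℚ.toℚᵘ-homo-+ (ℕ→ℚ m) (ℕ→ℚ n))
      (ℚᵘ.+-cong (toℚᵘ-/ (+ m) 0) (toℚᵘ-/ (+ n) 0))))))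
    where
    eq : + (m ℕ.+ n) ℤ.* + 1 ≡ (+ m ℤ.* + 1 ℤ.+ + n ℤ.* + 1) ℤ.* + 1
    eq = cong (ℤ._* + 1) (trans (ℤ.pos-+ m n)
           (sym (cong₂ ℤ._+_ (ℤ.*-identityʳ (+ m)) (ℤ.*-identityʳ (+ n)))))

  ℕ→ℚ-suc : ∀ n → ℕ→ℚ (suc n) ≡ 1ℚ + ℕ→ℚ n
  ℕ→ℚ-suc n = ℕ→ℚ-+ 1 n

  ℕ→ℚ-* : ∀ m n → ℕ→ℚ (m ℕ.* n) ≡ ℕ→ℚ m * ℕ→ℚ n
  ℕ→ℚ-* zero n = sym (ℚ.*-zeroˡ (ℕ→ℚ n))
  ℕ→ℚ-* (suc m) n = trans (ℕ→ℚ-+ n (m ℕ.* n))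
    (trans (cong (λ z → ℕ→ℚ n + z) (ℕ→ℚ-* m n))
    (trans (solve 2 (λ m n → n :+ m :* n := (con 1ℚ :+ m) :* n) refl (ℕ→ℚ m) (ℕ→ℚ n))
      (cong (_* ℕ→ℚ n) (sym (ℕ→ℚ-suc m)))))

  ℕ→ℚ-nonneg : ∀ n → 0ℚ ≤ ℕ→ℚ n
  ℕ→ℚ-nonneg zero = ≤-refl
  ℕ→ℚ-nonneg (suc n) =
    ≤-trans (+-nonneg 0≤1 (ℕ→ℚ-nonneg n)) (≤-reflexive (sym (ℕ→ℚ-suc n)))

  ℕ→ℚ-mono : ∀ {m n} → m ℕ.≤ n → ℕ→ℚ m ≤ ℕ→ℚ n
  ℕ→ℚ-mono {m} {n} m≤n = by-diff (ℕ→ℚ (n ℕ.∸ m)) (ℕ→ℚ-nonneg (n ℕ.∸ m))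
    (trans (sym (ℕ→ℚ-+ m (n ℕ.∸ m))) (cong ℕ→ℚ (ℕ.m+[n∸m]≡n m≤n)))

  1≤ℕ→ℚ-suc : ∀ n → 1ℚ ≤ ℕ→ℚ (suc n)
  1≤ℕ→ℚ-suc n = ℕ→ℚ-mono {1} {suc n} (ℕ.s≤s ℕ.z≤n)

  0<ℕ→ℚ-suc : ∀ n → 0ℚ < ℕ→ℚ (suc n)
  0<ℕ→ℚ-suc n = ℚ.<-≤-trans 0<1 (1≤ℕ→ℚ-suc n)

  /-as-* : ∀ i n → + i / suc n ≡ ℕ→ℚ i * (+ 1 / suc n)
  /-as-* i n = ℚ.toℚᵘ-injective (ℚᵘ.≃-trans (toℚᵘ-/ (+ i) n)
    (ℚᵘ.≃-trans (ℚᵘ.*≡* eq)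
    (ℚᵘ.≃-sym (ℚᵘ.≃-trans (ℚ.toℚᵘ-homo-* (ℕ→ℚ i) (+ 1 / suc n))
      (ℚᵘ.*-cong (toℚᵘ-/ (+ i) 0) (toℚᵘ-/ (+ 1) n))))))
    where
    eq : + i ℤ.* (+ 1 ℤ.* + suc n) ≡ (+ i ℤ.* + 1) ℤ.* + suc n
    eq = sym (ℤ.*-assoc (+ i) (+ 1) (+ suc n))

  n/n≡1 : ∀ n → + suc n / suc n ≡ 1ℚ
  n/n≡1 n = ℚ.toℚᵘ-injective (ℚᵘ.≃-trans (toℚᵘ-/ (+ suc n) n)
    (ℚᵘ.*≡* (ℤ.*-comm (+ suc n) (+ 1))))

  n*1/n : ∀ n → ℕ→ℚ (suc n) * (+ 1 / suc n) ≡ 1ℚ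
  n*1/n n = trans (sym (/-as-* (suc n) n)) (n/n≡1 n)

  0≤/ : ∀ i n → 0ℚ ≤ + i / suc n
  0≤/ i n = ℚ.nonNegative⁻¹ _ {{ℚ.normalize-nonNeg i (suc n)}}

  /-mono : ∀ {i j} n → i ℕ.≤ j → + i / suc n ≤ + j / suc n
  /-mono {i} {j} n i≤j = ≤-trans (≤-reflexive (/-as-* i n))
    (≤-trans (*-monoʳ (+ 1 / suc n) (0≤/ 1 n) (ℕ→ℚ-mono i≤j)) (≤-reflexive (sym (/-as-* j n))))

  /≤1 : ∀ {i} n → i ℕ.≤ suc n → + i / suc n ≤ 1ℚ
  /≤1 n i≤n = ≤-trans (/-mono n i≤n) (≤-reflexive (n/n≡1 n))

  archimedean : ∀ p → ∃ λ n → p ≤ ℕ→ℚ n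
  archimedean p@(mkℚ i d _) = ℤ.∣ i ∣ , ℚ.toℚᵘ-cancel-≤
    (ℚᵘ.≤-trans (ℚᵘ.*≤* bound) (ℚᵘ.≤-reflexive (ℚᵘ.≃-sym (toℚᵘ-/ (+ ℤ.∣ i ∣) 0))))
    where
    i≤∣i∣ : ∀ j → j ℤ.≤ + ℤ.∣ j ∣
    i≤∣i∣ (+ n) = ℤ.≤-refl
    i≤∣i∣ ℤ.-[1+ n ] = ℤ.-≤+
    bound : i ℤ.* + 1 ℤ.≤ + ℤ.∣ i ∣ ℤ.* + suc d
    bound = ℤ.≤-trans (ℤ.≤-reflexive (ℤ.*-identityʳ i)) (ℤ.≤-trans (i≤∣i∣ i)
      (ℤ.≤-trans (ℤ.+≤+ (ℕ.m≤m*n ℤ.∣ i ∣ (suc d)))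
        (ℤ.≤-reflexive (ℤ.pos-* ℤ.∣ i ∣ (suc d)))))

  1/n-small : ∀ B {ε} → 0ℚ ≤ B → 0ℚ < ε →
              ∃ λ N → ∀ n → N ℕ.≤ n → B * (+ 1 / suc n) ≤ ε
  1/n-small B {ε} 0≤B 0<ε with inverse 0<ε
  ... | (c , 0<c , eq) with archimedean (c * B)
  ...   | (N , cB≤N) = N , λ n N≤n →
    let u = + 1 / suc n
        cB≤n+1 = ≤-trans cB≤N (ℕ→ℚ-mono (ℕ.≤-trans N≤n (ℕ.n≤1+n n)))
    in ≤-trans
      (≤-reflexive (trans (sym (ℚ.*-identityˡ (B * u))) (trans (cong (_* (B * u)) (sym eq))
        (solve 4 (λ e c B u → e :* c :* (B :* u) := e :* (c :* B :* u)) refl ε c B u))))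
      (≤-trans (*-monoˡ ε (<⇒≤ 0<ε) (*-monoʳ u (0≤/ 1 n) cB≤n+1))
      (≤-reflexive (trans (cong (ε *_) (n*1/n n)) (ℚ.*-identityʳ ε))))

  ½^_ : ℕ → ℚ
  ½^ zero  = 1ℚ
  ½^ suc n = ½ * ½^ n

  0≤½^ : ∀ n → 0ℚ ≤ ½^ n
  0≤½^ zero    = 0≤1
  0≤½^ (suc n) = *-nonneg 0≤½ (0≤½^ n)

  n*½^n≤1 : ∀ n → ℕ→ℚ (suc n) * ½^ n ≤ 1ℚ
  n*½^n≤1 zero = ≤-refl
  n*½^n≤1 (suc n) = by-diff (½ * (ℕ→ℚ n * h) + (1ℚ - ℕ→ℚ (suc n) * h))
    (+-nonneg (*-nonneg 0≤½ (*-nonneg (ℕ→ℚ-nonneg n) (0≤½^ n))) (diff-nonneg (n*½^n≤1 n)))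
    (trans (cong₂ (λ s t → t * (½ * h) + (½ * (ℕ→ℚ n * h) + (1ℚ - s * h)))
             (ℕ→ℚ-suc n) (trans (ℕ→ℚ-suc (suc n)) (cong (λ z → 1ℚ + z) (ℕ→ℚ-suc n))))
      (solve 2 (λ n h → (con 1ℚ :+ (con 1ℚ :+ n)) :* (con ½ :* h)
          :+ (con ½ :* (n :* h) :+ (con 1ℚ :- (con 1ℚ :+ n) :* h)) := con 1ℚ)
        refl (ℕ→ℚ n) h))
    where h = ½^ n

  ½^≤1/n : ∀ n → ½^ n ≤ + 1 / suc n
  ½^≤1/n n = ≤-trans
    (≤-reflexive (trans (sym (ℚ.*-identityˡ h)) (trans (cong (_* h) (sym (n*1/n n)))
      (solve 3 (λ m u h → m :* u :* h := m :* h :* u) refl (ℕ→ℚ (suc n)) (+ 1 / suc n) h))))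
    (≤-trans (*-monoʳ (+ 1 / suc n) (0≤/ 1 n) (n*½^n≤1 n))
      (≤-reflexive (ℚ.*-identityˡ (+ 1 / suc n))))
    where h = ½^ n

  ½^-small : ∀ B {ε} → 0ℚ ≤ B → 0ℚ < ε → ∃ λ N → ∀ n → N ℕ.≤ n → B * ½^ n ≤ ε
  ½^-small B 0≤B 0<ε = let (N , h) = 1/n-small B 0≤B 0<ε in
    N , λ n N≤n → ≤-trans (*-monoˡ B 0≤B (½^≤1/n n)) (h n N≤n)

module Approximations where

  open import Data.Rational.Base
  open import Data.Rational.Properties using (≤-refl; ≤-trans; ≤-reflexive; <⇒≤; +-mono-≤)
  open +-*-Solver
  open RationalLemmas

  -- `F n` approximates a real function at rational arguments ever better as
  -- n grows.  Under this condition the diagonal n ↦ F n (xₙ) is Cauchy for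
  -- every Cauchy sequence x, and defines a function on the reals that is
  -- uniformly continuous on bounded sets.

  LocallyUniform : (ℕ → ℚ → ℚ) → Set
  LocallyUniform F = ∀ B ε → 0ℚ < ε → ∃ λ δ → 0ℚ < δ × ∃ λ N →
    ∀ m n → N ℕ.≤ m → N ℕ.≤ n → ∀ p q →
    ∣ p ∣ ≤ B → ∣ q ∣ ≤ B → ∣ p - q ∣ ≤ δ → ∣ F m p - F n q ∣ ≤ ε

  -- qᵏ / k!
  expTerm : ℚ → ℕ → ℚ
  expTerm q zero    = 1ℚ
  expTerm q (suc k) = expTerm q k * q * (+ 1 / suc k)

  expSum : ℕ → ℚ → ℚ
  expSum zero    q = 0ℚ
  expSum (suc n) q = expSum n q + expTerm q n

  module _ (B : ℚ) (0≤B : 0ℚ ≤ B) where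

    private
      t = expTerm B
      S = λ n → expSum n B

    expTerm-nonneg : ∀ k → 0ℚ ≤ t k
    expTerm-nonneg zero    = 0≤1
    expTerm-nonneg (suc k) = *-nonneg (*-nonneg (expTerm-nonneg k) 0≤B) (0≤/ 1 k)

    expTerm-bound : ∀ {q} → ∣ q ∣ ≤ B → ∀ k → ∣ expTerm q k ∣ ≤ t k
    expTerm-bound h zero    = ≤-refl
    expTerm-bound h (suc k) =
      ∣*∣-≤ (∣*∣-≤ (expTerm-bound h k) h) (≤-reflexive (ℚ.0≤p⇒∣p∣≡p (0≤/ 1 k)))

    expTerm-dist : ∀ {p q δ} → ∣ p ∣ ≤ B → ∣ q ∣ ≤ B → ∣ p - q ∣ ≤ δ → ∀ k →
                   ∣ expTerm p (suc k) - expTerm q (suc k) ∣ ≤ δ * t k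
    expTerm-dist {p} {q} {δ} hp hq h zero = ≤-trans
      (≤-reflexive (cong ∣_∣ (solve 2 (λ p q →
        con 1ℚ :* p :* con 1ℚ :- con 1ℚ :* q :* con 1ℚ := p :- q) refl p q)))
      (≤-trans h (≤-reflexive (sym (ℚ.*-identityʳ δ))))
    expTerm-dist {p} {q} {δ} hp hq h (suc k) = ≤-trans
      (≤-reflexive (cong ∣_∣ (solve 3 (λ x y u → x :* u :- y :* u := (x :- y) :* u) refl
        (expTerm p (suc k) * p) (expTerm q (suc k) * q) v)))
      (≤-trans
        (∣*∣-≤ (product-dist {expTerm p (suc k)} {p} {expTerm q (suc k)} {q}
                  (expTerm-bound hp (suc k)) hq (expTerm-dist hp hq h k) h)
               (≤-reflexive (ℚ.0≤p⇒∣p∣≡p (0≤/ 1 (suc k)))))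
        (≤-reflexive eq))
      where
      u = + 1 / suc k
      v = + 1 / suc (suc k)
      T = t (suc k)
      N = ℕ→ℚ (suc k)
      tB : N * T ≡ t k * B
      tB = trans (solve 4 (λ N u t B → N :* (t :* B :* u) := (t :* B) :* (N :* u)) refl N u (t k) B)
             (trans (cong (λ z → t k * B * z) (n*1/n k)) (ℚ.*-identityʳ _))
      eq : (T * δ + δ * t k * B) * v ≡ δ * T
      eq = trans (cong (λ z → (T * δ + z) * v)
                   (trans (ℚ.*-assoc δ (t k) B) (cong (δ *_) (sym tB))))
           (trans (solve 4 (λ T δ N v →
                    (T :* δ :+ δ :* (N :* T)) :* v := δ :* T :* ((con 1ℚ :+ N) :* v)) refl T δ N v)
           (trans (cong (λ z → δ * T * (z * v)) (sym (ℕ→ℚ-suc (suc k))))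
           (trans (cong (λ z → δ * T * z) (n*1/n (suc k))) (ℚ.*-identityʳ _))))

    expSum-dist : ∀ {p q δ} → ∣ p ∣ ≤ B → ∣ q ∣ ≤ B → ∣ p - q ∣ ≤ δ → ∀ n →
                  ∣ expSum (suc n) p - expSum (suc n) q ∣ ≤ δ * S n
    expSum-dist {δ = δ} hp hq h zero = ≤-reflexive (sym (ℚ.*-zeroʳ δ))
    expSum-dist {p} {q} {δ} hp hq h (suc n) = ≤-trans
      (≤-reflexive (cong ∣_∣ (solve 4 (λ a b c d → a :+ b :- (c :+ d) := (a :- c) :+ (b :- d)) refl
        (expSum (suc n) p) (expTerm p (suc n)) (expSum (suc n) q) (expTerm q (suc n)))))
      (≤-trans (∣+∣-≤ {expSum (suc n) p - expSum (suc n) q}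
                  (expSum-dist hp hq h n) (expTerm-dist hp hq h n))
        (≤-reflexive (sym (ℚ.*-distribˡ-+ δ (S n) (t n)))))

    expSum-mono : ∀ d n → S n ≤ S (d ℕ.+ n)
    expSum-mono zero    n = ≤-refl
    expSum-mono (suc d) n = ≤-trans (expSum-mono d n) (p+-nonneg (expTerm-nonneg (d ℕ.+ n)))

    expSum-gap : ∀ {q} → ∣ q ∣ ≤ B → ∀ d n →
                 ∣ expSum (d ℕ.+ n) q - expSum n q ∣ ≤ S (d ℕ.+ n) - S n
    expSum-gap {q} h zero n =
      ≤-reflexive (trans (cong ∣_∣ (ℚ.+-inverseʳ (expSum n q))) (sym (ℚ.+-inverseʳ (S n))))
    expSum-gap {q} h (suc d) n = ≤-trans
      (≤-reflexive (cong ∣_∣ (rearrange (expSum (d ℕ.+ n) q) (expTerm q (d ℕ.+ n)) (expSum n q))))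
      (≤-trans (∣+∣-≤ {expSum (d ℕ.+ n) q - expSum n q}
                  (expSum-gap h d n) (expTerm-bound h (d ℕ.+ n)))
        (≤-reflexive (sym (rearrange (S (d ℕ.+ n)) (t (d ℕ.+ n)) (S n)))))
      where
      rearrange : ∀ a b c → a + b - c ≡ a - c + b
      rearrange = solve 3 (λ a b c → a :+ b :- c := a :- c :+ b) refl

    private
      K : ℕ
      K = proj₁ (archimedean (B + B))

      expTerm-halves : ∀ n → K ℕ.≤ n → t (suc n) ≤ ½ * t n
      expTerm-halves n K≤n = by-diff (½ * (t n * ((N - (B + B)) * u)))
        (*-nonneg 0≤½ (*-nonneg (expTerm-nonneg n) (*-nonneg
          (diff-nonneg (≤-trans (proj₂ (archimedean (B + B)))
            (ℕ→ℚ-mono (ℕ.≤-trans K≤n (ℕ.n≤1+n n))))) (0≤/ 1 n))))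
        (trans (solve 4 (λ t B N u → t :* B :* u :+ con ½ :* (t :* ((N :- (B :+ B)) :* u))
                          := con ½ :* (t :* (N :* u))) refl (t n) B N u)
          (trans (cong (λ z → ½ * (t n * z)) (n*1/n n)) (cong (½ *_) (ℚ.*-identityʳ (t n)))))
        where
        N = ℕ→ℚ (suc n)
        u = + 1 / suc n

      expTerm-geometric : ∀ d → t (d ℕ.+ K) ≤ t K * ½^ d
      expTerm-geometric zero = ≤-reflexive (sym (ℚ.*-identityʳ (t K)))
      expTerm-geometric (suc d) = ≤-trans (expTerm-halves (d ℕ.+ K) (ℕ.m≤n+m K d))
        (≤-trans (*-monoˡ ½ 0≤½ (expTerm-geometric d))
          (≤-reflexive (solve 2 (λ t h → con ½ :* (t :* h) := t :* (con ½ :* h)) refl (t K) (½^ d))))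

      expSum-tail : ∀ d n → K ℕ.≤ n → S (d ℕ.+ n) ≤ S n + (t n + t n)
      expSum-tail zero n K≤n = p+-nonneg (+-nonneg (expTerm-nonneg n) (expTerm-nonneg n))
      expSum-tail (suc d) n K≤n = ≤-trans
        (≤-reflexive (cong S (sym (ℕ.+-suc d n))))
        (≤-trans (expSum-tail d (suc n) (ℕ.≤-trans K≤n (ℕ.n≤1+n n)))
        (by-diff ((½ * t n - t (suc n)) + (½ * t n - t (suc n)))
          (+-nonneg (diff-nonneg (expTerm-halves n K≤n)) (diff-nonneg (expTerm-halves n K≤n)))
          (solve 3 (λ S t t′ → let e = con ½ :* t :- t′ in
            S :+ t :+ (t′ :+ t′) :+ (e :+ e) := S :+ (t :+ t)) refl (S n) (t n) (t (suc n)))))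

    expSum-bounded : ∃ λ C → 0ℚ ≤ C × ∀ n → S n ≤ C
    expSum-bounded = C , ≤-trans (bound 0) ≤-refl , bound
      where
      C = S K + (t K + t K)
      bound : ∀ n → S n ≤ C
      bound n = ≤-trans (expSum-mono K n)
        (≤-trans (≤-reflexive (cong S (ℕ.+-comm K n))) (expSum-tail n K ℕ.≤-refl))

    expSum-tail-small : ∀ {ε} → 0ℚ < ε → ∃ λ N → ∀ d n → N ℕ.≤ n → S (d ℕ.+ n) - S n ≤ ε
    expSum-tail-small {ε} 0<ε = M ℕ.+ K , bound
      where
      T : ℚ
      T = t K + t K
      geometric : ∃ λ M → ∀ n → M ℕ.≤ n → T * ½^ n ≤ ε
      geometric = ½^-small T (+-nonneg (expTerm-nonneg K) (expTerm-nonneg K)) 0<ε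
      M : ℕ
      M = proj₁ geometric
      tail : ∀ d n → K ℕ.≤ n → S (d ℕ.+ n) - S n ≤ t n + t n
      tail d n K≤n = by-diff (S n + (t n + t n) - S (d ℕ.+ n)) (diff-nonneg (expSum-tail d n K≤n))
        (solve 3 (λ s t u → u :- s :+ (s :+ (t :+ t) :- u) := t :+ t) refl
          (S n) (t n) (S (d ℕ.+ n)))
      bound : ∀ d n → M ℕ.+ K ℕ.≤ n → S (d ℕ.+ n) - S n ≤ ε
      bound d n N≤n = ≤-trans (tail d n K≤n) (≤-trans doubled (proj₂ geometric e M≤e))
        where
        e = n ℕ.∸ K
        K≤n : K ℕ.≤ n
        K≤n = ℕ.≤-trans (ℕ.m≤n+m K M) N≤n
        M≤e : M ℕ.≤ e
        M≤e = ℕ.≤-trans (ℕ.≤-reflexive (sym (ℕ.m+n∸n≡m M K))) (ℕ.∸-monoˡ-≤ K N≤n)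
        tn≤ : t n ≤ t K * ½^ e
        tn≤ = ≤-trans (≤-reflexive (cong t (sym (ℕ.m∸n+n≡m K≤n)))) (expTerm-geometric e)
        doubled : t n + t n ≤ T * ½^ e
        doubled = ≤-trans (+-mono-≤ tn≤ tn≤)
          (≤-reflexive (sym (ℚ.*-distribʳ-+ (½^ e) (t K) (t K))))

  expSum-uniform : LocallyUniform expSum
  expSum-uniform B ε 0<ε = δ , proj₁ (proj₂ modulus) , suc N , uniform
    where
    A : ℚ
    A = ∣ B ∣
    0≤A : 0ℚ ≤ A
    0≤A = ℚ.0≤∣p∣ B
    C : ℚ
    C = proj₁ (expSum-bounded A 0≤A)
    bound : ∀ n → expSum n A ≤ C
    bound = proj₂ (proj₂ (expSum-bounded A 0≤A))
    small : ∃ λ N → ∀ d n → N ℕ.≤ n → expSum (d ℕ.+ n) A - expSum n A ≤ half ε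
    small = expSum-tail-small A 0≤A (half-pos 0<ε)
    N : ℕ
    N = proj₁ small
    modulus : ∃ λ δ → 0ℚ < δ × C * δ ≤ half ε
    modulus = shrink C (proj₁ (proj₂ (expSum-bounded A 0≤A))) (half-pos 0<ε)
    δ : ℚ
    δ = proj₁ modulus
    gap : ∀ {q} m n → ∣ q ∣ ≤ A → N ℕ.≤ m → m ℕ.≤ n →
          ∣ expSum n q - expSum m q ∣ ≤ half ε
    gap {q} m n hq N≤m m≤n = subst (λ k → ∣ expSum k q - expSum m q ∣ ≤ half ε) (ℕ.m∸n+n≡m m≤n)
      (≤-trans (expSum-gap A 0≤A hq (n ℕ.∸ m) m) (proj₂ small (n ℕ.∸ m) m N≤m))
    gap′ : ∀ {q} m n → ∣ q ∣ ≤ A → N ℕ.≤ m → N ℕ.≤ n →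
           ∣ expSum m q - expSum n q ∣ ≤ half ε
    gap′ {q} m n hq N≤m N≤n with ℕ.≤-total m n
    ... | inj₁ m≤n = ≤-trans (≤-reflexive (dist-sym (expSum m q) (expSum n q))) (gap m n hq N≤m m≤n)
    ... | inj₂ n≤m = gap n m hq N≤n n≤m
    dist : ∀ m {p q} → ∣ p ∣ ≤ A → ∣ q ∣ ≤ A → ∣ p - q ∣ ≤ δ →
           ∣ expSum (suc m) p - expSum (suc m) q ∣ ≤ half ε
    dist m {p} {q} hp hq h = ≤-trans (expSum-dist A 0≤A {p} {q} {δ} hp hq h m)
      (≤-trans (*-monoˡ δ (<⇒≤ (proj₁ (proj₂ modulus))) (bound m))
      (≤-trans (≤-reflexive (ℚ.*-comm δ C)) (proj₂ (proj₂ modulus))))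
    uniform : ∀ m n → suc N ℕ.≤ m → suc N ℕ.≤ n → ∀ p q →
              ∣ p ∣ ≤ B → ∣ q ∣ ≤ B → ∣ p - q ∣ ≤ δ → ∣ expSum m p - expSum n q ∣ ≤ ε
    uniform (suc m) (suc n) (ℕ.s≤s N≤m) (ℕ.s≤s N≤n) p q hp hq h = ≤-trans
      (triangle {expSum (suc m) p} {expSum (suc m) q} {expSum (suc n) q} {half ε} {half ε}
        (dist m (≤-trans hp (p≤∣p∣ B)) (≤-trans hq (p≤∣p∣ B)) h)
        (gap′ (suc m) (suc n) (≤-trans hq (p≤∣p∣ B))
          (ℕ.≤-trans N≤m (ℕ.n≤1+n m)) (ℕ.≤-trans N≤n (ℕ.n≤1+n n))))
      (≤-reflexive (half+half ε))

  -- Bisection: √(q ⊔ 0) lies between root n q and root n q + width n q.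

  width : ℕ → ℚ → ℚ
  width n q = (1ℚ + (q ⊔ 0ℚ)) * ½^ n

  root : ℕ → ℚ → ℚ
  root zero    q = 0ℚ
  root (suc n) q with root n q + width (suc n) q
  ... | mid with mid * mid ℚ.≤? q ⊔ 0ℚ
  ...   | yes _ = mid
  ...   | no  _ = root n q

  private
    0≤⊔0 : ∀ q → 0ℚ ≤ q ⊔ 0ℚ
    0≤⊔0 q = ℚ.p≤q⊔p q 0ℚ

  width-nonneg : ∀ n q → 0ℚ ≤ width n q
  width-nonneg n q = *-nonneg (+-nonneg 0≤1 (0≤⊔0 q)) (0≤½^ n)

  root-bounds : ∀ n q → 0ℚ ≤ root n q × root n q * root n q ≤ q ⊔ 0ℚ ×
    q ⊔ 0ℚ ≤ (root n q + width n q) * (root n q + width n q)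
  root-bounds zero q = ≤-refl , ≤-trans (≤-reflexive refl) (0≤⊔0 q) ,
    by-diff (1ℚ + (q ⊔ 0ℚ) + (q ⊔ 0ℚ) * (q ⊔ 0ℚ))
      (+-nonneg (+-nonneg 0≤1 (0≤⊔0 q)) (*-nonneg (0≤⊔0 q) (0≤⊔0 q)))
      (solve 1 (λ p → let w = con 0ℚ :+ (con 1ℚ :+ p) :* con 1ℚ in
        p :+ (con 1ℚ :+ p :+ p :* p) := w :* w) refl (q ⊔ 0ℚ))
  root-bounds (suc n) q with root-bounds n q
  ... | (0≤r , r²≤q , q≤) with (root n q + width (suc n) q) * (root n q + width (suc n) q) ℚ.≤? q ⊔ 0ℚ
  ...   | yes mid²≤q = +-nonneg 0≤r (width-nonneg (suc n) q) , mid²≤q ,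
          ≤-trans q≤ (≤-reflexive (cong (λ z → z * z)
            (solve 3 (λ r w h → r :+ w :* h := r :+ w :* (con ½ :* h) :+ w :* (con ½ :* h))
              refl (root n q) (1ℚ + (q ⊔ 0ℚ)) (½^ n))))
  ...   | no  mid²≰q = 0≤r , r²≤q , <⇒≤ (ℚ.≰⇒> mid²≰q)

  root-lower : ∀ {s} n q → s * s ≤ q ⊔ 0ℚ → s ≤ root n q + width n q
  root-lower n q s²≤q = let (0≤r , _ , q≤) = root-bounds n q in
    square-mono⁻¹ (+-nonneg 0≤r (width-nonneg n q)) (≤-trans s²≤q q≤)

  width-bound : ∀ {B q} n → ∣ q ∣ ≤ B → width n q ≤ (1ℚ + ∣ B ∣) * ½^ n
  width-bound {B} {q} n h = *-monoʳ (½^ n) (0≤½^ n) (ℚ.+-monoʳ-≤ 1ℚ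
    (ℚ.⊔-lub (≤-trans (p≤∣p∣ q) (≤-trans h (p≤∣p∣ B))) (ℚ.0≤∣p∣ B)))

  root-uniform : LocallyUniform root
  root-uniform B ε 0<ε = η * η , *-positive 0<η 0<η , proj₁ small ,
    λ m n N≤m N≤n p q hp hq h → dist-lub {root m p} {root n q} {ε}
      (one-sided m n p q N≤n hq h)
      (one-sided n m q p N≤m hp (≤-trans (≤-reflexive (dist-sym q p)) h))
    where
    η : ℚ
    η = half ε
    0<η : 0ℚ < η
    0<η = half-pos 0<ε
    small : ∃ λ N → ∀ n → N ℕ.≤ n → (1ℚ + ∣ B ∣) * ½^ n ≤ η
    small = ½^-small (1ℚ + ∣ B ∣) (+-nonneg 0≤1 (ℚ.0≤∣p∣ B)) 0<η
    one-sided : ∀ m n p q → proj₁ small ℕ.≤ n → ∣ q ∣ ≤ B → ∣ p - q ∣ ≤ η * η →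
                root m p ≤ root n q + ε
    one-sided m n p q N≤n hq h = ≤-trans r≤ (≤-trans (ℚ.+-monoˡ-≤ η w≤) (≤-reflexive sum≡))
      where
      w : ℚ
      w = root n q + width n q
      0≤w : 0ℚ ≤ w
      0≤w = +-nonneg (proj₁ (root-bounds n q)) (width-nonneg n q)
      shift : p ⊔ 0ℚ ≤ (q ⊔ 0ℚ) + η * η
      shift = dist-upper {p ⊔ 0ℚ} {q ⊔ 0ℚ} (≤-trans (⊔-lipschitz 0ℚ p q) h)
      expand : w * w + η * η ≤ (w + η) * (w + η)
      expand = by-diff (w * η + w * η)
        (+-nonneg (*-nonneg 0≤w (<⇒≤ 0<η)) (*-nonneg 0≤w (<⇒≤ 0<η)))
        (solve 2 (λ w η → w :* w :+ η :* η :+ (w :* η :+ w :* η) := (w :+ η) :* (w :+ η))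
          refl w η)
      r≤ : root m p ≤ w + η
      r≤ = square-mono⁻¹ (+-nonneg 0≤w (<⇒≤ 0<η))
        (≤-trans (proj₁ (proj₂ (root-bounds m p))) (≤-trans shift
        (≤-trans (ℚ.+-monoˡ-≤ (η * η) (proj₂ (proj₂ (root-bounds n q)))) expand)))
      w≤ : w ≤ root n q + η
      w≤ = ℚ.+-monoʳ-≤ (root n q) (≤-trans (width-bound {B} {q} n hq) (proj₂ small n N≤n))
      sum≡ : root n q + η + η ≡ root n q + ε
      sum≡ = trans (ℚ.+-assoc (root n q) η η) (cong (λ z → root n q + z) (half+half ε))

  module _ (c : ℚ) (0<c : 0ℚ < c) where

    private
      0<⊔c : ∀ q → 0ℚ < q ⊔ c
      0<⊔c q = ℚ.<-≤-trans 0<c (ℚ.p≤q⊔p q c)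

    recipAbove : ℚ → ℚ
    recipAbove q = (1/ (q ⊔ c)) {{ℚ.>-nonZero (0<⊔c q)}}

    recipAbove-inverse : ∀ q → (q ⊔ c) * recipAbove q ≡ 1ℚ
    recipAbove-inverse q = ℚ.*-inverseʳ (q ⊔ c) {{ℚ.>-nonZero (0<⊔c q)}}

    recipAbove-positive : ∀ q → 0ℚ < recipAbove q
    recipAbove-positive q =
      ℚ.positive⁻¹ _ {{ℚ.1/pos⇒pos (q ⊔ c) {{ℚ.positive (0<⊔c q)}}}}

    recipAbove-bound : ∀ q → ∣ recipAbove q ∣ ≤ proj₁ (inverse 0<c)
    recipAbove-bound q = ≤-trans (≤-reflexive (ℚ.0≤p⇒∣p∣≡p (<⇒≤ (recipAbove-positive q))))
      (by-diff (i * d * ((q ⊔ c) - c))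
        (*-nonneg (*-nonneg (<⇒≤ (recipAbove-positive q)) (<⇒≤ 0<d)) (diff-nonneg (ℚ.p≤q⊔p q c)))
        (trans (solve 4 (λ i d u c → i :+ i :* d :* (u :- c) := i :+ u :* i :* d :- i :* (c :* d))
                 refl i d (q ⊔ c) c)
          (trans (cong₂ (λ x y → i + x * d - i * y) (recipAbove-inverse q) cd≡1)
            (solve 2 (λ i d → i :+ con 1ℚ :* d :- i :* con 1ℚ := d) refl i d))))
      where
      i = recipAbove q
      d = proj₁ (inverse 0<c)
      0<d = proj₁ (proj₂ (inverse 0<c))
      cd≡1 = proj₂ (proj₂ (inverse 0<c))

    recipAbove-uniform : LocallyUniform (λ _ → recipAbove)
    recipAbove-uniform B ε 0<ε = proj₁ modulus , proj₁ (proj₂ modulus) , 0 ,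
      λ _ _ _ _ p q _ _ h → ≤-trans (dist p q (proj₁ modulus) h) (proj₂ (proj₂ modulus))
      where
      d : ℚ
      d = proj₁ (inverse 0<c)
      0≤d : 0ℚ ≤ d
      0≤d = <⇒≤ (proj₁ (proj₂ (inverse 0<c)))
      modulus : ∃ λ δ → 0ℚ < δ × d * d * δ ≤ ε
      modulus = shrink (d * d) (*-nonneg 0≤d 0≤d) 0<ε
      dist : ∀ p q δ → ∣ p - q ∣ ≤ δ → ∣ recipAbove p - recipAbove q ∣ ≤ d * d * δ
      dist p q δ h = ≤-trans (≤-reflexive (cong ∣_∣ (sym difference)))
        (∣*∣-≤ {i * j} {v - u} (∣*∣-≤ {i} {j} (recipAbove-bound p) (recipAbove-bound q))
          (≤-trans (≤-reflexive (dist-sym v u)) (≤-trans (⊔-lipschitz c p q) h)))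
        where
        i j u v : ℚ
        i = recipAbove p
        j = recipAbove q
        u = p ⊔ c
        v = q ⊔ c
        difference : i * j * (v - u) ≡ i - j
        difference =
          trans (solve 4 (λ i j u v → i :* j :* (v :- u) := v :* j :* i :- u :* i :* j) refl i j u v)
          (trans (cong₂ (λ x y → x * i - y * j) (recipAbove-inverse q) (recipAbove-inverse p))
            (cong₂ _-_ (ℚ.*-identityˡ i) (ℚ.*-identityˡ j)))

open RationalLemmas
open Approximations

Eventually : (ℕ → Set) → Set
Eventually P = ∃ λ N → ∀ n → N ℕ.≤ n → P n

eventually₂ : ∀ {P Q R : ℕ → Set} → (∀ n → P n → Q n → R n) →
              Eventually P → Eventually Q → Eventually R
eventually₂ f (M , p) (N , q) = M ℕ.⊔ N , λ n h →
  f n (p n (ℕ.m⊔n≤o⇒m≤o M N h)) (q n (ℕ.m⊔n≤o⇒n≤o M N h))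

eventually₁ : ∀ {P R : ℕ → Set} → (∀ n → P n → R n) → Eventually P → Eventually R
eventually₁ f (M , p) = M , λ n h → f n (p n h)

record ℝ : Set where
  no-eta-equality
  field
    seq    : ℕ → ℚ
    cauchy : ∀ ε → 0ℚ ℚ.< ε → ∃ λ N →
             ∀ m n → N ℕ.≤ m → N ℕ.≤ n → ℚ.∣ seq m ℚ.- seq n ∣ ℚ.≤ ε
open ℝ public

infixl 6 _+_ _-_
infixl 7 _*_ _÷_
infix  8 -_ √_
infix  4 _≤_ _<_ _⟶_

fromℚ : ℚ → ℝ
fromℚ q .seq _ = q
fromℚ q .cauchy ε 0<ε = 0 , λ _ _ _ _ →
  ℚ.≤-trans (ℚ.≤-reflexive (cong ℚ.∣_∣ (ℚ.+-inverseʳ q))) (ℚ.<⇒≤ 0<ε)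

fromℤ : ℤ → ℝ
fromℤ i .seq _  = i ℚ./ 1
fromℤ i .cauchy = fromℚ (i ℚ./ 1) .cauchy

fromℕ : ℕ → ℝ
fromℕ n .seq _  = + n ℚ./ 1
fromℕ n .cauchy = fromℚ (+ n ℚ./ 1) .cauchy

0ℝ : ℝ
0ℝ = fromℚ 0ℚ

1ℝ : ℝ
1ℝ = fromℚ 1ℚ

bounded : (x : ℝ) → ∃ λ B → 0ℚ ℚ.≤ B × ∀ n → ℚ.∣ seq x n ∣ ℚ.≤ B
bounded x = B , ℚ.≤-trans (ℚ.0≤∣p∣ (seq x 0)) (bound 0) , bound
  where
  initial : ∀ N → ∃ λ C → ∀ n → n ℕ.≤ N → ℚ.∣ seq x n ∣ ℚ.≤ C
  initial zero = ℚ.∣ seq x 0 ∣ , λ { .0 ℕ.z≤n → ℚ.≤-refl }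
  initial (suc N) = proj₁ (initial N) ℚ.⊔ ℚ.∣ seq x (suc N) ∣ , λ n n≤ → below n (ℕ.m≤n⇒m<n∨m≡n n≤)
    where
    below : ∀ n → n ℕ.< suc N ⊎ n ≡ suc N →
            ℚ.∣ seq x n ∣ ℚ.≤ proj₁ (initial N) ℚ.⊔ ℚ.∣ seq x (suc N) ∣
    below n (inj₁ (ℕ.s≤s n≤N)) = ℚ.≤-trans (proj₂ (initial N) n n≤N)
      (ℚ.p≤p⊔q (proj₁ (initial N)) ℚ.∣ seq x (suc N) ∣)
    below n (inj₂ refl) = ℚ.p≤q⊔p (proj₁ (initial N)) ℚ.∣ seq x (suc N) ∣
  N : ℕ
  N = proj₁ (cauchy x 1ℚ 0<1)
  C : ℚ
  C = proj₁ (initial N)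
  B : ℚ
  B = C ℚ.+ 1ℚ
  bound : ∀ n → ℚ.∣ seq x n ∣ ℚ.≤ B
  bound n with ℕ.≤-total n N
  ... | inj₁ n≤N = ℚ.≤-trans (proj₂ (initial N) n n≤N) (p+-nonneg {C} {1ℚ} 0≤1)
  ... | inj₂ N≤n = ℚ.≤-trans
    (ℚ.≤-reflexive (cong ℚ.∣_∣ (+-*-Solver.solve 2 (λ a b → a := b :+ (a :- b)) refl (seq x n) (seq x N))))
    (∣+∣-≤ {seq x N} {seq x n ℚ.- seq x N} {C} {1ℚ} (proj₂ (initial N) N ℕ.≤-refl)
      (proj₂ (cauchy x 1ℚ 0<1) n N N≤n ℕ.≤-refl))
    where open +-*-Solver

_+_ : ℝ → ℝ → ℝ
(x + y) .seq n = seq x n ℚ.+ seq y n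
(x + y) .cauchy ε 0<ε with cauchy x (half ε) (half-pos 0<ε) | cauchy y (half ε) (half-pos 0<ε)
... | (M , p) | (N , q) = M ℕ.⊔ N , λ m n hm hn → ℚ.≤-trans
  (ℚ.≤-reflexive (cong ℚ.∣_∣ (solve 4 (λ a b c d → a :+ b :- (c :+ d) := (a :- c) :+ (b :- d)) refl
    (seq x m) (seq y m) (seq x n) (seq y n))))
  (ℚ.≤-trans (∣+∣-≤ {seq x m ℚ.- seq x n} {seq y m ℚ.- seq y n} {half ε} {half ε}
      (p m n (ℕ.m⊔n≤o⇒m≤o M N hm) (ℕ.m⊔n≤o⇒m≤o M N hn))
      (q m n (ℕ.m⊔n≤o⇒n≤o M N hm) (ℕ.m⊔n≤o⇒n≤o M N hn)))
    (ℚ.≤-reflexive (half+half ε)))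
  where open +-*-Solver

-_ : ℝ → ℝ
(- x) .seq n = ℚ.- seq x n
(- x) .cauchy ε 0<ε with cauchy x ε 0<ε
... | (N , p) = N , λ m n hm hn → ℚ.≤-trans
  (ℚ.≤-reflexive (cong ℚ.∣_∣ (solve 2 (λ a b → :- a :- (:- b) := b :- a) refl (seq x m) (seq x n))))
  (p n m hn hm)
  where open +-*-Solver

_-_ : ℝ → ℝ → ℝ
x - y = x + - y

_*_ : ℝ → ℝ → ℝ
(x * y) .seq n = seq x n ℚ.* seq y n
(x * y) .cauchy ε 0<ε = proj₁ cx ℕ.⊔ proj₁ cy , λ m n hm hn → ℚ.≤-trans
  (product-dist {seq x m} {seq y m} {seq x n} {seq y n} {B} {C} {δ₁} {δ₂}
    (proj₂ (proj₂ (bounded x)) m) (proj₂ (proj₂ (bounded y)) n)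
    (proj₂ cx m n (ℕ.m⊔n≤o⇒m≤o (proj₁ cx) (proj₁ cy) hm) (ℕ.m⊔n≤o⇒m≤o (proj₁ cx) (proj₁ cy) hn))
    (proj₂ cy m n (ℕ.m⊔n≤o⇒n≤o (proj₁ cx) (proj₁ cy) hm) (ℕ.m⊔n≤o⇒n≤o (proj₁ cx) (proj₁ cy) hn)))
  total
  where
  B C : ℚ
  B = proj₁ (bounded x)
  C = proj₁ (bounded y)
  s₁ : ∃ λ δ → 0ℚ ℚ.< δ × C ℚ.* δ ℚ.≤ half ε
  s₁ = shrink C (proj₁ (proj₂ (bounded y))) (half-pos 0<ε)
  s₂ : ∃ λ δ → 0ℚ ℚ.< δ × B ℚ.* δ ℚ.≤ half ε
  s₂ = shrink B (proj₁ (proj₂ (bounded x))) (half-pos 0<ε)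
  δ₁ δ₂ : ℚ
  δ₁ = proj₁ s₁
  δ₂ = proj₁ s₂
  cx : ∃ λ N → ∀ m n → N ℕ.≤ m → N ℕ.≤ n → ℚ.∣ seq x m ℚ.- seq x n ∣ ℚ.≤ δ₁
  cx = cauchy x δ₁ (proj₁ (proj₂ s₁))
  cy : ∃ λ N → ∀ m n → N ℕ.≤ m → N ℕ.≤ n → ℚ.∣ seq y m ℚ.- seq y n ∣ ℚ.≤ δ₂
  cy = cauchy y δ₂ (proj₁ (proj₂ s₂))
  total : B ℚ.* δ₂ ℚ.+ δ₁ ℚ.* C ℚ.≤ ε
  total = ℚ.≤-trans (ℚ.+-mono-≤ (proj₂ (proj₂ s₂))
      (ℚ.≤-trans (ℚ.≤-reflexive (ℚ.*-comm δ₁ C)) (proj₂ (proj₂ s₁))))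
    (ℚ.≤-reflexive (half+half ε))

∣_∣ : ℝ → ℝ
∣ x ∣ .seq n = ℚ.∣ seq x n ∣
∣ x ∣ .cauchy ε 0<ε with cauchy x ε 0<ε
... | (N , p) = N , λ m n hm hn → ℚ.≤-trans (∣∣-lipschitz (seq x m) (seq x n)) (p m n hm hn)

-- The diagonal n ↦ F n (xₙ).
lift : (F : ℕ → ℚ → ℚ) → LocallyUniform F → ℝ → ℝ
lift F u x .seq n = F n (seq x n)
lift F u x .cauchy ε 0<ε = N ℕ.⊔ proj₁ cx , λ m n hm hn →
  h m n (ℕ.m⊔n≤o⇒m≤o N (proj₁ cx) hm) (ℕ.m⊔n≤o⇒m≤o N (proj₁ cx) hn) (seq x m) (seq x n)
    (proj₂ (proj₂ (bounded x)) m) (proj₂ (proj₂ (bounded x)) n)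
    (proj₂ cx m n (ℕ.m⊔n≤o⇒n≤o N (proj₁ cx) hm) (ℕ.m⊔n≤o⇒n≤o N (proj₁ cx) hn))
  where
  B : ℚ
  B = proj₁ (bounded x)
  δ : ℚ
  δ = proj₁ (u B ε 0<ε)
  N : ℕ
  N = proj₁ (proj₂ (proj₂ (u B ε 0<ε)))
  h : ∀ m n → N ℕ.≤ m → N ℕ.≤ n → ∀ p q → ℚ.∣ p ∣ ℚ.≤ B → ℚ.∣ q ∣ ℚ.≤ B →
      ℚ.∣ p ℚ.- q ∣ ℚ.≤ δ → ℚ.∣ F m p ℚ.- F n q ∣ ℚ.≤ ε
  h = proj₂ (proj₂ (proj₂ (u B ε 0<ε)))
  cx : ∃ λ N → ∀ m n → N ℕ.≤ m → N ℕ.≤ n → ℚ.∣ seq x m ℚ.- seq x n ∣ ℚ.≤ δ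
  cx = cauchy x δ (proj₁ (proj₂ (u B ε 0<ε)))

exp : ℝ → ℝ
exp = lift expSum expSum-uniform

-- Takes the value 0 at negative arguments.
√_ : ℝ → ℝ
√_ = lift root root-uniform

record _≤_ (x y : ℝ) : Set where
  field within : ∀ ε → 0ℚ ℚ.< ε → Eventually λ n → seq x n ℚ.≤ seq y n ℚ.+ ε
open _≤_ public

record _<_ (x y : ℝ) : Set where
  field
    gap     : ℚ
    gap-pos : 0ℚ ℚ.< gap
    apart   : Eventually λ n → seq x n ℚ.+ gap ℚ.≤ seq y n
open _<_ public

-- The cut-off at the gap leaves all late entries of y unchanged, so the value
-- does not depend on which proof of positivity is supplied.
_÷_ : (x y : ℝ) {{_ : 0ℝ < y}} → ℝ
_÷_ x y {{0<y}} =
  x * lift (λ _ → recipAbove (gap 0<y) (gap-pos 0<y)) (recipAbove-uniform (gap 0<y) (gap-pos 0<y)) y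

instance
  fromℕ-positive : ∀ {n} .{{_ : ℕ.NonZero n}} → 0ℝ < fromℕ n
  fromℕ-positive .gap     = 1ℚ
  fromℕ-positive .gap-pos = 0<1
  fromℕ-positive {suc n} .apart = 0 , λ _ _ → 1≤ℕ→ℚ-suc n

  *-positive-ℝ : ∀ {x y} {{_ : 0ℝ < x}} {{_ : 0ℝ < y}} → 0ℝ < x * y
  *-positive-ℝ {{p}} {{q}} .gap     = gap p ℚ.* gap q
  *-positive-ℝ {{p}} {{q}} .gap-pos = *-positive (gap-pos p) (gap-pos q)
  *-positive-ℝ {x} {y} {{p}} {{q}} .apart = eventually₂ (λ n h k →
      ℚ.≤-trans (ℚ.≤-reflexive (ℚ.+-identityˡ (gap p ℚ.* gap q)))
        (*-mono (drop0 (gap-nonneg p) h) (gap-nonneg q)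
          (≤-drop {gap p} h) (≤-drop {gap q} k)))
    (apart p) (apart q)
    where
    gap-nonneg : ∀ {z} (r : 0ℝ < z) → 0ℚ ℚ.≤ gap r
    gap-nonneg r = ℚ.<⇒≤ (gap-pos r)
    ≤-drop : ∀ {g s} → 0ℚ ℚ.+ g ℚ.≤ s → g ℚ.≤ s
    ≤-drop {g} h = ℚ.≤-trans (ℚ.≤-reflexive (sym (ℚ.+-identityˡ g))) h
    drop0 : ∀ {g s} → 0ℚ ℚ.≤ g → 0ℚ ℚ.+ g ℚ.≤ s → 0ℚ ℚ.≤ s
    drop0 {g} {s} 0≤g h = ℚ.≤-trans 0≤g (≤-drop {g} {s} h)

  √-positive : ∀ {x} {{_ : 0ℝ < x}} → 0ℝ < √ x
  √-positive {x} {{p}} .gap     = half (gap p ℚ.⊓ 1ℚ)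
  √-positive {x} {{p}} .gap-pos = half-pos (⊓-pos (gap-pos p))
    where
    ⊓-pos : ∀ {g} → 0ℚ ℚ.< g → 0ℚ ℚ.< g ℚ.⊓ 1ℚ
    ⊓-pos {g} 0<g with ℚ.≤-total g 1ℚ
    ... | inj₁ g≤1 = ℚ.<-≤-trans 0<g (ℚ.≤-reflexive (sym (ℚ.p≤q⇒p⊓q≡p g≤1)))
    ... | inj₂ 1≤g = ℚ.<-≤-trans 0<1 (ℚ.≤-reflexive (sym (ℚ.p≥q⇒p⊓q≡q 1≤g)))
  √-positive {x} {{p}} .apart = eventually₂ bound (apart p) small
    where
    open +-*-Solver
    g : ℚ
    g = gap p ℚ.⊓ 1ℚ
    0<g/2 : 0ℚ ℚ.< half g
    0<g/2 = gap-pos (√-positive {x} {{p}})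
    0≤g : 0ℚ ℚ.≤ g
    0≤g = ℚ.⊓-glb (ℚ.<⇒≤ (gap-pos p)) 0≤1
    B : ℚ
    B = proj₁ (bounded x)
    small : Eventually λ n → (1ℚ ℚ.+ ℚ.∣ B ∣) ℚ.* ½^ n ℚ.≤ half g
    small = ½^-small (1ℚ ℚ.+ ℚ.∣ B ∣) (+-nonneg 0≤1 (ℚ.0≤∣p∣ B)) 0<g/2
    g²≤gap : g ℚ.* g ℚ.≤ gap p
    g²≤gap = ℚ.≤-trans (*-mono (ℚ.<⇒≤ (gap-pos p)) 0≤g (ℚ.p⊓q≤p (gap p) 1ℚ) (ℚ.p⊓q≤q (gap p) 1ℚ))
      (ℚ.≤-reflexive (ℚ.*-identityʳ (gap p)))
    bound : ∀ n → 0ℚ ℚ.+ gap p ℚ.≤ seq x n → (1ℚ ℚ.+ ℚ.∣ B ∣) ℚ.* ½^ n ℚ.≤ half g →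
            0ℚ ℚ.+ half g ℚ.≤ root n (seq x n)
    bound n h k = by-diff (r ℚ.+ half g ℚ.- g) (diff-nonneg g≤)
      (solve 2 (λ g r → con 0ℚ :+ con ½ :* g :+ (r :+ con ½ :* g :- g) := r) refl g r)
      where
      r : ℚ
      r = root n (seq x n)
      g² : g ℚ.* g ℚ.≤ seq x n ℚ.⊔ 0ℚ
      g² = ℚ.≤-trans g²≤gap (ℚ.≤-trans (ℚ.≤-reflexive (sym (ℚ.+-identityˡ (gap p))))
        (ℚ.≤-trans h (ℚ.p≤p⊔q (seq x n) 0ℚ)))
      g≤ : g ℚ.≤ r ℚ.+ half g
      g≤ = ℚ.≤-trans (root-lower n (seq x n) g²) (ℚ.+-monoʳ-≤ r
        (ℚ.≤-trans (width-bound {B} {seq x n} n (proj₂ (proj₂ (bounded x)) n)) k))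

-- f 0 + … + f (n - 1)
∑ : ℕ → (ℕ → ℝ) → ℝ
∑ zero    f = 0ℝ
∑ (suc n) f = ∑ n f + f n

_⟶_ : (ℕ → ℝ) → ℝ → Set
f ⟶ l = ∀ ε → 0ℚ ℚ.< ε → Eventually λ n → ∣ f n - l ∣ ≤ fromℚ ε

HasSum : (ℕ → ℝ) → ℝ → Set
HasSum f l = (λ n → ∑ n f) ⟶ l

CauchySequence : (ℕ → ℝ) → Set
CauchySequence f = ∀ ε → 0ℚ ℚ.< ε → ∃ λ N →
  ∀ m n → N ℕ.≤ m → N ℕ.≤ n → ∣ f m - f n ∣ ≤ fromℚ ε

module Limit (f : ℕ → ℝ) (c : CauchySequence f) where

  private
    unit : ℕ → ℚ
    unit k = + 1 ℚ./ suc k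

    unit-pos : ∀ k → 0ℚ ℚ.< unit k
    unit-pos k = ℚ.positive⁻¹ (unit k) {{ℚ.normalize-pos 1 (suc k)}}

    index : ℕ → ℕ
    index k = proj₁ (cauchy (f k) (unit k) (unit-pos k))

    near : ∀ k j → index k ℕ.≤ j → ℚ.∣ seq (f k) (index k) ℚ.- seq (f k) j ∣ ℚ.≤ unit k
    near k j h = proj₂ (cauchy (f k) (unit k) (unit-pos k)) (index k) j ℕ.≤-refl h

    close : ∀ {e} → 0ℚ ℚ.< e → ∀ {m n} → ∣ f m - f n ∣ ≤ fromℚ e →
            Eventually λ j → ℚ.∣ seq (f m) j ℚ.- seq (f n) j ∣ ℚ.≤ e ℚ.+ e
    close {e} 0<e h = within h e 0<e

    units-small : ∀ {e} → 0ℚ ℚ.< e → ∃ λ N → ∀ n → N ℕ.≤ n → unit n ℚ.≤ e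
    units-small {e} 0<e = proj₁ s , λ n h → ℚ.≤-trans
      (ℚ.≤-reflexive (sym (ℚ.*-identityˡ (unit n)))) (proj₂ s n h)
      where
      s : ∃ λ N → ∀ n → N ℕ.≤ n → 1ℚ ℚ.* unit n ℚ.≤ e
      s = 1/n-small 1ℚ 0≤1 0<e

    quarters : ∀ ε → let e = half (half ε) in e ℚ.+ (e ℚ.+ e ℚ.+ e) ≡ ε
    quarters = solve 1 (λ ε → let e = con ½ :* (con ½ :* ε) in e :+ (e :+ e :+ e) := ε) refl
      where open +-*-Solver

  lim : ℝ
  lim .seq k = seq (f k) (index k)
  lim .cauchy ε 0<ε = N , bound
    where
    e : ℚ
    e = half (half ε)
    0<e : 0ℚ ℚ.< e
    0<e = half-pos (half-pos 0<ε)
    N₁ N₂ N : ℕ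
    N₁ = proj₁ (c e 0<e)
    N₂ = proj₁ (units-small 0<e)
    N  = N₁ ℕ.⊔ N₂
    bound : ∀ m n → N ℕ.≤ m → N ℕ.≤ n →
            ℚ.∣ seq (f m) (index m) ℚ.- seq (f n) (index n) ∣ ℚ.≤ ε
    bound m n hm hn = ℚ.≤-trans
      (triangle {seq (f m) (index m)} {seq (f m) j} {seq (f n) (index n)} {e} {e ℚ.+ e ℚ.+ e}
        (ℚ.≤-trans (near m j jm) (proj₂ (units-small 0<e) m (ℕ.m⊔n≤o⇒n≤o N₁ N₂ hm)))
        (triangle {seq (f m) j} {seq (f n) j} {seq (f n) (index n)} {e ℚ.+ e} {e}
          (proj₂ ev j jev)
          (ℚ.≤-trans (ℚ.≤-reflexive (dist-sym (seq (f n) j) (seq (f n) (index n))))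
            (ℚ.≤-trans (near n j jn) (proj₂ (units-small 0<e) n (ℕ.m⊔n≤o⇒n≤o N₁ N₂ hn))))))
      (ℚ.≤-reflexive (quarters ε))
      where
      ev : Eventually λ j → ℚ.∣ seq (f m) j ℚ.- seq (f n) j ∣ ℚ.≤ e ℚ.+ e
      ev = close 0<e (proj₂ (c e 0<e) m n (ℕ.m⊔n≤o⇒m≤o N₁ N₂ hm) (ℕ.m⊔n≤o⇒m≤o N₁ N₂ hn))
      j : ℕ
      j = index m ℕ.⊔ index n ℕ.⊔ proj₁ ev
      jm : index m ℕ.≤ j
      jm = ℕ.≤-trans (ℕ.m≤m⊔n (index m) (index n)) (ℕ.m≤m⊔n _ (proj₁ ev))
      jn : index n ℕ.≤ j
      jn = ℕ.≤-trans (ℕ.m≤n⊔m (index m) (index n)) (ℕ.m≤m⊔n _ (proj₁ ev))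
      jev : proj₁ ev ℕ.≤ j
      jev = ℕ.m≤n⊔m (index m ℕ.⊔ index n) (proj₁ ev)

  lim-converges : f ⟶ lim
  lim-converges ε 0<ε = N₁ , λ n hn → record { within = λ η 0<η → bound n hn η 0<η }
    where
    e : ℚ
    e = half (half ε)
    0<e : 0ℚ ℚ.< e
    0<e = half-pos (half-pos 0<ε)
    N₁ N₂ : ℕ
    N₁ = proj₁ (c e 0<e)
    N₂ = proj₁ (units-small 0<e)
    bound : ∀ n → N₁ ℕ.≤ n → ∀ η → 0ℚ ℚ.< η →
            Eventually λ j → ℚ.∣ seq (f n) j ℚ.- seq (f j) (index j) ∣ ℚ.≤ ε ℚ.+ η
    bound n hn η 0<η = M ℕ.⊔ (N₁ ℕ.⊔ N₂) , at
      where
      M : ℕ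
      M = proj₁ (cauchy (f n) e 0<e)
      at : ∀ j → M ℕ.⊔ (N₁ ℕ.⊔ N₂) ℕ.≤ j →
           ℚ.∣ seq (f n) j ℚ.- seq (f j) (index j) ∣ ℚ.≤ ε ℚ.+ η
      at j hj = ℚ.≤-trans
        (triangle {seq (f n) j} {seq (f n) i} {seq (f j) (index j)} {e} {e ℚ.+ e ℚ.+ e}
          (proj₂ (cauchy (f n) e 0<e) j i hM (ℕ.≤-trans hM ji))
          (triangle {seq (f n) i} {seq (f j) i} {seq (f j) (index j)} {e ℚ.+ e} {e}
            (proj₂ ev i (ℕ.m≤n⊔m (j ℕ.⊔ index j) (proj₁ ev)))
            (ℚ.≤-trans (ℚ.≤-reflexive (dist-sym (seq (f j) i) (seq (f j) (index j))))
              (ℚ.≤-trans (near j i (ℕ.≤-trans (ℕ.m≤n⊔m j (index j)) (ℕ.m≤m⊔n _ (proj₁ ev))))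
                (proj₂ (units-small 0<e) j (ℕ.m⊔n≤o⇒n≤o N₁ N₂ hN))))))
        (ℚ.≤-trans (ℚ.≤-reflexive (quarters ε)) (p+-nonneg {ε} {η} (ℚ.<⇒≤ 0<η)))
        where
        hM : M ℕ.≤ j
        hM = ℕ.m⊔n≤o⇒m≤o M (N₁ ℕ.⊔ N₂) hj
        hN : N₁ ℕ.⊔ N₂ ℕ.≤ j
        hN = ℕ.m⊔n≤o⇒n≤o M (N₁ ℕ.⊔ N₂) hj
        ev : Eventually λ i → ℚ.∣ seq (f n) i ℚ.- seq (f j) i ∣ ℚ.≤ e ℚ.+ e
        ev = close 0<e (proj₂ (c e 0<e) n j hn (ℕ.m⊔n≤o⇒m≤o N₁ N₂ hN))
        i : ℕ
        i = j ℕ.⊔ index j ℕ.⊔ proj₁ ev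
        ji : j ℕ.≤ i
        ji = ℕ.≤-trans (ℕ.m≤m⊔n j (index j)) (ℕ.m≤m⊔n _ (proj₁ ev))

open Limit public using (lim; lim-converges)

-- Uniform continuity on every bounded set.
Continuous : (ℝ → ℝ) → Set
Continuous f = ∀ B ε → 0ℚ ℚ.< ε → ∃ λ δ → 0ℚ ℚ.< δ × (∀ x y →
  ∣ x ∣ ≤ fromℚ B → ∣ y ∣ ≤ fromℚ B → ∣ x - y ∣ ≤ fromℚ δ → ∣ f x - f y ∣ ≤ fromℚ ε)

lift-continuous : ∀ F (u : LocallyUniform F) → Continuous (lift F u)
lift-continuous F u B ε 0<ε = half δ , half-pos 0<δ , λ x y hx hy h →
  record { within = λ η 0<η → bound x y hx hy h η 0<η }
  where
  A : ℚ
  A = B ℚ.+ 1ℚ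
  δ : ℚ
  δ = proj₁ (u A ε 0<ε)
  0<δ : 0ℚ ℚ.< δ
  0<δ = proj₁ (proj₂ (u A ε 0<ε))
  N : ℕ
  N = proj₁ (proj₂ (proj₂ (u A ε 0<ε)))
  bound : ∀ x y → ∣ x ∣ ≤ fromℚ B → ∣ y ∣ ≤ fromℚ B → ∣ x - y ∣ ≤ fromℚ (half δ) →
          ∀ η → 0ℚ ℚ.< η →
          Eventually λ n → ℚ.∣ F n (seq x n) ℚ.- F n (seq y n) ∣ ℚ.≤ ε ℚ.+ η
  bound x y hx hy h η 0<η =
    eventually₂ (λ n p q → p q)
      (eventually₂ (λ n p q → p q)
        (eventually₂ (λ n N≤n p q r → ℚ.≤-trans
            (proj₂ (proj₂ (proj₂ (u A ε 0<ε))) n n N≤n N≤n (seq x n) (seq y n) p q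
              (ℚ.≤-trans r (ℚ.≤-reflexive (half+half δ))))
            (p+-nonneg {ε} {η} (ℚ.<⇒≤ 0<η)))
          (N , λ n N≤n → N≤n) (within hx 1ℚ 0<1))
        (within hy 1ℚ 0<1))
      (within h (half δ) (half-pos 0<δ))

≤-pointwise : ∀ {x y} → (∀ n → seq x n ℚ.≤ seq y n) → x ≤ y
≤-pointwise {x} {y} h = record { within = λ ε 0<ε →
  0 , λ n _ → ℚ.≤-trans (h n) (p+-nonneg {seq y n} {ε} (ℚ.<⇒≤ 0<ε)) }

≤-trans-pointwise : ∀ {x y z} → (∀ n → seq x n ℚ.≤ seq y n) → y ≤ z → x ≤ z
≤-trans-pointwise h y≤z = record { within = λ ε 0<ε →
  eventually₁ (λ n p → ℚ.≤-trans (h n) p) (within y≤z ε 0<ε) }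

-- Covers t ↦ - (t * t) and t ↦ 1 - t * t.
parabola-continuous : ∀ f → Continuous f → ∀ c (g : ℝ → ℝ) →
  (∀ t n → seq (g t) n ≡ c ℚ.- seq t n ℚ.* seq t n) → Continuous (λ t → f (g t))
parabola-continuous f cont c g eq B ε 0<ε = δ , 0<δ , λ x y hx hy h →
  proj₂ (proj₂ (cont C ε 0<ε)) (g x) (g y) (bound x hx) (bound y hy) (dist x y hx hy h)
  where
  A C γ δ : ℚ
  A = ℚ.∣ B ∣ ℚ.+ 1ℚ
  C = ℚ.∣ c ∣ ℚ.+ A ℚ.* A
  0≤A : 0ℚ ℚ.≤ A
  0≤A = +-nonneg (ℚ.0≤∣p∣ B) 0≤1
  γ = proj₁ (cont C ε 0<ε)
  modulus : ∃ λ δ → 0ℚ ℚ.< δ × (A ℚ.+ A) ℚ.* δ ℚ.≤ γ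
  modulus = shrink (A ℚ.+ A) (+-nonneg 0≤A 0≤A) (proj₁ (proj₂ (cont C ε 0<ε)))
  δ = half (proj₁ modulus)
  0<δ : 0ℚ ℚ.< δ
  0<δ = half-pos (proj₁ (proj₂ modulus))
  eventually-≤ : ∀ x → ∣ x ∣ ≤ fromℚ B → Eventually λ n → ℚ.∣ seq x n ∣ ℚ.≤ A
  eventually-≤ x h = eventually₁
    (λ n p → ℚ.≤-trans p (ℚ.+-monoˡ-≤ 1ℚ (p≤∣p∣ B))) (within h 1ℚ 0<1)
  bound : ∀ x → ∣ x ∣ ≤ fromℚ B → ∣ g x ∣ ≤ fromℚ C
  bound x h = record { within = λ η 0<η → eventually₁ (λ n p → ℚ.≤-trans
    (ℚ.≤-reflexive (cong ℚ.∣_∣ (eq x n)))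
    (ℚ.≤-trans (∣-∣-≤ {c} {seq x n ℚ.* seq x n} ℚ.≤-refl (∣*∣-≤ {seq x n} {seq x n} p p))
      (p+-nonneg {C} {η} (ℚ.<⇒≤ 0<η)))) (eventually-≤ x h) }
  dist : ∀ x y → ∣ x ∣ ≤ fromℚ B → ∣ y ∣ ≤ fromℚ B → ∣ x - y ∣ ≤ fromℚ δ →
         ∣ g x - g y ∣ ≤ fromℚ γ
  dist x y hx hy h = record { within = λ η 0<η → eventually₂ (λ n p q → p q)
    (eventually₂ (λ n p q r → ℚ.≤-trans (ℚ.≤-reflexive (cong ℚ.∣_∣ (difference n)))
        (ℚ.≤-trans (∣*∣-≤ {seq x n ℚ.+ seq y n} {seq y n ℚ.- seq x n} {A ℚ.+ A} {proj₁ modulus}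
            (∣+∣-≤ {seq x n} {seq y n} p q)
            (ℚ.≤-trans (ℚ.≤-reflexive (dist-sym (seq y n) (seq x n)))
              (ℚ.≤-trans r (ℚ.≤-reflexive (half+half (proj₁ modulus))))))
        (ℚ.≤-trans (proj₂ (proj₂ modulus)) (p+-nonneg {γ} {η} (ℚ.<⇒≤ 0<η)))))
      (eventually-≤ x hx) (eventually-≤ y hy))
    (within h δ 0<δ) }
    where
    difference : ∀ n → seq (g x) n ℚ.- seq (g y) n ≡
                 (seq x n ℚ.+ seq y n) ℚ.* (seq y n ℚ.- seq x n)
    difference n = trans (cong₂ ℚ._-_ (eq x n) (eq y n))
      (solve 3 (λ c a b → c :- a :* a :- (c :- b :* b) := (a :+ b) :* (b :- a)) refl
        c (seq x n) (seq y n))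
      where open +-*-Solver

∣∣≤-cong : ∀ {x y K} → (∀ n → seq y n ≡ seq x n) → ∣ x ∣ ≤ K → ∣ y ∣ ≤ K
∣∣≤-cong eq = ≤-trans-pointwise (λ n → ℚ.≤-reflexive (cong ℚ.∣_∣ (eq n)))

∣∣≤-mono : ∀ {x K L} → K ℚ.≤ L → ∣ x ∣ ≤ fromℚ K → ∣ x ∣ ≤ fromℚ L
∣∣≤-mono {x} {K} {L} K≤L h = record { within = λ η 0<η →
  eventually₁ (λ n p → ℚ.≤-trans p (ℚ.+-monoˡ-≤ η K≤L)) (within h η 0<η) }

∣∣≤-+ : ∀ {x y K L} → ∣ x ∣ ≤ fromℚ K → ∣ y ∣ ≤ fromℚ L → ∣ x + y ∣ ≤ fromℚ (K ℚ.+ L)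
∣∣≤-+ {x} {y} {K} {L} h k = record { within = λ η 0<η → eventually₂ (λ n p q → ℚ.≤-trans
    (∣+∣-≤ {seq x n} {seq y n} p q) (ℚ.≤-reflexive (regroup η)))
  (within h (half η) (half-pos 0<η)) (within k (half η) (half-pos 0<η)) }
  where
  open +-*-Solver
  regroup : ∀ η → K ℚ.+ half η ℚ.+ (L ℚ.+ half η) ≡ K ℚ.+ L ℚ.+ η
  regroup η = solve 3 (λ K L η → let h = con ½ :* η in K :+ h :+ (L :+ h) := K :+ L :+ η)
    refl K L η

∣∣≤-* : ∀ {x y D L} → 0ℚ ℚ.≤ D → (∀ n → ℚ.∣ seq x n ∣ ℚ.≤ D) → ∣ y ∣ ≤ fromℚ L →
        ∣ x * y ∣ ≤ fromℚ (D ℚ.* L)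
∣∣≤-* {x} {y} {D} {L} 0≤D hx hy = record { within = λ η 0<η →
  let (δ , 0<δ , Dδ≤η) = shrink D 0≤D 0<η in
  eventually₁ (λ n p → ℚ.≤-trans (∣*∣-≤ {seq x n} {seq y n} (hx n) p)
    (ℚ.≤-trans (ℚ.≤-reflexive (ℚ.*-distribˡ-+ D L δ)) (ℚ.+-monoʳ-≤ (D ℚ.* L) Dδ≤η)))
    (within hy δ 0<δ) }

module Riemann (a b : ℝ) (f : ℝ → ℝ) where

  point : ℕ → ℕ → ℝ
  point m i = a + fromℚ (+ i ℚ./ suc m) * (b - a)

  -- The left sum over suc m subintervals of equal length.
  riemannSum : ℕ → ℝ
  riemannSum m = fromℚ (+ 1 ℚ./ suc m) * (b - a) * ∑ (suc m) (λ i → f (point m i))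

  private
    A D : ℚ
    A = proj₁ (bounded a)
    D = proj₁ (bounded (b - a))
    0≤A : 0ℚ ℚ.≤ A
    0≤A = proj₁ (proj₂ (bounded a))
    0≤D : 0ℚ ℚ.≤ D
    0≤D = proj₁ (proj₂ (bounded (b - a)))
    ∣b-a∣≤D : ∀ n → ℚ.∣ seq (b - a) n ∣ ℚ.≤ D
    ∣b-a∣≤D = proj₂ (proj₂ (bounded (b - a)))

    point-bound : ∀ m i → i ℕ.≤ suc m → ∣ point m i ∣ ≤ fromℚ (A ℚ.+ 1ℚ ℚ.* D)
    point-bound m i i≤ = ≤-pointwise λ n →
      ∣+∣-≤ {seq a n} {(+ i ℚ./ suc m) ℚ.* seq (b - a) n}
        (proj₂ (proj₂ (bounded a)) n)
        (∣*∣-≤ {+ i ℚ./ suc m} {seq (b - a) n}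
          (ℚ.≤-trans (ℚ.≤-reflexive (ℚ.0≤p⇒∣p∣≡p (0≤/ i m))) (/≤1 m i≤)) (∣b-a∣≤D n))

    module Refine (m n : ℕ) where

      N M k : ℕ
      N = suc m
      M = suc n
      k = n ℕ.+ m ℕ.* M

      w v : ℚ
      w = + 1 ℚ./ N
      v = + 1 ℚ./ suc k

      w≡Mv : w ≡ ℕ→ℚ M ℚ.* v
      w≡Mv = trans (sym (ℚ.*-identityʳ w))
        (trans (cong (w ℚ.*_) (sym (trans (cong (ℚ._* v) (sym (ℕ→ℚ-* N M))) (n*1/n k))))
        (trans (solve 4 (λ w N M v → w :* (N :* M :* v) := N :* w :* (M :* v)) refl w (ℕ→ℚ N) (ℕ→ℚ M) v)
        (trans (cong (ℚ._* (ℕ→ℚ M ℚ.* v)) (n*1/n m)) (ℚ.*-identityˡ (ℕ→ℚ M ℚ.* v)))))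
        where open +-*-Solver

      fraction : ∀ i r → + (r ℕ.+ i ℕ.* M) ℚ./ suc k ≡ (+ i ℚ./ N) ℚ.+ ℕ→ℚ r ℚ.* v
      fraction i r = trans (/-as-* (r ℕ.+ i ℕ.* M) k)
        (trans (cong (ℚ._* v) (trans (ℕ→ℚ-+ r (i ℕ.* M)) (cong (λ z → ℕ→ℚ r ℚ.+ z) (ℕ→ℚ-* i M))))
        (trans (solve 4 (λ r i M v → (r :+ i :* M) :* v := i :* (M :* v) :+ r :* v) refl
                  (ℕ→ℚ r) (ℕ→ℚ i) (ℕ→ℚ M) v)
          (cong (ℚ._+ ℕ→ℚ r ℚ.* v)
            (trans (cong (ℕ→ℚ i ℚ.*_) (sym w≡Mv)) (sym (/-as-* i m))))))
        where open +-*-Solver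

      points-close : ∀ i r → r ℕ.≤ M →
                     ∣ point m i - point k (r ℕ.+ i ℕ.* M) ∣ ≤ fromℚ (w ℚ.* D)
      points-close i r r≤M = ≤-pointwise λ j → ℚ.≤-trans
        (ℚ.≤-reflexive (trans (cong ℚ.∣_∣ (difference j)) (ℚ.∣-p∣≡∣p∣ _)))
        (∣*∣-≤ {ℕ→ℚ r ℚ.* v} {seq (b - a) j} rv≤w (∣b-a∣≤D j))
        where
        open +-*-Solver
        difference : ∀ j → seq (point m i - point k (r ℕ.+ i ℕ.* M)) j ≡
                     ℚ.- (ℕ→ℚ r ℚ.* v ℚ.* seq (b - a) j)
        difference j = trans
          (cong (λ z → seq a j ℚ.+ (+ i ℚ./ N) ℚ.* d ℚ.- (seq a j ℚ.+ z ℚ.* d)) (fraction i r))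
          (solve 4 (λ a t s d → a :+ t :* d :- (a :+ (t :+ s) :* d) := :- (s :* d)) refl
            (seq a j) (+ i ℚ./ N) (ℕ→ℚ r ℚ.* v) d)
          where
          d : ℚ
          d = seq (b - a) j
        rv≤w : ℚ.∣ ℕ→ℚ r ℚ.* v ∣ ℚ.≤ w
        rv≤w = ℚ.≤-trans
          (ℚ.≤-reflexive (ℚ.0≤p⇒∣p∣≡p (*-nonneg (ℕ→ℚ-nonneg r) (0≤/ 1 k))))
          (ℚ.≤-trans (*-monoʳ v (0≤/ 1 k) (ℕ→ℚ-mono r≤M)) (ℚ.≤-reflexive (sym w≡Mv)))

      u g : ℕ → ℝ
      u i = f (point m i)
      g j = f (point k j)

      module _ (ε : ℚ)
        (close : ∀ i r → i ℕ.≤ m → r ℕ.< M → ∣ u i - g (r ℕ.+ i ℕ.* M) ∣ ≤ fromℚ ε) where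

        partial : ℕ → ℕ → ℝ
        partial i r = fromℕ r * u i + fromℕ M * ∑ i u - ∑ (r ℕ.+ i ℕ.* M) g

        partial-bound : ∀ i r → i ℕ.≤ m → r ℕ.≤ M →
                        ∣ partial i r ∣ ≤ fromℚ (ε ℚ.* ℕ→ℚ (r ℕ.+ i ℕ.* M))
        partial-bound zero zero _ _ = ≤-pointwise λ j → ℚ.≤-reflexive
          (trans (cong ℚ.∣_∣ (solve 2 (λ u M → con 0ℚ :* u :+ M :* con 0ℚ :- con 0ℚ := con 0ℚ) refl
                   (seq (u 0) j) (ℕ→ℚ M)))
            (sym (ℚ.*-zeroʳ ε)))
          where open +-*-Solver
        partial-bound (suc i) zero i≤ _ = ∣∣≤-cong
          (λ j → solve 5 (λ u u′ M S G →
              con 0ℚ :* u′ :+ M :* (S :+ u) :- G := M :* u :+ M :* S :- G) refl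
            (seq (u i) j) (seq (u (suc i)) j) (ℕ→ℚ M) (seq (∑ i u) j)
            (seq (∑ (suc i ℕ.* M) g) j))
          (partial-bound i M (ℕ.≤-trans (ℕ.n≤1+n i) i≤) ℕ.≤-refl)
          where open +-*-Solver
        partial-bound i (suc r) i≤ r< = ∣∣≤-mono
          (ℚ.≤-reflexive (trans (solve 2 (λ ε t → ε :* t :+ ε := ε :* (con 1ℚ :+ t)) refl
              ε (ℕ→ℚ (r ℕ.+ i ℕ.* M)))
            (cong (ε ℚ.*_) (sym (ℕ→ℚ-suc (r ℕ.+ i ℕ.* M))))))
          (∣∣≤-cong (λ j → trans
              (cong (λ z → z ℚ.* seq (u i) j ℚ.+ ℕ→ℚ M ℚ.* seq (∑ i u) j
                  ℚ.- (seq (∑ (r ℕ.+ i ℕ.* M) g) j ℚ.+ seq (g (r ℕ.+ i ℕ.* M)) j)) (ℕ→ℚ-suc r))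
              (solve 5 (λ r u P S g → (con 1ℚ :+ r) :* u :+ P :- (S :+ g)
                  := r :* u :+ P :- S :+ (u :- g)) refl
                (ℕ→ℚ r) (seq (u i) j) (ℕ→ℚ M ℚ.* seq (∑ i u) j)
                (seq (∑ (r ℕ.+ i ℕ.* M) g) j) (seq (g (r ℕ.+ i ℕ.* M)) j)))
            (∣∣≤-+ (partial-bound i r i≤ (ℕ.≤-trans (ℕ.n≤1+n r) r<)) (close i r i≤ r<)))
          where open +-*-Solver

        refine : ∣ riemannSum m - riemannSum k ∣ ≤ fromℚ (D ℚ.* ε)
        refine = ∣∣≤-mono (ℚ.≤-reflexive weight)
          (∣∣≤-cong {fromℚ v * (b - a) * partial m M} {riemannSum m - riemannSum k}
            (λ j → trans
              (cong (λ z → z ℚ.* seq (b - a) j ℚ.* (seq (∑ m u) j ℚ.+ seq (u m) j)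
                  ℚ.- v ℚ.* seq (b - a) j ℚ.* seq (∑ (suc k) g) j) w≡Mv)
              (solve 6 (λ M v d S u G → M :* v :* d :* (S :+ u) :- v :* d :* G
                  := v :* d :* (M :* u :+ M :* S :- G)) refl
                (ℕ→ℚ M) v (seq (b - a) j) (seq (∑ m u) j) (seq (u m) j) (seq (∑ (suc k) g) j)))
            (∣∣≤-* {fromℚ v * (b - a)} {partial m M} (*-nonneg (0≤/ 1 k) 0≤D)
              (λ j → ∣*∣-≤ {v} {seq (b - a) j}
                (ℚ.≤-reflexive (ℚ.0≤p⇒∣p∣≡p (0≤/ 1 k))) (∣b-a∣≤D j))
              (partial-bound m M ℕ.≤-refl ℕ.≤-refl)))
          where
          open +-*-Solver
          weight : v ℚ.* D ℚ.* (ε ℚ.* ℕ→ℚ (suc k)) ≡ D ℚ.* ε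
          weight = trans (solve 4 (λ v D ε K → v :* D :* (ε :* K) := D :* ε :* (K :* v)) refl
              v D ε (ℕ→ℚ (suc k)))
            (trans (cong (D ℚ.* ε ℚ.*_) (n*1/n k)) (ℚ.*-identityʳ (D ℚ.* ε)))

  riemannSum-cauchy : Continuous f → CauchySequence riemannSum
  riemannSum-cauchy cont ε 0<ε = N₀ , bound
    where
    B e δ : ℚ
    B = A ℚ.+ 1ℚ ℚ.* D
    s : ∃ λ e → 0ℚ ℚ.< e × D ℚ.* e ℚ.≤ half ε
    s = shrink D 0≤D (half-pos 0<ε)
    e = proj₁ s
    modulus : ∃ λ δ → 0ℚ ℚ.< δ × (∀ x y →
      ∣ x ∣ ≤ fromℚ B → ∣ y ∣ ≤ fromℚ B → ∣ x - y ∣ ≤ fromℚ δ → ∣ f x - f y ∣ ≤ fromℚ e)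
    modulus = cont B e (proj₁ (proj₂ s))
    δ = proj₁ modulus
    small : ∃ λ N → ∀ n → N ℕ.≤ n → D ℚ.* (+ 1 ℚ./ suc n) ℚ.≤ δ
    small = 1/n-small D 0≤D (proj₁ (proj₂ modulus))
    N₀ : ℕ
    N₀ = proj₁ small
    half-bound : ∀ m n → N₀ ℕ.≤ m →
                 ∣ riemannSum m - riemannSum (Refine.k m n) ∣ ≤ fromℚ (half ε)
    half-bound m n hm = ∣∣≤-mono (proj₂ (proj₂ s)) (refine e λ i r i≤m r<M →
        proj₂ (proj₂ modulus) (point m i) (point k (r ℕ.+ i ℕ.* M))
          (point-bound m i (ℕ.≤-trans i≤m (ℕ.n≤1+n m)))
          (point-bound k (r ℕ.+ i ℕ.* M) (ℕ.≤-trans (ℕ.<⇒≤ (ℕ.+-monoˡ-< (i ℕ.* M) r<M))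
            (ℕ.*-monoˡ-≤ M (ℕ.s≤s i≤m))))
          (∣∣≤-mono (ℚ.≤-trans (ℚ.≤-reflexive (ℚ.*-comm w D)) (proj₂ small m hm))
            (points-close i r (ℕ.<⇒≤ r<M))))
      where open Refine m n
    bound : ∀ m n → N₀ ℕ.≤ m → N₀ ℕ.≤ n → ∣ riemannSum m - riemannSum n ∣ ≤ fromℚ ε
    bound m n hm hn = ∣∣≤-mono (ℚ.≤-reflexive (half+half ε))
      (∣∣≤-cong {riemannSum m - riemannSum k + (riemannSum k - riemannSum n)}
          {riemannSum m - riemannSum n}
        (λ j → solve 3 (λ x y z → x :- z := x :- y :+ (y :- z)) refl
          (seq (riemannSum m) j) (seq (riemannSum k) j) (seq (riemannSum n) j))
        (∣∣≤-+ (half-bound m n hm) flipped))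
      where
      open +-*-Solver
      k : ℕ
      k = Refine.k m n
      k′≡k : Refine.k n m ≡ k
      k′≡k = ℕ.suc-injective (ℕ.*-comm (suc n) (suc m))
      flipped : ∣ riemannSum k - riemannSum n ∣ ≤ fromℚ (half ε)
      flipped = ≤-trans-pointwise
        (λ j → ℚ.≤-reflexive (dist-sym (seq (riemannSum k) j) (seq (riemannSum n) j)))
        (subst (λ l → ∣ riemannSum n - riemannSum l ∣ ≤ fromℚ (half ε)) k′≡k (half-bound n m hn))

integral : (a b : ℝ) (f : ℝ → ℝ) → Continuous f → ℝ
integral a b f cont = lim (Riemann.riemannSum a b f) (Riemann.riemannSum-cauchy a b f cont)

gaussian : ℝ → ℝ
gaussian t = exp (- (t * t))

gaussian-continuous : Continuous gaussian
gaussian-continuous = parabola-continuous exp (lift-continuous expSum expSum-uniform) 0ℚ (λ t → - (t * t))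
  (λ t n → sym (ℚ.+-identityˡ (ℚ.- (seq t n ℚ.* seq t n))))

circle : ℝ → ℝ
circle t = √ (1ℝ - t * t)

circle-continuous : Continuous circle
circle-continuous = parabola-continuous √_ (lift-continuous root root-uniform) 1ℚ (λ t → 1ℝ - t * t)
  (λ t n → refl)

quarterDisc : ℝ
quarterDisc = integral 0ℝ 1ℝ circle circle-continuous

-- The area of the unit disc.
π : ℝ
π = fromℕ 4 * quarterDisc

-- Rests on 1 - t ≤ √ (1 - t²) for t in [0, 1].
module CircleBound where

  open Riemann 0ℝ 1ℝ circle
  open +-*-Solver

  ⅛ : ℚ
  ⅛ = + 1 ℚ./ 8
  0<⅛ : 0ℚ ℚ.< ⅛
  0<⅛ = ℚ.positive⁻¹ ⅛

  three : ℚ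
  three = + 3 ℚ./ 1
  small : ∃ λ J → ∀ j → J ℕ.≤ j → three ℚ.* ½^ j ℚ.≤ ⅛
  small = ½^-small three (ℚ.nonNegative⁻¹ three) 0<⅛

  module _ (m j : ℕ) (J≤j : proj₁ small ℕ.≤ j) where
    w : ℚ
    w = + 1 ℚ./ suc m
    value : ℕ → ℚ
    value i = seq (circle (point m i)) j

    value-lower : ∀ i → i ℕ.≤ m → 1ℚ ℚ.- ℕ→ℚ i ℚ.* w ℚ.- ⅛ ℚ.≤ value i
    value-lower i i≤m = by-diff (value i ℚ.+ ⅛ ℚ.- s) (diff-nonneg s≤)
      (solve 3 (λ s e r → s :- e :+ (r :+ e :- s) := r) refl s ⅛ (value i))
      where
      t s y : ℚ
      t = ℕ→ℚ i ℚ.* w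
      s = 1ℚ ℚ.- t
      y = seq (1ℝ - point m i * point m i) j
      t≡ : + i ℚ./ suc m ≡ t
      t≡ = /-as-* i m
      0≤t : 0ℚ ℚ.≤ t
      0≤t = *-nonneg (ℕ→ℚ-nonneg i) (0≤/ 1 m)
      t≤1 : t ℚ.≤ 1ℚ
      t≤1 = ℚ.≤-trans (ℚ.≤-reflexive (sym t≡)) (/≤1 m (ℕ.≤-trans i≤m (ℕ.n≤1+n m)))
      y≡ : y ≡ 1ℚ ℚ.- t ℚ.* t
      y≡ = trans (cong (λ z → let x = 0ℚ ℚ.+ z ℚ.* (1ℚ ℚ.- 0ℚ) in 1ℚ ℚ.- x ℚ.* x) t≡)
        (solve 1 (λ t → let x = con 0ℚ :+ t :* (con 1ℚ :- con 0ℚ) in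
          con 1ℚ :- x :* x := con 1ℚ :- t :* t) refl t)
      0≤s : 0ℚ ℚ.≤ s
      0≤s = diff-nonneg t≤1
      s²≤ : s ℚ.* s ℚ.≤ y ℚ.⊔ 0ℚ
      s²≤ = ℚ.≤-trans
        (by-diff (t ℚ.* s ℚ.+ t ℚ.* s) (+-nonneg (*-nonneg 0≤t 0≤s) (*-nonneg 0≤t 0≤s))
          (trans (solve 1 (λ t → let s = con 1ℚ :- t in
            s :* s :+ (t :* s :+ t :* s) := con 1ℚ :- t :* t) refl t) (sym y≡)))
        (ℚ.p≤p⊔q y 0ℚ)
      t²≤1 : t ℚ.* t ℚ.≤ 1ℚ
      t²≤1 = ℚ.≤-trans (*-mono 0≤1 0≤t t≤1 t≤1) (ℚ.≤-reflexive (ℚ.*-identityʳ 1ℚ))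
      ∣y∣≤2 : ℚ.∣ y ∣ ℚ.≤ 1ℚ ℚ.+ 1ℚ
      ∣y∣≤2 = ℚ.≤-trans (ℚ.≤-reflexive (cong ℚ.∣_∣ y≡))
        (∣-∣-≤ {1ℚ} {t ℚ.* t} ℚ.≤-refl
          (ℚ.≤-trans (ℚ.≤-reflexive (ℚ.0≤p⇒∣p∣≡p (*-nonneg 0≤t 0≤t))) t²≤1))
      s≤ : s ℚ.≤ value i ℚ.+ ⅛
      s≤ = ℚ.≤-trans (root-lower j y s²≤) (ℚ.+-monoʳ-≤ (value i)
        (ℚ.≤-trans (width-bound {1ℚ ℚ.+ 1ℚ} {y} j ∣y∣≤2) (proj₂ small j J≤j)))

    lower : ℕ → ℚ
    lower i = ℕ→ℚ i ℚ.- half (ℕ→ℚ i ℚ.* ℕ→ℚ i ℚ.* w) ℚ.- ℕ→ℚ i ℚ.* ⅛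

    ∑-lower : ∀ i → i ℕ.≤ suc m → lower i ℚ.≤ seq (∑ i (λ i → circle (point m i))) j
    ∑-lower zero _ = ℚ.≤-reflexive
      (solve 1 (λ w → let z = con 0ℚ in z :- con ½ :* (z :* z :* w) :- z :* con ⅛ := z) refl w)
    ∑-lower (suc i) (ℕ.s≤s i≤m) = ℚ.≤-trans step
      (ℚ.+-mono-≤ (∑-lower i (ℕ.≤-trans i≤m (ℕ.n≤1+n m))) (value-lower i i≤m))
      where
      step : lower (suc i) ℚ.≤ lower i ℚ.+ (1ℚ ℚ.- ℕ→ℚ i ℚ.* w ℚ.- ⅛)
      step = by-diff (half w) (*-nonneg 0≤½ (0≤/ 1 m))
        (trans (cong (λ z → z ℚ.- half (z ℚ.* z ℚ.* w) ℚ.- z ℚ.* ⅛ ℚ.+ half w) (ℕ→ℚ-suc i))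
          (solve 2 (λ i w → let z = con 1ℚ :+ i in
            z :- con ½ :* (z :* z :* w) :- z :* con ⅛ :+ con ½ :* w
              := i :- con ½ :* (i :* i :* w) :- i :* con ⅛ :+ (con 1ℚ :- i :* w :- con ⅛))
            refl (ℕ→ℚ i) w))

    sum-lower : ½ ℚ.- ⅛ ℚ.≤ seq (riemannSum m) j
    sum-lower = ℚ.≤-trans (ℚ.≤-reflexive (sym total))
      (*-monoˡ (w ℚ.* (1ℚ ℚ.- 0ℚ)) 0≤w (∑-lower (suc m) ℕ.≤-refl))
      where
      0≤w : 0ℚ ℚ.≤ w ℚ.* (1ℚ ℚ.- 0ℚ)
      0≤w = *-nonneg (0≤/ 1 m) 0≤1
      total : w ℚ.* (1ℚ ℚ.- 0ℚ) ℚ.* lower (suc m) ≡ ½ ℚ.- ⅛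
      total = trans (solve 2 (λ w N → w :* (con 1ℚ :- con 0ℚ) :*
            (N :- con ½ :* (N :* N :* w) :- N :* con ⅛)
            := N :* w :- con ½ :* ((N :* w) :* (N :* w)) :- N :* w :* con ⅛) refl
          w (ℕ→ℚ (suc m)))
        (cong (λ z → z ℚ.- half (z ℚ.* z) ℚ.- z ℚ.* ⅛) (n*1/n m))

  riemann-lower : ∀ m → Eventually λ j → ½ ℚ.- ⅛ ℚ.≤ seq (riemannSum m) j
  riemann-lower m = proj₁ small , sum-lower m

  transfer : ∀ {r q} → ½ ℚ.- ⅛ ℚ.≤ r → ℚ.∣ r ℚ.- q ∣ ℚ.≤ ⅛ ℚ.+ ⅛ → 0ℚ ℚ.+ ⅛ ℚ.≤ q
  transfer {r} {q} h k = by-diff {0ℚ ℚ.+ ⅛} {q} (q ℚ.+ (⅛ ℚ.+ ⅛) ℚ.- (½ ℚ.- ⅛)) (diff-nonneg upper)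
    (solve 1 (λ q → con 0ℚ :+ con ⅛ :+ (q :+ (con ⅛ :+ con ⅛) :- (con ½ :- con ⅛)) := q)
      refl q)
    where
    upper : ½ ℚ.- ⅛ ℚ.≤ q ℚ.+ (⅛ ℚ.+ ⅛)
    upper = ℚ.≤-trans h (dist-upper {r} {q} {⅛ ℚ.+ ⅛} k)

  positive-near-sum : ∀ m q → ∣ riemannSum m - q ∣ ≤ fromℚ ⅛ → 0ℝ < q
  positive-near-sum m q h .gap     = ⅛
  positive-near-sum m q h .gap-pos = 0<⅛
  positive-near-sum m q h .apart   = eventually₂
    (λ j → transfer {seq (riemannSum m) j} {seq q j}) (riemann-lower m) (within h ⅛ 0<⅛)

  positive-limit : ∀ q → riemannSum ⟶ q → 0ℝ < q
  positive-limit q conv = positive-near-sum (proj₁ (conv ⅛ 0<⅛)) q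
    (proj₂ (conv ⅛ 0<⅛) (proj₁ (conv ⅛ 0<⅛)) ℕ.≤-refl)

instance
  quarterDisc-positive : 0ℝ < quarterDisc
  quarterDisc-positive = CircleBound.positive-limit quarterDisc
    (lim-converges (Riemann.riemannSum 0ℝ 1ℝ circle)
      (Riemann.riemannSum-cauchy 0ℝ 1ℝ circle circle-continuous))

instance
  nonTrivial-nonZero : ∀ {n} .{{_ : ℕ.NonTrivial n}} → ℕ.NonZero n
  nonTrivial-nonZero {n} = ℕ.nonTrivial⇒nonZero n

erf : ℝ → ℝ
erf x = fromℕ 2 ÷ √ π * integral 0ℝ x gaussian gaussian-continuous

-- [ head ; tail 0 , tail 1 , … ]
record RegularCF : Set where
  field
    head         : ℤ
    tail         : ℕ → ℕ
    tail-nonZero : ∀ n → ℕ.NonZero (tail n)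
open RegularCF public

numerator : RegularCF → ℕ → ℤ
numerator c zero          = head c
numerator c (suc zero)    = + tail c 0 ℤ.* head c ℤ.+ + 1
numerator c (suc (suc n)) = + tail c (suc n) ℤ.* numerator c (suc n) ℤ.+ numerator c n

denominator : RegularCF → ℕ → ℕ
denominator c zero          = 1
denominator c (suc zero)    = tail c 0
denominator c (suc (suc n)) = tail c (suc n) ℕ.* denominator c (suc n) ℕ.+ denominator c n

denominator-nonZero : ∀ c n → ℕ.NonZero (denominator c n)
denominator-nonZero c zero          = _
denominator-nonZero c (suc zero)    = tail-nonZero c 0
denominator-nonZero c (suc (suc n)) = ℕ.>-nonZero (ℕ.<-≤-trans
  (ℕ.>-nonZero⁻¹ (denominator c n) {{denominator-nonZero c n}})
  (ℕ.m≤n+m (denominator c n) (tail c (suc n) ℕ.* denominator c (suc n))))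

convergent : RegularCF → ℕ → ℚ
convergent c n = (numerator c n ℚ./ denominator c n) {{denominator-nonZero c n}}

_IsExpansionOf_ : RegularCF → ℝ → Set
c IsExpansionOf α = (λ n → fromℚ (convergent c n)) ⟶ α

pred-nonZero : ∀ {n} → 2 ℕ.≤ n → ℕ.NonZero (n ℕ.∸ 1)
pred-nonZero (ℕ.s≤s (ℕ.s≤s _)) = _

-- [ s ; ℓ - 1 , 1 , 2s - 1 , 3ℓ - 1 , 1 , 2s - 1 , 5ℓ - 1 , … ]
expansion-ℓs : (ℓ s : ℕ) .{{_ : ℕ.NonTrivial ℓ}} .{{_ : ℕ.NonZero s}} → RegularCF
expansion-ℓs ℓ s = record { head = + s ; tail = quotient 0 ; tail-nonZero = nonZero 0 }
  where
  quotient : ℕ → ℕ → ℕ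
  quotient k 0 = (1 ℕ.+ 2 ℕ.* k) ℕ.* ℓ ℕ.∸ 1
  quotient k 1 = 1
  quotient k 2 = 2 ℕ.* s ℕ.∸ 1
  quotient k (suc (suc (suc n))) = quotient (suc k) n
  nonZero : ∀ k n → ℕ.NonZero (quotient k n)
  nonZero k 0 = pred-nonZero (ℕ.≤-trans (ℕ.nonTrivial⇒n>1 ℓ) (ℕ.m≤m+n ℓ (2 ℕ.* k ℕ.* ℓ)))
  nonZero k 1 = _
  nonZero k 2 = pred-nonZero (ℕ.*-monoʳ-≤ 2 (ℕ.>-nonZero⁻¹ s))
  nonZero k (suc (suc (suc n))) = nonZero (suc k) n

-- [ s + 1 ; 2s - 1 , 2 , 1 , 2s - 1 , 4 , 1 , 2s - 1 , 6 , 1 , … ]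
expansion-s : (s : ℕ) .{{_ : ℕ.NonZero s}} → RegularCF
expansion-s s = record { head = + (s ℕ.+ 1) ; tail = quotient 1 ; tail-nonZero = nonZero 1 }
  where
  quotient : ℕ → ℕ → ℕ
  quotient k 0 = 2 ℕ.* s ℕ.∸ 1
  quotient k 1 = 2 ℕ.* k
  quotient k 2 = 1
  quotient k (suc (suc (suc n))) = quotient (suc k) n
  nonZero : ∀ k .{{_ : ℕ.NonZero k}} n → ℕ.NonZero (quotient k n)
  nonZero k 0 = pred-nonZero (ℕ.*-monoʳ-≤ 2 (ℕ.>-nonZero⁻¹ s))
  nonZero k 1 = ℕ.m*n≢0 2 k
  nonZero k 2 = _
  nonZero k (suc (suc (suc n))) = nonZero (suc k) n

module Submission where

-- Let z = 1/(ℓs).  The errors |pₙ - αqₙ| are power series in z whose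
-- coefficients are multiples of (m-1)!/((m-k)!(m+k)!): these satisfy the
-- recurrence of the convergents, and in each group n = 3k, 3k+1, 3k+2 the
-- second and third error add up to the first.  Summing over k leaves
-- 2s Σ zᵐ 2ᵐ⁻¹/(2m-1)‼, which is the series of 2s √z eᶻ ∫₀^√z exp(-t²) dt by the
-- Cauchy product of the series of eᶻ and of the integral.  The second expansion
-- is the case ℓ = 1 of the first without its first two errors.
--
-- Real numbers are Cauchy sequences of rationals, so all identities are proved
-- for truncated series, up to null sequences.

open import Data.Nat.Base as ℕ using (ℕ; zero; suc; NonZero; NonTrivial)
import Data.Nat.Properties as ℕ
open import Data.Integer.Base as ℤ using (ℤ; +_)
import Data.Integer.Properties as ℤ
open import Data.Rational.Base as ℚ using (ℚ; 0ℚ; 1ℚ; ½)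
import Data.Rational.Properties as ℚ
open import Data.Rational.Solver using (module +-*-Solver)
import Data.Rational.Unnormalised.Base as ℚᵘ
import Data.Rational.Unnormalised.Properties as ℚᵘ
open import Data.Product.Base using (∃; _×_; _,_; proj₁; proj₂)
open import Data.Sum.Base using (_⊎_; inj₁; inj₂)
open import Relation.Binary.PropositionalEquality
  using (_≡_; refl; sym; trans; cong; cong₂; cong-app; subst)
open import Defs using (module RationalLemmas; module Approximations; Eventually; eventually₁; eventually₂)

-- Two limits meet: the number n of errors added and the truncation j of their power series.
-- `HasSum` fixes the range of n before j, so what remains of the sum must be small uniformly in j.
-- This is why coefficients are bounded by K·¼ⁱ and not by K·½ⁱ: those of the k-th group vanish for
-- i < k, so a factor ½ᵏ can be split off for the sum over k while ½ⁱ still controls the sum over i.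
--
-- The coefficients come from the Hermite integrals zᵏ⁺¹/k! ∫₀¹ xᵏ(1 - x)ᵏ exp(zx) dx, expanded in
-- z. Their terms are nonnegative, so the absolute values reduce to an alternating sign. That the
-- continued fractions converge to the given numbers is a consequence: the errors are summable,
-- hence tend to 0, and the denominators are at least 1.
--
-- Square roots enter only through products with rational value: √π cancels against the factor 2/√π
-- of erf, and u = 1/√(ℓs) occurs twice, in √(πs/ℓ) = √π·s·u and in the integral from 0 to u, which
-- is u times a series in u².

module RationalTools where

  -- Linear certificates, geometric bounds and finite sums of rationals.

  open import Data.Rational.Base
  open import Data.Rational.Properties using (≤-refl; ≤-trans; ≤-reflexive; <⇒≤; +-mono-≤)
  open +-*-Solver
  open RationalLemmas

  2ℚ : ℚ
  2ℚ = 1ℚ + 1ℚ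

  unit : ℕ → ℚ
  unit n = + 1 / suc n

  unit-inverse : ∀ n → ℕ→ℚ (suc n) * unit n ≡ 1ℚ
  unit-inverse = n*1/n

  unit-nonneg : ∀ n → 0ℚ ≤ unit n
  unit-nonneg = 0≤/ 1

  unit≤1 : ∀ n → unit n ≤ 1ℚ
  unit≤1 n = /≤1 n (ℕ.s≤s ℕ.z≤n)

  ≡-by-diff : ∀ {p q} → p - q ≡ 0ℚ → p ≡ q
  ≡-by-diff {p} {q} h = trans (solve 2 (λ p q → p := p :- q :+ q) refl p q)
    (trans (cong (_+ q) h) (ℚ.+-identityˡ q))

  -- The ring solver proves only unconditional identities. To use hypotheses, p - q is written as an
  -- explicit combination of the differences of their two sides.
  combine₁ : ∀ {p q s t} c → s ≡ t → p - q ≡ c * (s - t) → p ≡ q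
  combine₁ {s = s} c refl h = ≡-by-diff
    (trans h (solve 2 (λ c s → c :* (s :- s) := con 0ℚ) refl c s))

  combine₂ : ∀ {p q s t s′ t′} c c′ → s ≡ t → s′ ≡ t′ →
             p - q ≡ c * (s - t) + c′ * (s′ - t′) → p ≡ q
  combine₂ {s = s} {s′ = s′} c c′ refl refl h = ≡-by-diff (trans h
    (solve 4 (λ c s c′ s′ → c :* (s :- s) :+ c′ :* (s′ :- s′) := con 0ℚ) refl c s c′ s′))

  combine₃ : ∀ {p q s t s′ t′ s″ t″} c c′ c″ → s ≡ t → s′ ≡ t′ → s″ ≡ t″ →
             p - q ≡ c * (s - t) + c′ * (s′ - t′) + c″ * (s″ - t″) → p ≡ q
  combine₃ {s = s} {s′ = s′} {s″ = s″} c c′ c″ refl refl refl h = ≡-by-diff (trans h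
    (solve 6 (λ c s c′ s′ c″ s″ →
      c :* (s :- s) :+ c′ :* (s′ :- s′) :+ c″ :* (s″ :- s″) := con 0ℚ) refl c s c′ s′ c″ s″))

  cancel : ∀ {p q} d → 0ℚ < d → d * p ≡ d * q → p ≡ q
  cancel {p} {q} d 0<d h with inverse 0<d
  ... | (e , _ , de≡1) = combine₂ e (q - p) h de≡1
    (solve 4 (λ p q d e → p :- q := e :* (d :* p :- d :* q) :+ (q :- p) :* (d :* e :- con 1ℚ))
      refl p q d e)

  ¼^_ : ℕ → ℚ
  ¼^ n = ½^ n * ½^ n

  ¼ : ℚ
  ¼ = ½ * ½

  0≤¼^ : ∀ n → 0ℚ ≤ ¼^ n
  0≤¼^ n = *-nonneg (0≤½^ n) (0≤½^ n)

  ½^-antitone : ∀ {m n} → m ℕ.≤ n → ½^ n ≤ ½^ m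
  ½^-antitone {m} {n} m≤n = subst (λ k → ½^ k ≤ ½^ m) (ℕ.m∸n+n≡m m≤n) (go (n ℕ.∸ m))
    where
    go : ∀ d → ½^ (d ℕ.+ m) ≤ ½^ m
    go zero    = ≤-refl
    go (suc d) = ≤-trans (by-diff (½ * h) (*-nonneg 0≤½ (0≤½^ (d ℕ.+ m)))
      (half+half h)) (go d)
      where h = ½^ (d ℕ.+ m)

  ½^≤1 : ∀ n → ½^ n ≤ 1ℚ
  ½^≤1 n = ½^-antitone {0} {n} ℕ.z≤n

  ¼^≤½^ : ∀ n → ¼^ n ≤ ½^ n
  ¼^≤½^ n = ≤-trans (*-monoˡ (½^ n) (0≤½^ n) (½^≤1 n)) (≤-reflexive (ℚ.*-identityʳ (½^ n)))

  -- Induction on N through the shifted sequence: undoing a shift multiplies the constant by 4, and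
  -- adding f 0 covers the entry that the shift drops.
  geometric-bound : ∀ N (f : ℕ → ℚ) → (∀ n → 0ℚ ≤ f n) →
    (∀ n → N ℕ.≤ n → f (suc n) ≤ ¼ * f n) → ∃ λ K → 0ℚ ≤ K × ∀ n → f n ≤ K * ¼^ n
  geometric-bound zero f 0≤f decay = f 0 , 0≤f 0 , bound
    where
    bound : ∀ n → f n ≤ f 0 * ¼^ n
    bound zero    = ≤-reflexive (sym (ℚ.*-identityʳ (f 0)))
    bound (suc n) = ≤-trans (decay n ℕ.z≤n)
      (≤-trans (*-monoˡ ¼ (*-nonneg 0≤½ 0≤½) (bound n))
        (≤-reflexive (solve 2 (λ f h → con ½ :* con ½ :* (f :* (h :* h))
          := f :* (con ½ :* h :* (con ½ :* h))) refl (f 0) (½^ n))))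
  geometric-bound (suc N) f 0≤f decay
    with geometric-bound N (λ n → f (suc n)) (λ n → 0≤f (suc n)) (λ n h → decay (suc n) (ℕ.s≤s h))
  ... | (K , 0≤K , bound) = f 0 + 4K , +-nonneg (0≤f 0) 0≤4K , bound′
    where
    4K = 2ℚ * 2ℚ * K
    0≤4K : 0ℚ ≤ 4K
    0≤4K = *-nonneg (ℚ.nonNegative⁻¹ (2ℚ * 2ℚ)) 0≤K
    bound′ : ∀ n → f n ≤ (f 0 + 4K) * ¼^ n
    bound′ zero    = ≤-trans (p+-nonneg {f 0} 0≤4K) (≤-reflexive (sym (ℚ.*-identityʳ (f 0 + 4K))))
    bound′ (suc n) = ≤-trans (bound n) (by-diff (f 0 * ¼^ (suc n)) (*-nonneg (0≤f 0) (0≤¼^ (suc n)))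
      (solve 3 (λ f K h → K :* (h :* h) :+ f :* (con ½ :* h :* (con ½ :* h))
        := (f :+ con 2ℚ :* con 2ℚ :* K) :* (con ½ :* h :* (con ½ :* h))) refl (f 0) K (½^ n)))

  sum : (ℕ → ℚ) → ℕ → ℚ
  sum f zero    = 0ℚ
  sum f (suc n) = sum f n + f n

  sum-cong : ∀ {f g} → (∀ i → f i ≡ g i) → ∀ n → sum f n ≡ sum g n
  sum-cong h zero    = refl
  sum-cong h (suc n) = cong₂ _+_ (sum-cong h n) (h n)

  sum-+ : ∀ f g n → sum (λ i → f i + g i) n ≡ sum f n + sum g n
  sum-+ f g zero    = refl
  sum-+ f g (suc n) = trans (cong (_+ (f n + g n)) (sum-+ f g n))
    (solve 4 (λ a b c d → a :+ b :+ (c :+ d) := a :+ c :+ (b :+ d)) refl (sum f n) (sum g n) (f n) (g n))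

  sum-* : ∀ c f n → sum (λ i → c * f i) n ≡ c * sum f n
  sum-* c f zero    = sym (ℚ.*-zeroʳ c)
  sum-* c f (suc n) = trans (cong (_+ c * f n) (sum-* c f n)) (sym (ℚ.*-distribˡ-+ c (sum f n) (f n)))

  sum-peel : ∀ f n → sum f (suc n) ≡ f 0 + sum (λ i → f (suc i)) n
  sum-peel f zero    = ℚ.+-comm 0ℚ (f 0)
  sum-peel f (suc n) = trans (cong (_+ f (suc n)) (sum-peel f n))
    (ℚ.+-assoc (f 0) (sum (λ i → f (suc i)) n) (f (suc n)))

  sum-mono : ∀ {f g} → (∀ i → f i ≤ g i) → ∀ n → sum f n ≤ sum g n
  sum-mono h zero    = ≤-refl
  sum-mono h (suc n) = +-mono-≤ (sum-mono h n) (h n)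

  sum-nonneg : ∀ {f} → (∀ i → 0ℚ ≤ f i) → ∀ n → 0ℚ ≤ sum f n
  sum-nonneg h zero    = ≤-refl
  sum-nonneg h (suc n) = +-nonneg (sum-nonneg h n) (h n)

  ∣sum∣≤ : ∀ {f g} → (∀ i → ∣ f i ∣ ≤ g i) → ∀ n → ∣ sum f n ∣ ≤ sum g n
  ∣sum∣≤ h zero    = ≤-refl
  ∣sum∣≤ {f} h (suc n) = ∣+∣-≤ {sum f n} {f n} (∣sum∣≤ h n) (h n)

  sum-½^ : ∀ n → sum ½^_ n ≤ 2ℚ
  sum-½^ n = by-diff (½^ n + ½^ n) (+-nonneg (0≤½^ n) (0≤½^ n)) (exact n)
    where
    exact : ∀ n → sum ½^_ n + (½^ n + ½^ n) ≡ 2ℚ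
    exact zero    = refl
    exact (suc n) = trans
      (solve 2 (λ s h → s :+ h :+ (con ½ :* h :+ con ½ :* h) := s :+ (h :+ h)) refl (sum ½^_ n) (½^ n))
      (exact n)

  sum-geometric : ∀ {f} K → (∀ i → f i ≤ K * ½^ i) → 0ℚ ≤ K → ∀ n → sum f n ≤ K * 2ℚ
  sum-geometric K h 0≤K n = ≤-trans (sum-mono h n)
    (≤-trans (≤-reflexive (sum-* K ½^_ n)) (*-monoˡ K 0≤K (sum-½^ n)))

-- Equality of sequences up to a null sequence.

module Asymptotics where

  open import Data.Rational.Base
  open import Data.Rational.Properties using (≤-refl; ≤-trans; ≤-reflexive; <⇒≤; +-mono-≤)
  open +-*-Solver
  open RationalLemmas
  open RationalTools

  infix 4 _≋_

  -- On Cauchy sequences this is equality of real numbers. Stated for arbitrary sequences, it also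
  -- applies to truncated series before they are known to be Cauchy.
  record _≋_ (x y : ℕ → ℚ) : Set where
    constructor mk≋
    field close : ∀ ε → 0ℚ < ε → Eventually λ n → ∣ x n - y n ∣ ≤ ε
  open _≋_ public

  Bounded : (ℕ → ℚ) → Set
  Bounded x = ∃ λ B → 0ℚ ≤ B × ∀ n → ∣ x n ∣ ≤ B

  ∣p-p∣≤ : ∀ p {ε} → 0ℚ ≤ ε → ∣ p - p ∣ ≤ ε
  ∣p-p∣≤ p = ≤-trans (≤-reflexive (cong ∣_∣ (ℚ.+-inverseʳ p)))

  ≋-eventually : ∀ {x y} → Eventually (λ n → x n ≡ y n) → x ≋ y
  ≋-eventually {x} {y} (N , h) .close ε 0<ε = N , λ n N≤n →
    subst (λ p → ∣ x n - p ∣ ≤ ε) (h n N≤n) (∣p-p∣≤ (x n) (<⇒≤ 0<ε))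

  ≋-reflexive : ∀ {x y} → (∀ n → x n ≡ y n) → x ≋ y
  ≋-reflexive h = ≋-eventually (0 , λ n _ → h n)

  ≋-refl : ∀ {x} → x ≋ x
  ≋-refl = ≋-reflexive λ _ → refl

  ≋-sym : ∀ {x y} → x ≋ y → y ≋ x
  ≋-sym {x} {y} h .close ε 0<ε =
    eventually₁ (λ n → ≤-trans (≤-reflexive (dist-sym (y n) (x n)))) (close h ε 0<ε)

  ≋-trans : ∀ {x y w} → x ≋ y → y ≋ w → x ≋ w
  ≋-trans {x} {y} {w} h k .close ε 0<ε = eventually₂
    (λ n p q → ≤-trans (triangle {x n} {y n} {w n} {half ε} {half ε} p q) (≤-reflexive (half+half ε)))
    (close h (half ε) (half-pos 0<ε)) (close k (half ε) (half-pos 0<ε))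

  ≋-+ : ∀ {x y x′ y′} → x ≋ x′ → y ≋ y′ → (λ n → x n + y n) ≋ (λ n → x′ n + y′ n)
  ≋-+ {x} {y} {x′} {y′} h k .close ε 0<ε = eventually₂
    (λ n p q → ≤-trans
      (≤-reflexive (cong ∣_∣ (solve 4 (λ a b c d → a :+ b :- (c :+ d) := (a :- c) :+ (b :- d)) refl
        (x n) (y n) (x′ n) (y′ n))))
      (≤-trans (∣+∣-≤ {x n - x′ n} {y n - y′ n} {half ε} {half ε} p q) (≤-reflexive (half+half ε))))
    (close h (half ε) (half-pos 0<ε)) (close k (half ε) (half-pos 0<ε))

  ≋-scale : ∀ {w x y} → Bounded w → x ≋ y → (λ n → w n * x n) ≋ (λ n → w n * y n)
  ≋-scale {w} {x} {y} (B , 0≤B , bound) h .close ε 0<ε = eventually₁ scaled (close h δ (proj₁ (proj₂ s)))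
    where
    s : ∃ λ δ → 0ℚ < δ × B * δ ≤ ε
    s = shrink B 0≤B 0<ε
    δ : ℚ
    δ = proj₁ s
    scaled : ∀ n → ∣ x n - y n ∣ ≤ δ → ∣ w n * x n - w n * y n ∣ ≤ ε
    scaled n p = ≤-trans
      (≤-reflexive (cong ∣_∣ (solve 3 (λ w x y → w :* x :- w :* y := w :* (x :- y)) refl
        (w n) (x n) (y n))))
      (≤-trans (∣*∣-≤ {w n} {x n - y n} {B} {δ} (bound n) p) (proj₂ (proj₂ s)))

  constant-bounded : ∀ c → Bounded (λ _ → c)
  constant-bounded c = ∣ c ∣ , ℚ.0≤∣p∣ c , λ _ → ≤-refl

  *-bounded : ∀ {x y} → Bounded x → Bounded y → Bounded (λ n → x n * y n)
  *-bounded {x} {y} (B , 0≤B , h) (C , 0≤C , k) =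
    B * C , *-nonneg 0≤B 0≤C , λ n → ∣*∣-≤ {x n} {y n} {B} {C} (h n) (k n)

  ≋-constant-scale : ∀ c {x y} → x ≋ y → (λ n → c * x n) ≋ (λ n → c * y n)
  ≋-constant-scale c = ≋-scale (constant-bounded c)

  ≋-minus : ∀ {x y x′ y′} → x ≋ x′ → y ≋ y′ → (λ n → x n - y n) ≋ (λ n → x′ n - y′ n)
  ≋-minus {x} {y} {x′} {y′} h k = ≋-trans
    (≋-reflexive λ n → solve 2 (λ x y → x :- y := x :+ (:- con 1ℚ) :* y) refl (x n) (y n))
    (≋-trans (≋-+ h (≋-constant-scale (- 1ℚ) k))
    (≋-reflexive λ n → solve 2 (λ x y → x :+ (:- con 1ℚ) :* y := x :- y) refl (x′ n) (y′ n)))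

  ≋-∣∣ : ∀ {x y} → x ≋ y → (λ n → ∣ x n ∣) ≋ (λ n → ∣ y n ∣)
  ≋-∣∣ {x} {y} h .close ε 0<ε =
    eventually₁ (λ n → ≤-trans (∣∣-lipschitz (x n) (y n))) (close h ε 0<ε)

  ≋-geometric : ∀ {x y} K → 0ℚ ≤ K → (∀ n → ∣ x n - y n ∣ ≤ K * ½^ n) → x ≋ y
  ≋-geometric K 0≤K h .close ε 0<ε = proj₁ small , λ n N≤n → ≤-trans (h n) (proj₂ small n N≤n)
    where
    small : ∃ λ N → ∀ n → N ℕ.≤ n → K * ½^ n ≤ ε
    small = ½^-small K 0≤K 0<ε

  -- For x, y ≥ 0 one has (x - y)² ≤ |x² - y²|.
  ≋-square⁻¹ : ∀ {x y} → (∀ n → 0ℚ ≤ x n) → (∀ n → 0ℚ ≤ y n) →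
               (λ n → x n * x n) ≋ (λ n → y n * y n) → x ≋ y
  ≋-square⁻¹ {x} {y} 0≤x 0≤y h .close ε 0<ε = eventually₁
    (λ n p → square-mono⁻¹ (<⇒≤ 0<ε) (≤-trans (square-dist (0≤x n) (0≤y n)) p))
    (close h (ε * ε) (*-positive 0<ε 0<ε))
    where
    square-dist : ∀ {p q} → 0ℚ ≤ p → 0ℚ ≤ q → ∣ p - q ∣ * ∣ p - q ∣ ≤ ∣ p * p - q * q ∣
    square-dist {p} {q} 0≤p 0≤q = ≤-trans
      (*-monoˡ ∣ p - q ∣ (ℚ.0≤∣p∣ (p - q))
        (∣-∣-lub {p - q} {p + q}
          (by-diff (q + q) (+-nonneg 0≤q 0≤q)
            (solve 2 (λ p q → p :- q :+ (q :+ q) := p :+ q) refl p q))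
          (by-diff (p + p) (+-nonneg 0≤p 0≤p)
            (solve 2 (λ p q → :- (p :- q) :+ (p :+ p) := p :+ q) refl p q))))
      (≤-reflexive (trans (cong (∣ p - q ∣ *_) (sym (ℚ.0≤p⇒∣p∣≡p (+-nonneg 0≤p 0≤q))))
        (trans (sym (ℚ.∣p*q∣≡∣p∣*∣q∣ (p - q) (p + q)))
          (cong ∣_∣ (solve 2 (λ p q → (p :- q) :* (p :+ q) := p :* p :- q :* q) refl p q)))))

-- The coefficients of the error series and their recurrences.

module Coefficients (z : ℚ) (0≤z : 0ℚ ℚ.≤ z) where

  open import Data.Rational.Base
  open import Data.Rational.Properties using (≤-refl; ≤-trans; ≤-reflexive; <⇒≤; +-mono-≤)
  open +-*-Solver
  open RationalLemmas
  open Approximations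
  open RationalTools

  -- This is m + k + 1 for m = i + 1, written with separate casts so that ring identities see i and
  -- k.
  span : ℕ → ℕ → ℚ
  span i k = 1ℚ + (1ℚ + (ℕ→ℚ i + ℕ→ℚ k))

  span≡ : ∀ i k → ℕ→ℚ (suc (suc (i ℕ.+ k))) ≡ span i k
  span≡ i k = trans (ℕ→ℚ-suc (suc (i ℕ.+ k))) (cong (λ N → 1ℚ + N)
    (trans (ℕ→ℚ-suc (i ℕ.+ k)) (cong (λ N → 1ℚ + N) (ℕ→ℚ-+ i k))))

  span-pos : ∀ i k → 0ℚ < span i k
  span-pos i k = ℚ.<-≤-trans 0<1 (p+-nonneg {1ℚ}
    (+-nonneg 0≤1 (+-nonneg (ℕ→ℚ-nonneg i) (ℕ→ℚ-nonneg k))))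

  -- zᵐ (m - 1)! / ((m - k)! (m + k)!) for m = i + 1; the truncated subtraction
  -- makes this 0 for k > m.
  weight : ℕ → ℕ → ℚ
  weight i zero    = expTerm z (suc i) * unit i
  weight i (suc k) = weight i k * ℕ→ℚ (suc i ℕ.∸ k) * unit (suc (i ℕ.+ k))

  weight-nonneg : ∀ i k → 0ℚ ≤ weight i k
  weight-nonneg i zero    = *-nonneg (expTerm-nonneg z 0≤z (suc i)) (unit-nonneg i)
  weight-nonneg i (suc k) = *-nonneg
    (*-nonneg (weight-nonneg i k) (ℕ→ℚ-nonneg (suc i ℕ.∸ k))) (unit-nonneg (suc (i ℕ.+ k)))

  weight-vanish : ∀ i k → suc i ℕ.≤ k → weight i (suc k) ≡ 0ℚ
  weight-vanish i k h = trans
    (cong (λ d → weight i k * ℕ→ℚ d * unit (suc (i ℕ.+ k))) (ℕ.m≤n⇒m∸n≡0 h))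
    (solve 2 (λ w u → w :* con 0ℚ :* u := con 0ℚ) refl (weight i k) (unit (suc (i ℕ.+ k))))

  -- Truncated and genuine subtraction differ only for k > i + 1, and there the weight is 0.
  weight-gap : ∀ i k → weight i k * ℕ→ℚ (suc i ℕ.∸ k) ≡ (1ℚ + ℕ→ℚ i - ℕ→ℚ k) * weight i k
  weight-gap i k = split k (ℕ.≤-total k (suc i))
    where
    Gap : ℕ → Set
    Gap k = weight i k * ℕ→ℚ (suc i ℕ.∸ k) ≡ (1ℚ + ℕ→ℚ i - ℕ→ℚ k) * weight i k
    below : ∀ k → k ℕ.≤ suc i → Gap k
    below k h = combine₁ (weight i k)
      (trans (sym (ℕ→ℚ-+ (suc i ℕ.∸ k) k)) (trans (cong ℕ→ℚ (ℕ.m∸n+n≡m h)) (ℕ→ℚ-suc i)))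
      (solve 4 (λ w d k i → w :* d :- (con 1ℚ :+ i :- k) :* w := w :* (d :+ k :- (con 1ℚ :+ i)))
        refl (weight i k) (ℕ→ℚ (suc i ℕ.∸ k)) (ℕ→ℚ k) (ℕ→ℚ i))
    zeros : ∀ {w} d c → w ≡ 0ℚ → w * d ≡ c * w
    zeros d c refl = trans (ℚ.*-zeroˡ d) (sym (ℚ.*-zeroʳ c))
    above : ∀ k → suc i ℕ.< suc k ⊎ suc i ≡ suc k → Gap (suc k)
    above k (inj₁ (ℕ.s≤s i<k)) = zeros (ℕ→ℚ (i ℕ.∸ k)) (1ℚ + ℕ→ℚ i - ℕ→ℚ (suc k)) (weight-vanish i k i<k)
    above k (inj₂ refl)        = below (suc k) ℕ.≤-refl
    split : ∀ k → k ℕ.≤ suc i ⊎ suc i ℕ.≤ k → Gap k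
    split k       (inj₁ h) = below k h
    split (suc k) (inj₂ h) = above k (ℕ.m≤n⇒m<n∨m≡n h)

  weight-step : ∀ i k → span i k * weight i (suc k) ≡ (1ℚ + ℕ→ℚ i - ℕ→ℚ k) * weight i k
  weight-step i k = combine₃ (weight i k * ℕ→ℚ (suc i ℕ.∸ k)) 1ℚ
    (- (weight i k * ℕ→ℚ (suc i ℕ.∸ k) * unit (suc (i ℕ.+ k))))
    (unit-inverse (suc (i ℕ.+ k))) (weight-gap i k) (span≡ i k)
    (solve 5 (λ s wd u R n → s :* (wd :* u) :- R
        := wd :* (n :* u :- con 1ℚ) :+ con 1ℚ :* (wd :- R) :+ (:- (wd :* u)) :* (n :- s))
      refl (span i k) (weight i k * ℕ→ℚ (suc i ℕ.∸ k)) (unit (suc (i ℕ.+ k)))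
      ((1ℚ + ℕ→ℚ i - ℕ→ℚ k) * weight i k) (ℕ→ℚ (suc (suc (i ℕ.+ k)))))

  expTerm-step : ∀ q i → (1ℚ + ℕ→ℚ i) * expTerm q (suc i) ≡ q * expTerm q i
  expTerm-step q i = combine₂ (expTerm q i * q) (- (expTerm q i * q * unit i))
    (unit-inverse i) (ℕ→ℚ-suc i)
    (solve 5 (λ t q u n i → (con 1ℚ :+ i) :* (t :* q :* u) :- q :* t
        := t :* q :* (n :* u :- con 1ℚ) :+ (:- (t :* q :* u)) :* (n :- (con 1ℚ :+ i)))
      refl (expTerm q i) q (unit i) (ℕ→ℚ (suc i)) (ℕ→ℚ i))

  -- By the closed form the quotient of the weights at m + 1 and m is zm/((m + 1 - k)(m + 1 + k)).
  -- The denominator stays multiplied out because it vanishes at k = m + 1.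
  weight-shift : ∀ i k → (1ℚ + (1ℚ + ℕ→ℚ i) - ℕ→ℚ k) * (span i k * weight (suc i) k)
                         ≡ (1ℚ + ℕ→ℚ i) * z * weight i k
  weight-shift i zero = combine₃ (n * unit (suc i)) (z * t) (- (z * t))
    (subst (λ N → (1ℚ + N) * t′ ≡ z * t) (ℕ→ℚ-suc i) (expTerm-step z (suc i)))
    (subst (λ N → N * unit (suc i) ≡ 1ℚ) (ℕ→ℚ-suc-suc i) (unit-inverse (suc i)))
    (subst (λ N → N * unit i ≡ 1ℚ) (ℕ→ℚ-suc i) (unit-inverse i))
    (solve 6 (λ i t′ u′ z t u → let n = con 1ℚ :+ (con 1ℚ :+ i) in
        (n :- con 0ℚ) :* ((con 1ℚ :+ (con 1ℚ :+ (i :+ con 0ℚ))) :* (t′ :* u′))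
          :- (con 1ℚ :+ i) :* z :* (t :* u)
        := n :* u′ :* (n :* t′ :- z :* t) :+ z :* t :* (n :* u′ :- con 1ℚ)
          :+ (:- (z :* t)) :* ((con 1ℚ :+ i) :* u :- con 1ℚ))
      refl (ℕ→ℚ i) t′ (unit (suc i)) z t (unit i))
    where
    t t′ n : ℚ
    t  = expTerm z (suc i)
    t′ = expTerm z (suc (suc i))
    n  = 1ℚ + (1ℚ + ℕ→ℚ i)
    ℕ→ℚ-suc-suc : ∀ i → ℕ→ℚ (suc (suc i)) ≡ 1ℚ + (1ℚ + ℕ→ℚ i)
    ℕ→ℚ-suc-suc i = trans (ℕ→ℚ-suc (suc i)) (cong (λ N → 1ℚ + N) (ℕ→ℚ-suc i))
  weight-shift i (suc k) = cancel (span i k) (span-pos i k)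
    (subst (λ N → span i k * ((1ℚ + (1ℚ + ℕ→ℚ i) - N) * ((1ℚ + (1ℚ + (ℕ→ℚ i + N))) * W′))
                  ≡ span i k * ((1ℚ + ℕ→ℚ i) * z * V′)) (sym (ℕ→ℚ-suc k))
      -- Three sides of the square with corners (m, k) and (m + 1, k + 1) give the fourth: the step
      -- in row m + 1, the shift at k and the step in row m.
      (combine₃ (D * (1ℚ + ℕ→ℚ i - ℕ→ℚ k)) (1ℚ + ℕ→ℚ i - ℕ→ℚ k) (- ((1ℚ + ℕ→ℚ i) * z))
        (subst (λ N → (1ℚ + (1ℚ + (N + ℕ→ℚ k))) * W′ ≡ (1ℚ + N - ℕ→ℚ k) * W) (ℕ→ℚ-suc i)
          (weight-step (suc i) k))
        (weight-shift i k) (weight-step i k)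
        (solve 7 (λ i k z V V′ W W′ →
          let D  = con 1ℚ :+ (con 1ℚ :+ (i :+ k))
              i′ = con 1ℚ :+ i
              k′ = con 1ℚ :+ k
          in D :* ((con 1ℚ :+ i′ :- k′) :* ((con 1ℚ :+ (con 1ℚ :+ (i :+ k′))) :* W′))
               :- D :* (i′ :* z :* V′)
          := D :* (con 1ℚ :+ i :- k) :* ((con 1ℚ :+ (con 1ℚ :+ (i′ :+ k))) :* W′ :- (con 1ℚ :+ i′ :- k) :* W)
            :+ (con 1ℚ :+ i :- k) :* ((con 1ℚ :+ i′ :- k) :* (D :* W) :- i′ :* z :* V)
            :+ (:- (i′ :* z)) :* (D :* V′ :- (con 1ℚ :+ i :- k) :* V))
          refl (ℕ→ℚ i) (ℕ→ℚ k) z V V′ W W′)))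
    where
    D V V′ W W′ : ℚ
    D  = span i k
    V  = weight i k
    V′ = weight i (suc k)
    W  = weight (suc i) k
    W′ = weight (suc i) (suc k)

  -- Equal to zᵐ (m - 1)!/((m - k - 1)! (m + k)!) for k < m, the coefficient of the Hermite integral
  -- zᵏ⁺¹/k! ∫₀¹ xᵏ(1 - x)ᵏ exp(zx) dx.
  remainder : ℕ → ℕ → ℚ
  remainder i k = span i k * weight i (suc k)

  -- For k ≥ 1 this is half the drop from `remainder i (k - 1)` to `remainder i k`.
  difference : ℕ → ℕ → ℚ
  difference i k = ℕ→ℚ k * weight i k

  remainder-nonneg : ∀ i k → 0ℚ ≤ remainder i k
  remainder-nonneg i k = *-nonneg (<⇒≤ (span-pos i k)) (weight-nonneg i (suc k))

  difference-nonneg : ∀ i k → 0ℚ ≤ difference i k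
  difference-nonneg i k = *-nonneg (ℕ→ℚ-nonneg k) (weight-nonneg i k)

  remainder-weight : ∀ i k → span i k * remainder (suc i) k ≡ (1ℚ + ℕ→ℚ i) * z * weight i k
  remainder-weight i k = trans
    (cong (span i k *_) (subst (λ N → remainder (suc i) k ≡ (1ℚ + N - ℕ→ℚ k) * weight (suc i) k)
      (ℕ→ℚ-suc i) (weight-step (suc i) k)))
    (trans (solve 3 (λ s d w → s :* (d :* w) := d :* (s :* w)) refl
      (span i k) (1ℚ + (1ℚ + ℕ→ℚ i) - ℕ→ℚ k) (weight (suc i) k))
      (weight-shift i k))

  -- Splits m + k + 1 as 2(k + 1) + (m - k - 1). Summed over m, this yields the partial quotient 2s
  -- - 1.
  remainder-difference : ∀ i k → remainder i k ≡ 2ℚ * difference i (suc k) + remainder i (suc k)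
  remainder-difference i k = subst
    (λ N → remainder i k ≡ 2ℚ * (N * weight i (suc k)) + remainder i (suc k)) (sym (ℕ→ℚ-suc k))
    (combine₁ (- 1ℚ)
      (subst (λ N → remainder i (suc k) ≡ (1ℚ + ℕ→ℚ i - N) * weight i (suc k)) (ℕ→ℚ-suc k)
        (weight-step i (suc k)))
      (solve 4 (λ i k V′ r′ → (con 1ℚ :+ (con 1ℚ :+ (i :+ k))) :* V′
            :- (con 2ℚ :* ((con 1ℚ :+ k) :* V′) :+ r′)
          := (:- con 1ℚ) :* (r′ :- (con 1ℚ :+ i :- (con 1ℚ :+ k)) :* V′))
        refl (ℕ→ℚ i) (ℕ→ℚ k) (weight i (suc k)) (remainder i (suc k))))

  -- The source of the partial quotients (2k + 1)ℓ - 1: the odd factor depends on k alone and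
  -- survives the summation over m.
  remainder-odd : ∀ i k → (1ℚ + 2ℚ * ℕ→ℚ k) * remainder (suc i) k
                          ≡ z * (difference i (suc k) + difference i k)
  remainder-odd i k = cancel (span i k) (span-pos i k)
    (subst (λ N → span i k * ((1ℚ + 2ℚ * ℕ→ℚ k) * remainder (suc i) k)
                  ≡ span i k * (z * (N * V′ + difference i k))) (sym (ℕ→ℚ-suc k))
      (combine₂ (1ℚ + 2ℚ * ℕ→ℚ k) (- (z * (1ℚ + ℕ→ℚ k)))
        (remainder-weight i k) (weight-step i k)
        (solve 6 (λ i k z V V′ r →
          let D = con 1ℚ :+ (con 1ℚ :+ (i :+ k))
              o = con 1ℚ :+ con 2ℚ :* k
          in D :* (o :* r) :- D :* (z :* ((con 1ℚ :+ k) :* V′ :+ k :* V))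
          := o :* (D :* r :- (con 1ℚ :+ i) :* z :* V)
            :+ (:- (z :* (con 1ℚ :+ k))) :* (D :* V′ :- (con 1ℚ :+ i :- k) :* V))
          refl (ℕ→ℚ i) (ℕ→ℚ k) z (weight i k) V′ (remainder (suc i) k))))
    where
    V′ : ℚ
    V′ = weight i (suc k)

  odd : ℕ → ℚ
  odd i = 1ℚ + 2ℚ * (1ℚ + ℕ→ℚ i)

  -- Here the odd factor depends on m alone and the differences telescope in k, so the relation can
  -- be summed over k.
  remainder-recurrence : ∀ i k → odd i * remainder (suc i) k
    ≡ z * (2ℚ * remainder i k + difference i k - difference i (suc k))
  remainder-recurrence i k = cancel (span i k) (span-pos i k)
    (subst (λ N → span i k * (odd i * remainder (suc i) k)
        ≡ span i k * (z * (2ℚ * remainder i k + difference i k - N * V′))) (sym (ℕ→ℚ-suc k))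
      (combine₂ (odd i) (- (z * (2ℚ * span i k - (1ℚ + ℕ→ℚ k))))
        (remainder-weight i k) (weight-step i k)
        (solve 6 (λ i k z V V′ r →
          let D = con 1ℚ :+ (con 1ℚ :+ (i :+ k))
              o = con 1ℚ :+ con 2ℚ :* (con 1ℚ :+ i)
          in D :* (o :* r) :- D :* (z :* (con 2ℚ :* (D :* V′) :+ k :* V :- (con 1ℚ :+ k) :* V′))
          := o :* (D :* r :- (con 1ℚ :+ i) :* z :* V)
            :+ (:- (z :* (con 2ℚ :* D :- (con 1ℚ :+ k)))) :* (D :* V′ :- (con 1ℚ :+ i :- k) :* V))
          refl (ℕ→ℚ i) (ℕ→ℚ k) z (weight i k) V′ (remainder (suc i) k))))
    where
    V′ : ℚ
    V′ = weight i (suc k)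

  oddUnit : ℕ → ℚ
  oddUnit i = unit (2 ℕ.* suc i)

  oddUnit-inverse : ∀ i → odd i * oddUnit i ≡ 1ℚ
  oddUnit-inverse i = subst (λ N → N * oddUnit i ≡ 1ℚ)
    (trans (ℕ→ℚ-suc (2 ℕ.* suc i)) (cong (λ N → 1ℚ + N)
      (trans (ℕ→ℚ-* 2 (suc i)) (cong (ℕ→ℚ 2 *_) (ℕ→ℚ-suc i)))))
    (unit-inverse (2 ℕ.* suc i))

  odd-pos : ∀ i → 0ℚ < odd i
  odd-pos i = ℚ.<-≤-trans 0<1 (p+-nonneg {1ℚ}
    (*-nonneg (ℚ.nonNegative⁻¹ 2ℚ) (+-nonneg 0≤1 (ℕ→ℚ-nonneg i))))

  -- tail i k sums remainder i k′ over k′ ≥ k.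
  tail : ℕ → ℕ → ℚ
  tail zero    zero    = z
  tail zero    (suc k) = 0ℚ
  tail (suc i) k       = oddUnit i * (z * (2ℚ * tail i k + difference i k))

  tail-recurrence : ∀ i k → odd i * tail (suc i) k ≡ z * (2ℚ * tail i k + difference i k)
  tail-recurrence i k = combine₁ (z * (2ℚ * tail i k + difference i k)) (oddUnit-inverse i)
    (solve 3 (λ o u x → o :* (u :* x) :- x := x :* (o :* u :- con 1ℚ)) refl
      (odd i) (oddUnit i) (z * (2ℚ * tail i k + difference i k)))

  remainder-vanish : ∀ i k → suc i ℕ.≤ k → remainder i k ≡ 0ℚ
  remainder-vanish i k h =
    trans (cong (span i k *_) (weight-vanish i k h)) (ℚ.*-zeroʳ (span i k))

  remainder-zero-zero : remainder 0 0 ≡ z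
  remainder-zero-zero = trans (weight-step 0 0)
    (solve 1 (λ z → (con 1ℚ :+ con 0ℚ :- con 0ℚ) :* (con 1ℚ :* z :* con 1ℚ :* con 1ℚ) := z) refl z)

  -- The recursion of `tail` is `remainder-recurrence` summed over k′ ≥ k, where the telescoping
  -- differences leave the single term `difference i k`.
  tail-step : ∀ i k → tail i k ≡ remainder i k + tail i (suc k)
  tail-step zero zero = sym (trans (ℚ.+-identityʳ (remainder 0 0)) remainder-zero-zero)
  tail-step zero (suc k) = sym (trans (ℚ.+-identityʳ (remainder 0 (suc k)))
    (remainder-vanish 0 (suc k) (ℕ.s≤s ℕ.z≤n)))
  tail-step (suc i) k = cancel (odd i) (odd-pos i) (trans (tail-recurrence i k)
    (sym (trans (ℚ.*-distribˡ-+ (odd i) (remainder (suc i) k) (tail (suc i) (suc k)))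
    (trans (cong₂ _+_ (remainder-recurrence i k) (tail-recurrence i (suc k)))
      (combine₁ (- (2ℚ * z)) (tail-step i k)
        (solve 6 (λ z y y′ r a a′ →
            z :* (con 2ℚ :* r :+ a :- a′) :+ z :* (con 2ℚ :* y′ :+ a′) :- z :* (con 2ℚ :* y :+ a)
            := (:- (con 2ℚ :* z)) :* (y :- (r :+ y′)))
          refl z (tail i k) (tail i (suc k)) (remainder i k) (difference i k) (difference i (suc k))))))))

  tail-vanish : ∀ i k → i ℕ.< k → tail i k ≡ 0ℚ
  tail-vanish zero    (suc k) _ = refl
  tail-vanish (suc i) (suc k) (ℕ.s≤s h) = trans
    (cong₂ (λ y a → oddUnit i * (z * (2ℚ * y + a)))
      (tail-vanish i (suc k) (ℕ.≤-trans h (ℕ.n≤1+n k)))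
      (trans (cong (ℕ→ℚ (suc k) *_) (weight-vanish i k h)) (ℚ.*-zeroʳ (ℕ→ℚ (suc k)))))
    (solve 2 (λ u z → u :* (z :* (con 2ℚ :* con 0ℚ :+ con 0ℚ)) := con 0ℚ) refl (oddUnit i) z)

  tail-nonneg : ∀ i k → 0ℚ ≤ tail i k
  tail-nonneg zero    zero    = 0≤z
  tail-nonneg zero    (suc k) = ≤-refl
  tail-nonneg (suc i) k       = *-nonneg (unit-nonneg (2 ℕ.* suc i)) (*-nonneg 0≤z
    (+-nonneg (*-nonneg (ℚ.nonNegative⁻¹ 2ℚ) (tail-nonneg i k)) (difference-nonneg i k)))

  tail-antitone : ∀ i k → tail i k ≤ tail i 0
  tail-antitone i zero    = ≤-refl
  tail-antitone i (suc k) = ≤-trans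
    (by-diff (remainder i k) (remainder-nonneg i k)
      (trans (ℚ.+-comm (tail i (suc k)) (remainder i k)) (sym (tail-step i k))))
    (tail-antitone i k)

  remainder≤tail : ∀ i k → remainder i k ≤ tail i 0
  remainder≤tail i k = ≤-trans
    (by-diff (tail i (suc k)) (tail-nonneg i (suc k)) (sym (tail-step i k))) (tail-antitone i k)

  module _ (z≤1 : z ≤ 1ℚ) where

    -- At k = 0 the difference term vanishes and the ratio is 2z/(2m + 1); i ≥ 3 makes 2m + 1 at
    -- least 9, hence the ratio less than 1/4.
    tail-decay : ∀ i → 3 ℕ.≤ i → tail (suc i) 0 ≤ ¼ * tail i 0
    tail-decay i 3≤i = by-diff
      (½ * ½ * ½ * (2ℚ * ((1ℚ - z) * y) + (1ℚ + 2ℚ * (I - ℕ→ℚ 3)) * y′))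
      (*-nonneg (ℚ.nonNegative⁻¹ (½ * ½ * ½)) (+-nonneg
        (*-nonneg 0≤2 (*-nonneg (diff-nonneg z≤1) (tail-nonneg i 0)))
        (*-nonneg (+-nonneg 0≤1 (*-nonneg 0≤2 (diff-nonneg (ℕ→ℚ-mono 3≤i)))) (tail-nonneg (suc i) 0))))
      (combine₁ (½ * ½ * ½) (tail-recurrence i 0)
        (solve 5 (λ z I w y y′ → let ⅛ = con ½ :* con ½ :* con ½ in
            y′ :+ ⅛ :* (con 2ℚ :* ((con 1ℚ :- z) :* y)
              :+ (con 1ℚ :+ con 2ℚ :* (I :- con (ℕ→ℚ 3))) :* y′) :- con ½ :* con ½ :* y
            := ⅛ :* ((con 1ℚ :+ con 2ℚ :* (con 1ℚ :+ I)) :* y′ :- z :* (con 2ℚ :* y :+ con 0ℚ :* w)))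
          refl z I (weight i 0) y y′))
      where
      I y y′ : ℚ
      I  = ℕ→ℚ i
      y  = tail i 0
      y′ = tail (suc i) 0
      0≤2 : 0ℚ ≤ 2ℚ
      0≤2 = ℚ.nonNegative⁻¹ 2ℚ

    tail-geometric : ∃ λ K → 0ℚ ≤ K × ∀ i → tail i 0 ≤ K * ¼^ i
    tail-geometric = geometric-bound 3 (λ i → tail i 0) (λ i → tail-nonneg i 0) tail-decay

    private
      K : ℚ
      K = proj₁ tail-geometric
      0≤K : 0ℚ ≤ K
      0≤K = proj₁ (proj₂ tail-geometric)

    -- Only k ≤ i matters, since `tail` vanishes beyond; there one of the two factors ½ⁱ may be
    -- weakened to ½ᵏ.
    tail≤ : ∀ i k → tail i k ≤ K * ½^ k * ½^ i
    tail≤ i k = split (ℕ.≤-<-connex k i)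
      where
      split : k ℕ.≤ i ⊎ i ℕ.< k → tail i k ≤ K * ½^ k * ½^ i
      split (inj₁ k≤i) = ≤-trans (tail-antitone i k) (≤-trans (proj₂ (proj₂ tail-geometric) i)
        (≤-trans (*-monoˡ K 0≤K (*-monoʳ (½^ i) (0≤½^ i) (½^-antitone k≤i)))
          (≤-reflexive (sym (ℚ.*-assoc K (½^ k) (½^ i))))))
      split (inj₂ i<k) = ≤-trans (≤-reflexive (tail-vanish i k i<k))
        (*-nonneg (*-nonneg 0≤K (0≤½^ k)) (0≤½^ i))

    sum-tail≤ : ∀ k n → sum (λ i → tail i k) n ≤ K * ½^ k * 2ℚ
    sum-tail≤ k = sum-geometric (K * ½^ k) (λ i → tail≤ i k) (*-nonneg 0≤K (0≤½^ k))

-- Partial quotients, and the errors as power series in z.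

module Quotients where

  -- Follows the recursion of `expansion-ℓs`, but also admits ℓ = 1, where the very first quotient
  -- is 0; the second expansion is read off from that case.
  quotient : ℕ → ℕ → ℕ → ℕ → ℕ
  quotient ℓ s k 0 = (1 ℕ.+ 2 ℕ.* k) ℕ.* ℓ ℕ.∸ 1
  quotient ℓ s k 1 = 1
  quotient ℓ s k 2 = 2 ℕ.* s ℕ.∸ 1
  quotient ℓ s k (suc (suc (suc n))) = quotient ℓ s (suc k) n

module Magnitudes (ℓ s : ℕ) (z : ℚ) (0≤z : 0ℚ ℚ.≤ z) (z≤1 : z ℚ.≤ 1ℚ) (1≤ℓ : 1 ℕ.≤ ℓ) (1≤s : 1 ℕ.≤ s)
  (zℓs≡1 : z ℚ.* (RationalLemmas.ℕ→ℚ ℓ ℚ.* RationalLemmas.ℕ→ℚ s) ≡ 1ℚ) where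

  open import Data.Rational.Base
  open import Data.Rational.Properties using (≤-refl; ≤-trans; ≤-reflexive; <⇒≤; +-mono-≤)
  open +-*-Solver
  open RationalLemmas
  open Approximations
  open RationalTools
  open Asymptotics
  open Coefficients z 0≤z
  open Quotients

  L S : ℚ
  L = ℕ→ℚ ℓ
  S = ℕ→ℚ s

  -- With p₋₁ = 1 and q₋₁ = 0, the sequences A k, B k and C k converge to
  -- |pₙ - α qₙ| for n = 3k - 1, 3k and 3k + 1.
  A B C : ℕ → ℕ → ℚ
  A zero    j = 1ℚ
  A (suc k) j = sum (λ i → difference i (suc k)) j
  B k j = S * sum (λ i → remainder i k) j
  C k j = B k j - A (suc k) j

  sum-remainder : ∀ k j → sum (λ i → remainder i k) j ≡ 2ℚ * A (suc k) j + sum (λ i → remainder i (suc k)) j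
  sum-remainder k j = trans (sum-cong (λ i → remainder-difference i k) j)
    (trans (sum-+ (λ i → 2ℚ * difference i (suc k)) (λ i → remainder i (suc k)) j)
      (cong (_+ sum (λ i → remainder i (suc k)) j) (sum-* 2ℚ (λ i → difference i (suc k)) j)))

  B-step : ∀ k j → B (suc k) j ≡ B k j - 2ℚ * S * A (suc k) j
  B-step k j = combine₁ (- S) (sum-remainder k j)
    (solve 4 (λ S R R′ A → S :* R′ :- (S :* R :- con 2ℚ :* S :* A) := (:- S) :* (R :- (con 2ℚ :* A :+ R′)))
      refl S (sum (λ i → remainder i k) j) (sum (λ i → remainder i (suc k)) j) (A (suc k) j))

  A-nonneg : ∀ k j → 0ℚ ≤ A k j
  A-nonneg zero    j = 0≤1
  A-nonneg (suc k) j = sum-nonneg (λ i → difference-nonneg i (suc k)) j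

  0≤S : 0ℚ ≤ S
  0≤S = ℕ→ℚ-nonneg s

  B-nonneg : ∀ k j → 0ℚ ≤ B k j
  B-nonneg k j = *-nonneg 0≤S (sum-nonneg (λ i → remainder-nonneg i k) j)

  -- With B = sR and R = 2A + R′, the difference B - A is (s - 1)R + A + R′, and s ≥ 1.
  C-nonneg : ∀ k j → 0ℚ ≤ C k j
  C-nonneg k j = ≤-trans
    (+-nonneg (*-nonneg (diff-nonneg (ℕ→ℚ-mono 1≤s)) (sum-nonneg (λ i → remainder-nonneg i k) j))
      (+-nonneg (A-nonneg (suc k) j) (sum-nonneg (λ i → remainder-nonneg i (suc k)) j)))
    (≤-reflexive (combine₁ (- 1ℚ) (sum-remainder k j)
      (solve 4 (λ S R R′ A → (S :- con 1ℚ) :* R :+ (A :+ R′) :- (S :* R :- A)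
        := (:- con 1ℚ) :* (R :- (con 2ℚ :* A :+ R′)))
        refl S (sum (λ i → remainder i k) j) (sum (λ i → remainder i (suc k)) j) (A (suc k) j))))

  -- Accounts for the coefficient m = 1, which `remainder-odd` does not reach. For k = 0 it is this
  -- coefficient that produces the error 1 of p₋₁ = 1, q₋₁ = 0.
  first-remainder : ∀ k j → (1ℚ + 2ℚ * ℕ→ℚ k) * remainder 0 k + z * sum (λ i → difference i k) j ≡ z * A k j
  first-remainder zero j = trans
    (cong₂ (λ r d → (1ℚ + 2ℚ * 0ℚ) * r + z * d) remainder-zero-zero (vanish j))
    (solve 1 (λ z → (con 1ℚ :+ con 2ℚ :* con 0ℚ) :* z :+ z :* con 0ℚ := z :* con 1ℚ) refl z)
    where
    vanish : ∀ j → sum (λ i → difference i 0) j ≡ 0ℚ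
    vanish zero    = refl
    vanish (suc j) = trans (cong₂ _+_ (vanish j) (ℚ.*-zeroˡ (weight j 0))) (ℚ.+-identityˡ 0ℚ)
  first-remainder (suc k) j = trans
    (cong (λ r → (1ℚ + 2ℚ * ℕ→ℚ (suc k)) * r + z * A (suc k) j)
      (remainder-vanish 0 (suc k) (ℕ.s≤s ℕ.z≤n)))
    (solve 2 (λ o x → o :* con 0ℚ :+ x := x) refl (1ℚ + 2ℚ * ℕ→ℚ (suc k)) (z * A (suc k) j))

  sum-remainder-odd : ∀ k j → (1ℚ + 2ℚ * ℕ→ℚ k) * sum (λ i → remainder i k) (suc j) ≡ z * (A (suc k) j + A k j)
  sum-remainder-odd k j = trans (cong (o *_) (sum-peel (λ i → remainder i k) j))
    (trans (ℚ.*-distribˡ-+ o (remainder 0 k) (sum (λ i → remainder (suc i) k) j))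
    (trans (cong (λ x → o * remainder 0 k + x) rest)
    (combine₁ 1ℚ (first-remainder k j)
      (solve 5 (λ r z D A A′ → r :+ z :* (A′ :+ D) :- z :* (A′ :+ A) := con 1ℚ :* (r :+ z :* D :- z :* A))
        refl (o * remainder 0 k) z (sum (λ i → difference i k) j) (A k j) (A (suc k) j)))))
    where
    o : ℚ
    o = 1ℚ + 2ℚ * ℕ→ℚ k
    rest : o * sum (λ i → remainder (suc i) k) j ≡ z * (A (suc k) j + sum (λ i → difference i k) j)
    rest = trans (sym (sum-* o (λ i → remainder (suc i) k) j))
      (trans (sum-cong (λ i → remainder-odd i k) j)
      (trans (sum-* z (λ i → difference i (suc k) + difference i k) j)
        (cong (z *_) (sum-+ (λ i → difference i (suc k)) (λ i → difference i k) j))))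

  private
    K : ℚ
    K = proj₁ (tail-geometric z≤1)
    0≤K : 0ℚ ≤ K
    0≤K = proj₁ (proj₂ (tail-geometric z≤1))

  remainder≤ : ∀ i k → remainder i k ≤ K * ½^ i
  remainder≤ i k = ≤-trans (remainder≤tail i k) (≤-trans (proj₂ (proj₂ (tail-geometric z≤1)) i)
    (*-monoˡ K 0≤K (¼^≤½^ i)))

  B-shift : ∀ k → B k ≋ (λ j → B k (suc j))
  B-shift k = ≋-geometric (S * K) (*-nonneg 0≤S 0≤K) λ j → ≤-trans
    (≤-reflexive (trans (cong ∣_∣ (solve 3 (λ S R r → S :* R :- S :* (R :+ r) := :- (S :* r)) refl
        S (sum (λ i → remainder i k) j) (remainder j k)))
      (trans (ℚ.∣-p∣≡∣p∣ (S * remainder j k)) (ℚ.0≤p⇒∣p∣≡p (*-nonneg 0≤S (remainder-nonneg j k))))))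
    (≤-trans (*-monoˡ S 0≤S (remainder≤ j k)) (≤-reflexive (sym (ℚ.*-assoc S K (½^ j)))))

  -- Multiplication by ℓs = 1/z removes the factor z from `sum-remainder-odd`. Since that identity
  -- compares truncations of different length, the result holds only up to a null sequence, unlike
  -- the relations behind the quotients 1 and 2s - 1.
  B-odd : ∀ k → (λ j → (1ℚ + 2ℚ * ℕ→ℚ k) * L * B k j) ≋ (λ j → A (suc k) j + A k j)
  B-odd k = ≋-trans (≋-constant-scale ((1ℚ + 2ℚ * ℕ→ℚ k) * L) (B-shift k)) (≋-reflexive λ j →
    combine₂ (L * S) (A (suc k) j + A k j) (sum-remainder-odd k j) zℓs≡1
      (solve 6 (λ o L S R z A → o :* L :* (S :* R) :- A
          := L :* S :* (o :* R :- z :* A) :+ A :* (z :* (L :* S) :- con 1ℚ))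
        refl (1ℚ + 2ℚ * ℕ→ℚ k) L S (sum (λ i → remainder i k) (suc j)) z (A (suc k) j + A k j)))

  magnitude : ℕ → ℕ → ℕ → ℚ
  magnitude k 0 = B k
  magnitude k 1 = C k
  magnitude k 2 = A (suc k)
  magnitude k (suc (suc (suc n))) = magnitude (suc k) n

  magnitude-nonneg : ∀ k n j → 0ℚ ≤ magnitude k n j
  magnitude-nonneg k 0 = B-nonneg k
  magnitude-nonneg k 1 = C-nonneg k
  magnitude-nonneg k 2 = A-nonneg (suc k)
  magnitude-nonneg k (suc (suc (suc n))) = magnitude-nonneg (suc k) n

  ℕ→ℚ-pred : ∀ {n} → 1 ℕ.≤ n → ℕ→ℚ (n ℕ.∸ 1) ≡ ℕ→ℚ n - 1ℚ
  ℕ→ℚ-pred {n} 1≤n = combine₁ 1ℚ (trans (sym (ℕ→ℚ-+ (n ℕ.∸ 1) 1)) (cong ℕ→ℚ (ℕ.m∸n+n≡m 1≤n)))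
    (solve 2 (λ m n → m :- (n :- con 1ℚ) := con 1ℚ :* (m :+ con 1ℚ :- n)) refl (ℕ→ℚ (n ℕ.∸ 1)) (ℕ→ℚ n))

  quotient-0 : ∀ k → ℕ→ℚ (quotient ℓ s k 0) ≡ (1ℚ + 2ℚ * ℕ→ℚ k) * L - 1ℚ
  quotient-0 k = trans (ℕ→ℚ-pred (ℕ.≤-trans 1≤ℓ (ℕ.m≤m+n ℓ (2 ℕ.* k ℕ.* ℓ))))
    (cong (_- 1ℚ) (trans (ℕ→ℚ-* (1 ℕ.+ 2 ℕ.* k) ℓ) (cong (_* L)
      (trans (ℕ→ℚ-suc (2 ℕ.* k)) (cong (λ N → 1ℚ + N) (ℕ→ℚ-* 2 k))))))

  quotient-2 : ∀ k → ℕ→ℚ (quotient ℓ s k 2) ≡ 2ℚ * S - 1ℚ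
  quotient-2 k = trans (ℕ→ℚ-pred (ℕ.≤-trans 1≤s (ℕ.m≤m+n s (1 ℕ.* s))))
    (cong (_- 1ℚ) (ℕ→ℚ-* 2 s))

  C-recurrence : ∀ k → C k ≋ (λ j → A k j - ℕ→ℚ (quotient ℓ s k 0) * B k j)
  C-recurrence k = ≋-trans
    (≋-reflexive λ j → solve 3 (λ A A′ B → B :- A′ := A :- (A′ :+ A :- B)) refl (A k j) (A (suc k) j) (B k j))
    (≋-trans (≋-minus (≋-refl {A k}) (≋-minus (≋-sym (B-odd k)) (≋-refl {B k})))
    (≋-reflexive λ j → combine₁ (B k j) (quotient-0 k)
      (solve 4 (λ A o B q → A :- (o :* B :- B) :- (A :- q :* B) := B :* (q :- (o :- con 1ℚ))) refl
        (A k j) ((1ℚ + 2ℚ * ℕ→ℚ k) * L) (B k j) (ℕ→ℚ (quotient ℓ s k 0)))))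

  magnitude-recurrence : ∀ k n → magnitude k (suc (suc n))
    ≋ (λ j → magnitude k n j - ℕ→ℚ (quotient ℓ s k (suc n)) * magnitude k (suc n) j)
  magnitude-recurrence k 0 = ≋-reflexive λ j →
    solve 2 (λ A B → A := B :- con 1ℚ :* (B :- A)) refl (A (suc k) j) (B k j)
  magnitude-recurrence k 1 = ≋-reflexive λ j →
    combine₂ 1ℚ (A (suc k) j) (B-step k j) (quotient-2 k)
      (solve 5 (λ A B B′ S q → B′ :- (B :- A :- q :* A)
          := con 1ℚ :* (B′ :- (B :- con 2ℚ :* S :* A)) :+ A :* (q :- (con 2ℚ :* S :- con 1ℚ)))
        refl (A (suc k) j) (B k j) (B (suc k) j) S (ℕ→ℚ (quotient ℓ s k 2)))
  magnitude-recurrence k 2 = C-recurrence (suc k)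
  magnitude-recurrence k (suc (suc (suc n))) = magnitude-recurrence (suc k) n

  -- Twice the sum of `B k′` over k′ ≥ k, which is the sum of all errors from group k on because C
  -- and the following A add up to B.
  total : ℕ → ℕ → ℚ
  total k j = 2ℚ * S * sum (λ i → tail i k) j

  total-step : ∀ k j → total k j ≡ 2ℚ * B k j + total (suc k) j
  total-step k j = combine₁ (2ℚ * S) sum-step
    (solve 4 (λ S T R T′ → con 2ℚ :* S :* T :- (con 2ℚ :* (S :* R) :+ con 2ℚ :* S :* T′)
        := con 2ℚ :* S :* (T :- (R :+ T′)))
      refl S (sum (λ i → tail i k) j) (sum (λ i → remainder i k) j) (sum (λ i → tail i (suc k)) j))
    where
    sum-step : sum (λ i → tail i k) j ≡ sum (λ i → remainder i k) j + sum (λ i → tail i (suc k)) j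
    sum-step = trans (sum-cong (λ i → tail-step i k) j) (sum-+ (λ i → remainder i k) (λ i → tail i (suc k)) j)

  total-nonneg : ∀ k j → 0ℚ ≤ total k j
  total-nonneg k j = *-nonneg (*-nonneg (ℚ.nonNegative⁻¹ 2ℚ) 0≤S) (sum-nonneg (λ i → tail-nonneg i k) j)

  total≤ : ∀ k j → total k j ≤ 2ℚ * S * (K * 2ℚ) * ½^ k
  total≤ k j = ≤-trans
    (*-monoˡ (2ℚ * S) (*-nonneg (ℚ.nonNegative⁻¹ 2ℚ) 0≤S) (sum-tail≤ z≤1 k j))
    (≤-reflexive (solve 3 (λ S K h → con 2ℚ :* S :* (K :* h :* con 2ℚ) := con 2ℚ :* S :* (K :* con 2ℚ) :* h)
      refl S K (½^ k)))

  -- What the first n errors from group k on leave of `total k`. Restarting at the next group is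
  -- consistent by `total-step`.
  residue : ℕ → ℕ → ℕ → ℚ
  residue k 0 j = total k j
  residue k 1 j = total k j - B k j
  residue k 2 j = total k j - B k j - C k j
  residue k (suc (suc (suc n))) = residue (suc k) n

  residue-step : ∀ k n j → residue k n j ≡ magnitude k n j + residue k (suc n) j
  residue-step k 0 j = solve 2 (λ T B → T := B :+ (T :- B)) refl (total k j) (B k j)
  residue-step k 1 j = solve 3 (λ T B C → T :- B := C :+ (T :- B :- C)) refl (total k j) (B k j) (C k j)
  residue-step k 2 j = combine₁ 1ℚ (total-step k j)
    (solve 4 (λ T B A T′ → T :- B :- (B :- A) :- (A :+ T′) := con 1ℚ :* (T :- (con 2ℚ :* B :+ T′))) refl
      (total k j) (B k j) (A (suc k) j) (total (suc k) j))
  residue-step k (suc (suc (suc n))) = residue-step (suc k) n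

  residue-nonneg : ∀ k n j → 0ℚ ≤ residue k n j
  residue-nonneg k 0 = total-nonneg k
  residue-nonneg k 1 j = ≤-trans (+-nonneg (C-nonneg k j) (residue-nonneg k 2 j))
    (≤-reflexive (sym (residue-step k 1 j)))
  residue-nonneg k 2 j = ≤-trans (+-nonneg (A-nonneg (suc k) j) (total-nonneg (suc k) j))
    (≤-reflexive (sym (residue-step k 2 j)))
  residue-nonneg k (suc (suc (suc n))) = residue-nonneg (suc k) n

  residue≤total : ∀ k n j → residue k n j ≤ total k j
  residue≤total k zero    j = ≤-refl
  residue≤total k (suc n) j = ≤-trans
    (by-diff (magnitude k n j) (magnitude-nonneg k n j)
      (trans (ℚ.+-comm (residue k (suc n) j) (magnitude k n j)) (sym (residue-step k n j))))
    (residue≤total k n j)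

  residue-shift : ∀ m k n → residue k (m ℕ.* 3 ℕ.+ n) ≡ residue (m ℕ.+ k) n
  residue-shift zero    k n = refl
  residue-shift (suc m) k n = trans (residue-shift m (suc k) n) (cong (λ i → residue i n) (ℕ.+-suc m k))

  partial-sum : ∀ n j → sum (λ i → magnitude 0 i j) n + residue 0 n j ≡ total 0 j
  partial-sum zero    j = ℚ.+-identityˡ (total 0 j)
  partial-sum (suc n) j = trans
    (trans (ℚ.+-assoc (sum (λ i → magnitude 0 i j) n) (magnitude 0 n j) (residue 0 (suc n) j))
      (cong (λ r → sum (λ i → magnitude 0 i j) n + r) (sym (residue-step 0 n j))))
    (partial-sum n j)

  -- After 3M errors the residue is at most `total M`, whose bound c·½ᴹ does not depend on j.
  partial-sum-close : ∀ ε → 0ℚ < ε → ∃ λ N → ∀ n → N ℕ.≤ n → ∀ j →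
                      ∣ sum (λ i → magnitude 0 i j) n - total 0 j ∣ ≤ ε
  partial-sum-close ε 0<ε = M ℕ.* 3 , λ n h j → ≤-trans
    (≤-reflexive (trans (dist-sym (sum (λ i → magnitude 0 i j) n) (total 0 j))
      (trans (cong ∣_∣ (combine₁ (- 1ℚ) (partial-sum n j)
          (solve 3 (λ T s r → T :- s :- r := (:- con 1ℚ) :* (s :+ r :- T)) refl
            (total 0 j) (sum (λ i → magnitude 0 i j) n) (residue 0 n j))))
        (ℚ.0≤p⇒∣p∣≡p (residue-nonneg 0 n j)))))
    (≤-trans (residue≤ n h j) (proj₂ small (M ℕ.+ 0) (ℕ.m≤m+n M 0)))
    where
    c : ℚ
    c = 2ℚ * S * (K * 2ℚ)
    small : ∃ λ M → ∀ k → M ℕ.≤ k → c * ½^ k ≤ ε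
    small = ½^-small c (*-nonneg (*-nonneg (ℚ.nonNegative⁻¹ 2ℚ) 0≤S)
      (*-nonneg 0≤K (ℚ.nonNegative⁻¹ 2ℚ))) 0<ε
    M : ℕ
    M = proj₁ small
    residue≤ : ∀ n → M ℕ.* 3 ℕ.≤ n → ∀ j → residue 0 n j ≤ c * ½^ (M ℕ.+ 0)
    residue≤ n h j = ≤-trans
      (≤-reflexive (cong-app (trans (cong (residue 0) (sym (ℕ.m+[n∸m]≡n h)))
        (residue-shift M 0 (n ℕ.∸ M ℕ.* 3))) j))
      (≤-trans (residue≤total (M ℕ.+ 0) (n ℕ.∸ M ℕ.* 3) j) (total≤ (M ℕ.+ 0) j))

  -- `remainder i 0` is the exponential coefficient zᵐ/m!, so `B 0` is the series of s(eᶻ - 1). It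
  -- lacks the constant term, hence the comparison with `expSum (suc j)`.
  B-exp : (λ j → S * expSum j z) ≋ (λ j → S + B 0 j)
  B-exp = ≋-trans (≋-geometric (S * K₁) (*-nonneg 0≤S 0≤K₁) late) (≋-reflexive early)
    where
    remainder-exp : ∀ i → remainder i 0 ≡ expTerm z (suc i)
    remainder-exp i = trans (weight-step i 0) (combine₁ t
      (subst (λ N → N * unit i ≡ 1ℚ) (ℕ→ℚ-suc i) (unit-inverse i))
      (solve 3 (λ i t u → (con 1ℚ :+ i :- con 0ℚ) :* (t :* u) :- t := t :* ((con 1ℚ :+ i) :* u :- con 1ℚ))
        refl (ℕ→ℚ i) t (unit i)))
      where
      t : ℚ
      t = expTerm z (suc i)
    expSum-sum : ∀ j → expSum (suc j) z ≡ 1ℚ + sum (λ i → remainder i 0) j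
    expSum-sum zero    = trans (ℚ.+-identityˡ 1ℚ) (sym (ℚ.+-identityʳ 1ℚ))
    expSum-sum (suc j) = trans (cong₂ _+_ (expSum-sum j) (sym (remainder-exp j)))
      (ℚ.+-assoc 1ℚ (sum (λ i → remainder i 0) j) (remainder j 0))
    -- The summand 1 covers z⁰/0!, the factor 2 the index shift from `remainder` to `expTerm`.
    K₁ : ℚ
    K₁ = K * 2ℚ + 1ℚ
    0≤K₁ : 0ℚ ≤ K₁
    0≤K₁ = +-nonneg (*-nonneg 0≤K (ℚ.nonNegative⁻¹ 2ℚ)) 0≤1
    expTerm≤ : ∀ j → expTerm z j ≤ K₁ * ½^ j
    expTerm≤ zero    = ≤-trans (nonneg+p (*-nonneg 0≤K (ℚ.nonNegative⁻¹ 2ℚ)))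
      (≤-reflexive (sym (ℚ.*-identityʳ K₁)))
    expTerm≤ (suc j) = ≤-trans (≤-reflexive (sym (remainder-exp j)))
      (≤-trans (remainder≤ j 0) (by-diff (½ * ½^ j) (*-nonneg 0≤½ (0≤½^ j))
        (solve 2 (λ K h → K :* h :+ con ½ :* h := (K :* con 2ℚ :+ con 1ℚ) :* (con ½ :* h)) refl K (½^ j))))
    late : ∀ j → ∣ S * expSum j z - S * expSum (suc j) z ∣ ≤ S * K₁ * ½^ j
    late j = ≤-trans
      (≤-reflexive (trans (cong ∣_∣ (solve 3 (λ S R r → S :* R :- S :* (R :+ r) := :- (S :* r)) refl
          S (expSum j z) (expTerm z j)))
        (trans (ℚ.∣-p∣≡∣p∣ (S * expTerm z j)) (ℚ.0≤p⇒∣p∣≡p (*-nonneg 0≤S (expTerm-nonneg z 0≤z j))))))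
      (≤-trans (*-monoˡ S 0≤S (expTerm≤ j)) (≤-reflexive (sym (ℚ.*-assoc S K₁ (½^ j)))))
    early : ∀ j → S * expSum (suc j) z ≡ S + B 0 j
    early j = trans (cong (S *_) (expSum-sum j))
      (solve 2 (λ S R → S :* (con 1ℚ :+ R) := S :+ S :* R) refl S (sum (λ i → remainder i 0) j))

-- The series of the Gaussian integral and its Riemann sums.

module GaussianSeries where

  open import Data.Rational.Base
  open import Data.Rational.Properties using (≤-refl; ≤-trans; ≤-reflexive; <⇒≤; +-mono-≤)
  open +-*-Solver
  open RationalLemmas
  open Approximations
  open RationalTools
  open Asymptotics

  -- Structural, so that `pow t (double (suc k))` unfolds to two more factors t.
  double : ℕ → ℕ
  double zero    = zero
  double (suc k) = suc (suc (double k))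

  ℕ→ℚ-double : ∀ k → ℕ→ℚ (suc (double k)) ≡ 1ℚ + 2ℚ * ℕ→ℚ k
  ℕ→ℚ-double zero    = refl
  ℕ→ℚ-double (suc k) = trans (ℕ→ℚ-suc (suc (suc (double k))))
    (trans (cong (λ N → 1ℚ + N) (ℕ→ℚ-suc (suc (double k))))
    (trans (cong (λ N → 1ℚ + (1ℚ + N)) (ℕ→ℚ-double k))
    (trans (solve 1 (λ k → con 1ℚ :+ (con 1ℚ :+ (con 1ℚ :+ con 2ℚ :* k)) := con 1ℚ :+ con 2ℚ :* (con 1ℚ :+ k))
        refl (ℕ→ℚ k))
      (cong (λ N → 1ℚ + 2ℚ * N) (sym (ℕ→ℚ-suc k))))))

  gaussTerm : ℚ → ℕ → ℚ
  gaussTerm c k = expTerm c k * unit (double k)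

  -- x · gaussSum n (- x²) is the truncated series of ∫₀ˣ exp (- t²) dt.
  gaussSum : ℕ → ℚ → ℚ
  gaussSum n c = sum (gaussTerm c) n

  module _ (B : ℚ) (0≤B : 0ℚ ≤ B) where

    ∣gaussTerm∣≤ : ∀ {c} → ∣ c ∣ ≤ B → ∀ k → ∣ gaussTerm c k ∣ ≤ expTerm B k
    ∣gaussTerm∣≤ {c} h k = ≤-trans
      (∣*∣-≤ {expTerm c k} {unit (double k)} {expTerm B k} {1ℚ} (expTerm-bound B 0≤B h k)
        (≤-trans (≤-reflexive (ℚ.0≤p⇒∣p∣≡p (unit-nonneg (double k)))) (unit≤1 (double k))))
      (≤-reflexive (ℚ.*-identityʳ (expTerm B k)))

    gaussTerm-dist : ∀ {p q δ} → ∣ p ∣ ≤ B → ∣ q ∣ ≤ B → ∣ p - q ∣ ≤ δ → ∀ k →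
      ∣ gaussTerm p (suc k) - gaussTerm q (suc k) ∣ ≤ δ * expTerm B k
    gaussTerm-dist {p} {q} {δ} hp hq h k = ≤-trans
      (≤-reflexive (cong ∣_∣ (solve 3 (λ a b u → a :* u :- b :* u := (a :- b) :* u) refl
        (expTerm p (suc k)) (expTerm q (suc k)) u)))
      (≤-trans (∣*∣-≤ {expTerm p (suc k) - expTerm q (suc k)} {u} {δ * expTerm B k} {1ℚ}
          (expTerm-dist B 0≤B {p} {q} {δ} hp hq h k)
          (≤-trans (≤-reflexive (ℚ.0≤p⇒∣p∣≡p (unit-nonneg (double (suc k))))) (unit≤1 (double (suc k)))))
        (≤-reflexive (ℚ.*-identityʳ (δ * expTerm B k))))
      where
      u : ℚ
      u = unit (double (suc k))

    gaussSum-dist : ∀ {p q δ} → ∣ p ∣ ≤ B → ∣ q ∣ ≤ B → ∣ p - q ∣ ≤ δ → ∀ n →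
      ∣ gaussSum (suc n) p - gaussSum (suc n) q ∣ ≤ δ * expSum n B
    gaussSum-dist {p} {q} {δ} hp hq h zero = ≤-reflexive (sym (ℚ.*-zeroʳ δ))
    gaussSum-dist {p} {q} {δ} hp hq h (suc n) = ≤-trans
      (≤-reflexive (cong ∣_∣ (solve 4 (λ a b c d → a :+ b :- (c :+ d) := a :- c :+ (b :- d)) refl
        (gaussSum (suc n) p) (gaussTerm p (suc n)) (gaussSum (suc n) q) (gaussTerm q (suc n)))))
      (≤-trans (∣+∣-≤ {gaussSum (suc n) p - gaussSum (suc n) q} {gaussTerm p (suc n) - gaussTerm q (suc n)}
          {δ * expSum n B} {δ * expTerm B n}
          (gaussSum-dist hp hq h n) (gaussTerm-dist hp hq h n))
        (≤-reflexive (sym (ℚ.*-distribˡ-+ δ (expSum n B) (expTerm B n)))))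

  -- The Lipschitz constant of `gaussSum n` on a bounded set does not depend on n, so argument and
  -- truncation may vary together.
  gaussSum-≋ : ∀ {x : ℕ → ℚ} {c} → Bounded x → x ≋ (λ _ → c) →
               (λ n → gaussSum n (x n)) ≋ (λ n → gaussSum n c)
  gaussSum-≋ {x} {c} (B , 0≤B , h) x≋c .close ε 0<ε = suc N , late
    where
    D : ℚ
    D = B + ∣ c ∣
    0≤D : 0ℚ ≤ D
    0≤D = +-nonneg 0≤B (ℚ.0≤∣p∣ c)
    C : ∃ λ C → 0ℚ ≤ C × ∀ n → expSum n D ≤ C
    C = expSum-bounded D 0≤D
    modulus : ∃ λ δ → 0ℚ < δ × proj₁ C * δ ≤ ε
    modulus = shrink (proj₁ C) (proj₁ (proj₂ C)) 0<ε
    δ : ℚ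
    δ = proj₁ modulus
    near : Eventually λ n → ∣ x n - c ∣ ≤ δ
    near = close x≋c δ (proj₁ (proj₂ modulus))
    N : ℕ
    N = proj₁ near
    late : ∀ n → suc N ℕ.≤ n → ∣ gaussSum n (x n) - gaussSum n c ∣ ≤ ε
    late (suc n) (ℕ.s≤s N≤n) = ≤-trans
      (gaussSum-dist D 0≤D {x (suc n)} {c} {δ}
        (≤-trans (h (suc n)) (p+-nonneg {B} (ℚ.0≤∣p∣ c))) (nonneg+p {∣ c ∣} 0≤B)
        (proj₂ near (suc n) (ℕ.≤-trans N≤n (ℕ.n≤1+n n))) n)
      (≤-trans (*-monoˡ δ (<⇒≤ (proj₁ (proj₂ modulus))) (proj₂ (proj₂ C) n))
        (≤-trans (≤-reflexive (ℚ.*-comm δ (proj₁ C))) (proj₂ (proj₂ modulus))))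

  pow : ℚ → ℕ → ℚ
  pow t zero    = 1ℚ
  pow t (suc p) = t * pow t p

  pow-nonneg : ∀ {t} → 0ℚ ≤ t → ∀ p → 0ℚ ≤ pow t p
  pow-nonneg 0≤t zero    = 0≤1
  pow-nonneg 0≤t (suc p) = *-nonneg 0≤t (pow-nonneg 0≤t p)

  pow-1 : ∀ p → pow 1ℚ p ≡ 1ℚ
  pow-1 zero    = refl
  pow-1 (suc p) = trans (ℚ.*-identityˡ (pow 1ℚ p)) (pow-1 p)

  module _ {t w : ℚ} (0≤t : 0ℚ ≤ t) (0≤w : 0ℚ ≤ w) where

    -- A form of Bernoulli's inequality. With `pow-upper` it encloses the increment of tᵖ⁺¹ between
    -- (p + 1)w tᵖ and (p + 1)w (t + w)ᵖ, which telescopes to bounds for power sums.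
    pow-lower : ∀ p → pow t (suc p) + (1ℚ + ℕ→ℚ p) * w * pow t p ≤ pow (t + w) (suc p)
    pow-lower zero = ≤-reflexive (solve 2 (λ t w →
      t :* con 1ℚ :+ (con 1ℚ :+ con 0ℚ) :* w :* con 1ℚ := (t :+ w) :* con 1ℚ) refl t w)
    pow-lower (suc p) = subst (λ N → pow t (suc (suc p)) + (1ℚ + N) * w * pow t (suc p) ≤ pow (t + w) (suc (suc p)))
      (sym (ℕ→ℚ-suc p))
      (by-diff ((1ℚ + ℕ→ℚ p) * w * w * T + (t + w) * (Q - (t * T + (1ℚ + ℕ→ℚ p) * w * T)))
        (+-nonneg
          (*-nonneg (*-nonneg (*-nonneg (+-nonneg 0≤1 (ℕ→ℚ-nonneg p)) 0≤w) 0≤w) (pow-nonneg 0≤t p))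
          (*-nonneg (+-nonneg 0≤t 0≤w) (diff-nonneg (pow-lower p))))
        (solve 5 (λ t w P T Q →
          t :* (t :* T) :+ (con 1ℚ :+ (con 1ℚ :+ P)) :* w :* (t :* T)
            :+ ((con 1ℚ :+ P) :* w :* w :* T :+ (t :+ w) :* (Q :- (t :* T :+ (con 1ℚ :+ P) :* w :* T)))
          := (t :+ w) :* Q) refl t w (ℕ→ℚ p) T Q))
      where
      T Q : ℚ
      T = pow t p
      Q = pow (t + w) (suc p)

    pow-upper : ∀ p → pow (t + w) (suc p) ≤ pow t (suc p) + (1ℚ + ℕ→ℚ p) * w * pow (t + w) p
    pow-upper zero = ≤-reflexive (solve 2 (λ t w →
      (t :+ w) :* con 1ℚ := t :* con 1ℚ :+ (con 1ℚ :+ con 0ℚ) :* w :* con 1ℚ) refl t w)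
    pow-upper (suc p) = subst (λ N → pow (t + w) (suc (suc p)) ≤ pow t (suc (suc p)) + (1ℚ + N) * w * pow (t + w) (suc p))
      (sym (ℕ→ℚ-suc p))
      (by-diff ((1ℚ + ℕ→ℚ p) * w * w * Q + t * (T + (1ℚ + ℕ→ℚ p) * w * Q - (t + w) * Q))
        (+-nonneg
          (*-nonneg (*-nonneg (*-nonneg (+-nonneg 0≤1 (ℕ→ℚ-nonneg p)) 0≤w) 0≤w) (pow-nonneg (+-nonneg 0≤t 0≤w) p))
          (*-nonneg 0≤t (diff-nonneg (pow-upper p))))
        (solve 5 (λ t w P T Q →
          (t :+ w) :* ((t :+ w) :* Q)
            :+ ((con 1ℚ :+ P) :* w :* w :* Q :+ t :* (T :+ (con 1ℚ :+ P) :* w :* Q :- (t :+ w) :* Q))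
          := t :* T :+ (con 1ℚ :+ (con 1ℚ :+ P)) :* w :* ((t :+ w) :* Q)) refl t w (ℕ→ℚ p) T Q))
      where
      T Q : ℚ
      T = pow t (suc p)
      Q = pow (t + w) p

  module _ (m : ℕ) where

    private
      w : ℚ
      w = unit m
      0≤w : 0ℚ ≤ w
      0≤w = unit-nonneg m

    node : ℕ → ℚ
    node i = ℕ→ℚ i * w

    node-nonneg : ∀ i → 0ℚ ≤ node i
    node-nonneg i = *-nonneg (ℕ→ℚ-nonneg i) 0≤w

    node-suc : ∀ i → node (suc i) ≡ node i + w
    node-suc i = trans (cong (_* w) (ℕ→ℚ-suc i))
      (solve 2 (λ i w → (con 1ℚ :+ i) :* w := i :* w :+ w) refl (ℕ→ℚ i) w)

    powSum : ℕ → ℕ → ℚ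
    powSum p n = sum (λ i → pow (node i) p) n

    powSum-upper : ∀ p n → (1ℚ + ℕ→ℚ p) * (w * powSum p n) ≤ pow (node n) (suc p)
    powSum-upper p zero = ≤-reflexive
      (solve 3 (λ o w x → o :* (w :* con 0ℚ) := con 0ℚ :* w :* x) refl (1ℚ + ℕ→ℚ p) w (pow (node 0) p))
    powSum-upper p (suc n) = ≤-trans
      (≤-reflexive (solve 4 (λ o w s x → o :* (w :* (s :+ x)) := o :* (w :* s) :+ o :* w :* x) refl
        (1ℚ + ℕ→ℚ p) w (powSum p n) (pow (node n) p)))
      (≤-trans (ℚ.+-monoˡ-≤ ((1ℚ + ℕ→ℚ p) * w * pow (node n) p) (powSum-upper p n))
      (≤-trans (pow-lower (node-nonneg n) 0≤w p)
        (≤-reflexive (cong (λ t → pow t (suc p)) (sym (node-suc n))))))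

    powSum-lower : ∀ p n → pow (node n) (suc p) ≤ (1ℚ + ℕ→ℚ p) * (w * powSum p n + w * pow (node n) p)
    powSum-lower p zero = ≤-trans
      (≤-reflexive (solve 2 (λ w x → con 0ℚ :* w :* x := con 0ℚ) refl w (pow (node 0) p)))
      (*-nonneg (+-nonneg 0≤1 (ℕ→ℚ-nonneg p)) (+-nonneg (*-nonneg 0≤w ≤-refl)
        (*-nonneg 0≤w (pow-nonneg (node-nonneg 0) p))))
    powSum-lower p (suc n) = ≤-trans
      (≤-reflexive (cong (λ t → pow t (suc p)) (node-suc n)))
      (≤-trans (pow-upper (node-nonneg n) 0≤w p)
      (≤-trans (ℚ.+-monoˡ-≤ (o * w * pow (node n + w) p) (powSum-lower p n))
      (≤-reflexive (trans
        (solve 5 (λ o w s x y → o :* (w :* s :+ w :* x) :+ o :* w :* y := o :* (w :* (s :+ x) :+ w :* y)) refl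
          o w (powSum p n) (pow (node n) p) (pow (node n + w) p))
        (cong (λ t → o * (w * powSum p (suc n) + w * pow t p)) (sym (node-suc n)))))))
      where
      o : ℚ
      o = 1ℚ + ℕ→ℚ p

    node-end : node (suc m) ≡ 1ℚ
    node-end = unit-inverse m

    -- The error is the mesh w whatever the exponent, so it can be summed over all terms of a power
    -- series.
    powSum-close : ∀ p → ∣ w * powSum p (suc m) - unit p ∣ ≤ w
    powSum-close p = dist-lub {w * powSum p (suc m)} {unit p} {w}
      (≤-trans (divide (w * powSum p (suc m)) 1ℚ (≤-trans (powSum-upper p (suc m)) (≤-reflexive (end (suc p)))))
        (≤-trans (≤-reflexive (ℚ.*-identityʳ (unit p))) (p+-nonneg {unit p} 0≤w)))
      (≤-trans (≤-reflexive (sym (ℚ.*-identityʳ (unit p))))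
        (divide′ (w * powSum p (suc m) + w) 1ℚ (≤-trans (≤-reflexive (sym (end (suc p))))
          (≤-trans (powSum-lower p (suc m)) (≤-reflexive (cong (λ t → o * (w * powSum p (suc m) + t))
            (trans (cong (w *_) (end p)) (ℚ.*-identityʳ w))))))))
      where
      o : ℚ
      o = 1ℚ + ℕ→ℚ p
      end : ∀ q → pow (node (suc m)) q ≡ 1ℚ
      end q = trans (cong (λ t → pow t q) node-end) (pow-1 q)
      ou≡1 : o * unit p ≡ 1ℚ
      ou≡1 = subst (λ N → N * unit p ≡ 1ℚ) (ℕ→ℚ-suc p) (unit-inverse p)
      undo : ∀ x → unit p * (o * x) ≡ x
      undo x = combine₁ x ou≡1 (solve 3 (λ u o x → u :* (o :* x) :- x := x :* (o :* u :- con 1ℚ)) refl (unit p) o x)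
      divide : ∀ x y → o * x ≤ y → x ≤ unit p * y
      divide x y h = ≤-trans (≤-reflexive (sym (undo x))) (*-monoˡ (unit p) (unit-nonneg p) h)
      divide′ : ∀ x y → y ≤ o * x → unit p * y ≤ x
      divide′ x y h = ≤-trans (*-monoˡ (unit p) (unit-nonneg p) h) (≤-reflexive (undo x))

    expTerm-square : ∀ c t k → expTerm (c * (t * t)) k ≡ expTerm c k * pow t (double k)
    expTerm-square c t zero    = refl
    expTerm-square c t (suc k) = trans
      (cong (λ e → e * (c * (t * t)) * unit k) (expTerm-square c t k))
      (solve 5 (λ e x c t u → e :* x :* (c :* (t :* t)) :* u := e :* c :* u :* (t :* (t :* x))) refl
        (expTerm c k) (pow t (double k)) c t (unit k))

    -- Term by term from `powSum-close`: the k-th term contributes at most w·|c|ᵏ/k!, which keeps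
    -- the bound uniform in the truncation.
    riemann-gauss : ∀ c n →
      ∣ w * sum (λ i → expSum n (c * (node i * node i))) (suc m) - gaussSum n c ∣ ≤ w * expSum n ∣ c ∣
    riemann-gauss c zero = ≤-trans
      (≤-reflexive (cong (λ s → ∣ w * s - 0ℚ ∣) (sum-zero (suc m))))
      (≤-reflexive (trans (cong ∣_∣ (solve 1 (λ w → w :* con 0ℚ :- con 0ℚ := con 0ℚ) refl w))
        (sym (ℚ.*-zeroʳ w))))
      where
      sum-zero : ∀ n → sum (λ _ → 0ℚ) n ≡ 0ℚ
      sum-zero zero    = refl
      sum-zero (suc n) = trans (ℚ.+-identityʳ (sum (λ _ → 0ℚ) n)) (sum-zero n)
    riemann-gauss c (suc n) = ≤-trans
      (≤-reflexive (cong ∣_∣ (trans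
        (cong (λ s → w * s - (gaussSum n c + gaussTerm c n)) split)
        (solve 6 (λ w s e P g u → w :* (s :+ e :* P) :- (g :+ e :* u) := (w :* s :- g) :+ e :* (w :* P :- u)) refl
          w s e (powSum (double n) (suc m)) (gaussSum n c) (unit (double n))))))
      (≤-trans (∣+∣-≤ {w * s - gaussSum n c} {e * (w * powSum (double n) (suc m) - unit (double n))}
          {w * expSum n ∣ c ∣} {expTerm ∣ c ∣ n * w}
          (riemann-gauss c n)
          (∣*∣-≤ {e} {w * powSum (double n) (suc m) - unit (double n)} {expTerm ∣ c ∣ n} {w}
            (expTerm-bound ∣ c ∣ (ℚ.0≤∣p∣ c) {c} ≤-refl n) (powSum-close (double n))))
        (≤-reflexive (solve 3 (λ w S t → w :* S :+ t :* w := w :* (S :+ t)) refl w (expSum n ∣ c ∣) (expTerm ∣ c ∣ n))))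
      where
      e s : ℚ
      e = expTerm c n
      s = sum (λ i → expSum n (c * (node i * node i))) (suc m)
      split : sum (λ i → expSum (suc n) (c * (node i * node i))) (suc m) ≡ s + e * powSum (double n) (suc m)
      split = trans
        (sum-+ (λ i → expSum n (c * (node i * node i))) (λ i → expTerm (c * (node i * node i)) n) (suc m))
        (cong (λ x → s + x) (trans (sum-cong (λ i → expTerm-square c (node i) n) (suc m))
          (sum-* e (λ i → pow (node i) (double n)) (suc m))))

-- Coefficients of products and a quantitative Cauchy product.

module Convolution where

  open import Data.Rational.Base
  open import Data.Rational.Properties using (≤-refl; ≤-trans; ≤-reflexive; <⇒≤; +-mono-≤)
  open +-*-Solver
  open RationalLemmas
  open RationalTools

  -- Peeling coefficients off a avoids the subtraction n - i and makes inductions pass to the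
  -- shifted sequence.
  conv : (ℕ → ℚ) → (ℕ → ℚ) → ℕ → ℚ
  conv a b zero    = a 0 * b 0
  conv a b (suc n) = a 0 * b (suc n) + conv (λ i → a (suc i)) b n

  conv-congˡ : ∀ {a a′} b → (∀ i → a i ≡ a′ i) → ∀ n → conv a b n ≡ conv a′ b n
  conv-congˡ b h zero    = cong (_* b 0) (h 0)
  conv-congˡ b h (suc n) = cong₂ (λ x y → x * b (suc n) + y) (h 0) (conv-congˡ b (λ i → h (suc i)) n)

  conv-congʳ : ∀ a {b b′} → (∀ i → b i ≡ b′ i) → ∀ n → conv a b n ≡ conv a b′ n
  conv-congʳ a h zero    = cong (a 0 *_) (h 0)
  conv-congʳ a h (suc n) = cong₂ (λ x y → a 0 * x + y) (h (suc n)) (conv-congʳ (λ i → a (suc i)) h n)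

  conv-+ˡ : ∀ a a′ b n → conv (λ i → a i + a′ i) b n ≡ conv a b n + conv a′ b n
  conv-+ˡ a a′ b zero    = ℚ.*-distribʳ-+ (b 0) (a 0) (a′ 0)
  conv-+ˡ a a′ b (suc n) = trans
    (cong (λ x → (a 0 + a′ 0) * b (suc n) + x) (conv-+ˡ (λ i → a (suc i)) (λ i → a′ (suc i)) b n))
    (solve 5 (λ a a′ b x y → (a :+ a′) :* b :+ (x :+ y) := a :* b :+ x :+ (a′ :* b :+ y)) refl
      (a 0) (a′ 0) (b (suc n)) (conv (λ i → a (suc i)) b n) (conv (λ i → a′ (suc i)) b n))

  conv-+ʳ : ∀ a b b′ n → conv a (λ i → b i + b′ i) n ≡ conv a b n + conv a b′ n
  conv-+ʳ a b b′ zero    = ℚ.*-distribˡ-+ (a 0) (b 0) (b′ 0)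
  conv-+ʳ a b b′ (suc n) = trans
    (cong (λ x → a 0 * (b (suc n) + b′ (suc n)) + x) (conv-+ʳ (λ i → a (suc i)) b b′ n))
    (solve 5 (λ a b b′ x y → a :* (b :+ b′) :+ (x :+ y) := a :* b :+ x :+ (a :* b′ :+ y)) refl
      (a 0) (b (suc n)) (b′ (suc n)) (conv (λ i → a (suc i)) b n) (conv (λ i → a (suc i)) b′ n))

  conv-*ˡ : ∀ c a b n → conv (λ i → c * a i) b n ≡ c * conv a b n
  conv-*ˡ c a b zero    = ℚ.*-assoc c (a 0) (b 0)
  conv-*ˡ c a b (suc n) = trans
    (cong (λ x → c * a 0 * b (suc n) + x) (conv-*ˡ c (λ i → a (suc i)) b n))
    (solve 4 (λ c a b x → c :* a :* b :+ c :* x := c :* (a :* b :+ x)) refl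
      c (a 0) (b (suc n)) (conv (λ i → a (suc i)) b n))

  conv-*ʳ : ∀ c a b n → conv a (λ i → c * b i) n ≡ c * conv a b n
  conv-*ʳ c a b zero    = solve 3 (λ c a b → a :* (c :* b) := c :* (a :* b)) refl c (a 0) (b 0)
  conv-*ʳ c a b (suc n) = trans
    (cong (λ x → a 0 * (c * b (suc n)) + x) (conv-*ʳ c (λ i → a (suc i)) b n))
    (solve 4 (λ c a b x → a :* (c :* b) :+ c :* x := c :* (a :* b :+ x)) refl
      c (a 0) (b (suc n)) (conv (λ i → a (suc i)) b n))

  -- Leibniz rule for the derivation that multiplies the n-th coefficient by n.
  conv-leibniz : ∀ a b n → ℕ→ℚ n * conv a b n
    ≡ conv (λ i → ℕ→ℚ i * a i) b n + conv a (λ j → ℕ→ℚ j * b j) n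
  conv-leibniz a b zero    = solve 2 (λ a b → con 0ℚ :* (a :* b) := con 0ℚ :* a :* b :+ a :* (con 0ℚ :* b))
    refl (a 0) (b 0)
  conv-leibniz a b (suc n) = combine₃ 1ℚ 1ℚ X (conv-leibniz a′ b n)
    (sym (trans (conv-congˡ b weight-suc n) (conv-+ˡ a′ (λ i → ℕ→ℚ i * a′ i) b n)))
    (ℕ→ℚ-suc n)
    (solve 8 (λ N n a b X Y Z W → N :* (a :* b :+ X) :- (con 0ℚ :* a :* b :+ W :+ (a :* (N :* b) :+ Z))
        := con 1ℚ :* (n :* X :- (Y :+ Z)) :+ con 1ℚ :* (X :+ Y :- W) :+ X :* (N :- (con 1ℚ :+ n)))
      refl (ℕ→ℚ (suc n)) (ℕ→ℚ n) (a 0) (b (suc n)) X (conv (λ i → ℕ→ℚ i * a′ i) b n)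
      (conv a′ (λ j → ℕ→ℚ j * b j) n) (conv (λ i → ℕ→ℚ (suc i) * a′ i) b n))
    where
    a′ : ℕ → ℚ
    a′ i = a (suc i)
    X : ℚ
    X = conv a′ b n
    weight-suc : ∀ i → ℕ→ℚ (suc i) * a′ i ≡ a′ i + ℕ→ℚ i * a′ i
    weight-suc i = trans (cong (_* a′ i) (ℕ→ℚ-suc i))
      (solve 2 (λ i a → (con 1ℚ :+ i) :* a := a :+ i :* a) refl (ℕ→ℚ i) (a′ i))

  conv-shiftˡ : ∀ a b n → a 0 ≡ 0ℚ → conv a b (suc n) ≡ conv (λ i → a (suc i)) b n
  conv-shiftˡ a b n h = trans (cong (λ x → x * b (suc n) + conv (λ i → a (suc i)) b n) h)
    (solve 2 (λ b x → con 0ℚ :* b :+ x := x) refl (b (suc n)) (conv (λ i → a (suc i)) b n))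

  conv-shiftʳ : ∀ a b n → b 0 ≡ 0ℚ → conv a b (suc n) ≡ conv a (λ j → b (suc j)) n
  conv-shiftʳ a b zero    h = trans (cong (λ x → a 0 * b 1 + a 1 * x) h)
    (solve 2 (λ x a → x :+ a :* con 0ℚ := x) refl (a 0 * b 1) (a 1))
  conv-shiftʳ a b (suc n) h = cong (λ x → a 0 * b (suc (suc n)) + x) (conv-shiftʳ (λ i → a (suc i)) b n h)

  sum-conv-suc : ∀ a b n → sum (conv a b) (suc n) ≡ a 0 * sum b (suc n) + sum (conv (λ i → a (suc i)) b) n
  sum-conv-suc a b zero    = solve 2 (λ a b → con 0ℚ :+ a :* b := a :* (con 0ℚ :+ b) :+ con 0ℚ) refl (a 0) (b 0)
  sum-conv-suc a b (suc n) = trans (cong (_+ conv a b (suc n)) (sum-conv-suc a b n))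
    (solve 5 (λ a s t b x → a :* s :+ t :+ (a :* b :+ x) := a :* (s :+ b) :+ (t :+ x)) refl
      (a 0) (sum b (suc n)) (sum (conv (λ i → a (suc i)) b) n) (b (suc n)) (conv (λ i → a (suc i)) b n))

  -- Peeling a 0 leaves the same claim for the shifted sequence with K/4 in place of K, plus the
  -- product of its sum with b n. Each part is at most half of KM·½ⁿ, and KM·½ⁿ = 2KM·½ⁿ⁺¹.
  cauchy-product : ∀ M (b : ℕ → ℚ) → 0ℚ ≤ M → (∀ j → ∣ b j ∣ ≤ M * ½^ j) →
    ∀ n K a → 0ℚ ≤ K → (∀ i → ∣ a i ∣ ≤ K * ¼^ i) →
    ∣ sum a n * sum b n - sum (conv a b) n ∣ ≤ 2ℚ * (K * M) * ½^ n
  cauchy-product M b 0≤M hb zero K a 0≤K ha =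
    *-nonneg (*-nonneg (ℚ.nonNegative⁻¹ 2ℚ) (*-nonneg 0≤K 0≤M)) 0≤1
  cauchy-product M b 0≤M hb (suc n) K a 0≤K ha = ≤-trans
    (≤-reflexive (cong ∣_∣ (trans
      (cong₂ (λ x y → x * sum b (suc n) - y) (sum-peel a n) (sum-conv-suc a b n))
      (solve 5 (λ a A B b P → (a :+ A) :* (B :+ b) :- (a :* (B :+ b) :+ P) := (A :* B :- P) :+ A :* b) refl
        (a 0) (sum a′ n) (sum b n) (b n) (sum (conv a′ b) n)))))
    (≤-trans (∣+∣-≤ {sum a′ n * sum b n - sum (conv a′ b) n} {sum a′ n * b n}
        {2ℚ * (¼ * K * M) * ½^ n} {¼ * K * 2ℚ * (M * ½^ n)}
        (cauchy-product M b 0≤M hb n (¼ * K) a′ 0≤¼K ha′)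
        (∣*∣-≤ {sum a′ n} {b n} {¼ * K * 2ℚ} {M * ½^ n}
          (≤-trans (∣sum∣≤ (λ i → ≤-trans (ha′ i) (*-monoˡ (¼ * K) 0≤¼K (¼^≤½^ i))) n)
            (sum-geometric (¼ * K) (λ i → ≤-refl) 0≤¼K n))
          (hb n)))
      (≤-reflexive (solve 3 (λ K M h → let ¼ = con ½ :* con ½ in
          con 2ℚ :* (¼ :* K :* M) :* h :+ ¼ :* K :* con 2ℚ :* (M :* h) := con 2ℚ :* (K :* M) :* (con ½ :* h))
        refl K M (½^ n))))
    where
    a′ : ℕ → ℚ
    a′ i = a (suc i)
    0≤¼K : 0ℚ ≤ ¼ * K
    0≤¼K = *-nonneg (ℚ.nonNegative⁻¹ ¼) 0≤K
    ha′ : ∀ i → ∣ a′ i ∣ ≤ ¼ * K * ¼^ i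
    ha′ i = ≤-trans (ha (suc i)) (≤-reflexive (solve 2 (λ K h →
      K :* (con ½ :* h :* (con ½ :* h)) := con ½ :* con ½ :* K :* (h :* h)) refl K (½^ i)))

-- The product of the exponential and the Gaussian series.

module ExpGaussProduct (z : ℚ) (0≤z : 0ℚ ℚ.≤ z) (z≤1 : z ℚ.≤ 1ℚ) where

  open import Data.Rational.Base
  open import Data.Rational.Properties using (≤-refl; ≤-trans; ≤-reflexive; <⇒≤; +-mono-≤)
  open +-*-Solver
  open RationalLemmas
  open Approximations
  open RationalTools
  open Asymptotics
  open Convolution
  open GaussianSeries
  open Coefficients z 0≤z

  private
    a e⁻ b : ℕ → ℚ
    a  = expTerm z
    e⁻ = expTerm (- z)
    b  = gaussTerm (- z)

  expTerm-ℕ→ℚ : ∀ q i → ℕ→ℚ (suc i) * expTerm q (suc i) ≡ q * expTerm q i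
  expTerm-ℕ→ℚ q i = subst (λ N → N * expTerm q (suc i) ≡ q * expTerm q i) (sym (ℕ→ℚ-suc i)) (expTerm-step q i)

  conv-derivedˡ : ∀ c n → conv (λ i → ℕ→ℚ i * a i) c (suc n) ≡ z * conv a c n
  conv-derivedˡ c n = trans (conv-shiftˡ (λ i → ℕ→ℚ i * a i) c n refl)
    (trans (conv-congˡ c (expTerm-ℕ→ℚ z) n) (conv-*ˡ z a c n))

  -- The positive-degree part of exp(z)·exp(-z) = 1: by the Leibniz rule, n + 1 times the
  -- coefficient is z - z times the preceding one.
  conv-exp-opposite : ∀ n → conv a e⁻ (suc n) ≡ 0ℚ
  conv-exp-opposite n = cancel (ℕ→ℚ (suc n)) (0<ℕ→ℚ-suc n)
    (trans (conv-leibniz a e⁻ (suc n))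
    (trans (cong₂ _+_ (conv-derivedˡ e⁻ n)
      (trans (conv-shiftʳ a (λ j → ℕ→ℚ j * e⁻ j) n refl)
        (trans (conv-congʳ a (expTerm-ℕ→ℚ (- z)) n) (conv-*ʳ (- z) a e⁻ n))))
      (solve 3 (λ z x N → z :* x :+ (:- z) :* x := N :* con 0ℚ) refl z (conv a e⁻ n) (ℕ→ℚ (suc n)))))

  -- The differential equation G + 2DG = exp(-z) of the Gaussian series, with D multiplying the j-th
  -- coefficient by j.
  gaussTerm-odd : ∀ j → b j + 2ℚ * (ℕ→ℚ j * b j) ≡ e⁻ j
  gaussTerm-odd j = combine₁ (e⁻ j) (subst (λ N → N * unit (double j) ≡ 1ℚ) (ℕ→ℚ-double j) (unit-inverse (double j)))
    (solve 3 (λ e u j → e :* u :+ con 2ℚ :* (j :* (e :* u)) :- e := e :* ((con 1ℚ :+ con 2ℚ :* j) :* u :- con 1ℚ))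
      refl (e⁻ j) (unit (double j)) (ℕ→ℚ j))

  conv-odd : ∀ n → conv a b n + 2ℚ * conv a (λ j → ℕ→ℚ j * b j) n ≡ conv a e⁻ n
  conv-odd n = trans (cong (λ x → conv a b n + x) (sym (conv-*ʳ 2ℚ a (λ j → ℕ→ℚ j * b j) n)))
    (trans (sym (conv-+ʳ a b (λ j → 2ℚ * (ℕ→ℚ j * b j)) n)) (conv-congʳ a gaussTerm-odd n))

  -- The Leibniz rule and the differential equation give (2n + 3)cₙ₊₁ = 2z cₙ for the product, which
  -- is the recursion of `tail` at k = 0.
  conv-tail : ∀ n → z * conv a b n ≡ tail n 0
  conv-tail zero    = solve 1 (λ z → z :* (con 1ℚ :* (con 1ℚ :* con 1ℚ)) := z) refl z
  conv-tail (suc n) = cancel (odd n) (odd-pos n) (trans step (sym (tail-recurrence n 0)))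
    where
    c c′ : ℚ
    c  = conv a b n
    c′ = conv a b (suc n)
    d : ℚ
    d = conv a (λ j → ℕ→ℚ j * b j) (suc n)
    leibniz : (1ℚ + ℕ→ℚ n) * c′ ≡ z * c + d
    leibniz = subst (λ N → N * c′ ≡ z * c + d) (ℕ→ℚ-suc n)
      (trans (conv-leibniz a b (suc n)) (cong (_+ d) (conv-derivedˡ b n)))
    step : odd n * (z * c′) ≡ z * (2ℚ * tail n 0 + difference n 0)
    step = combine₃ (2ℚ * z) z (2ℚ * z) leibniz (trans (conv-odd (suc n)) (conv-exp-opposite n)) (conv-tail n)
      (solve 7 (λ n z c c′ d t w →
          (con 1ℚ :+ con 2ℚ :* (con 1ℚ :+ n)) :* (z :* c′) :- z :* (con 2ℚ :* t :+ con 0ℚ :* w)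
          := con 2ℚ :* z :* ((con 1ℚ :+ n) :* c′ :- (z :* c :+ d)) :+ z :* (c′ :+ con 2ℚ :* d :- con 0ℚ)
            :+ con 2ℚ :* z :* (z :* c :- t))
        refl (ℕ→ℚ n) z c c′ d (tail n 0) (weight n 0))

  private
    0≤2 : 0ℚ ≤ 2ℚ
    0≤2 = ℚ.nonNegative⁻¹ 2ℚ

    -- The ratio z/(i + 1) of consecutive terms is at most 1/4 from i = 3 on.
    expTerm-geometric : ∃ λ K → 0ℚ ≤ K × ∀ i → a i ≤ K * ¼^ i
    expTerm-geometric = geometric-bound 3 a (expTerm-nonneg z 0≤z) λ i 3≤i → by-diff
      (¼ * ((1ℚ - z) * a i + (ℕ→ℚ i - ℕ→ℚ 3) * a (suc i)))
      (*-nonneg (ℚ.nonNegative⁻¹ ¼) (+-nonneg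
        (*-nonneg (diff-nonneg z≤1) (expTerm-nonneg z 0≤z i))
        (*-nonneg (diff-nonneg (ℕ→ℚ-mono 3≤i)) (expTerm-nonneg z 0≤z (suc i)))))
      (combine₁ ¼ (expTerm-step z i)
        (solve 4 (λ z i t t′ → let ¼ = con ½ :* con ½ in
          t′ :+ ¼ :* ((con 1ℚ :- z) :* t :+ (i :- con (ℕ→ℚ 3)) :* t′) :- ¼ :* t
          := ¼ :* ((con 1ℚ :+ i) :* t′ :- z :* t)) refl z (ℕ→ℚ i) (a i) (a (suc i))))

    K : ℚ
    K = proj₁ expTerm-geometric
    0≤K : 0ℚ ≤ K
    0≤K = proj₁ (proj₂ expTerm-geometric)
    a≤ : ∀ i → a i ≤ K * ¼^ i
    a≤ = proj₂ (proj₂ expTerm-geometric)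
    ∣-z∣≤z : ∣ - z ∣ ≤ z
    ∣-z∣≤z = ≤-reflexive (trans (ℚ.∣-p∣≡∣p∣ z) (ℚ.0≤p⇒∣p∣≡p 0≤z))
    expSum≡ : ∀ n → expSum n z ≡ sum a n
    expSum≡ zero    = refl
    expSum≡ (suc n) = cong (_+ a n) (expSum≡ n)

  gaussSum-bounded : Bounded (λ n → gaussSum n (- z))
  gaussSum-bounded = C , proj₁ (proj₂ exp-bounded) , λ n →
    ≤-trans (∣sum∣≤ (∣gaussTerm∣≤ z 0≤z ∣-z∣≤z) n)
      (≤-trans (≤-reflexive (sym (expSum≡ n))) (proj₂ (proj₂ exp-bounded) n))
    where
    exp-bounded : ∃ λ C → 0ℚ ≤ C × ∀ n → expSum n z ≤ C
    exp-bounded = expSum-bounded z 0≤z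
    C : ℚ
    C = proj₁ exp-bounded

  exp-gauss : (λ n → z * (expSum n z * gaussSum n (- z))) ≋ (λ n → sum (λ i → tail i 0) n)
  exp-gauss = ≋-trans (≋-constant-scale z product) (≋-reflexive λ n →
    trans (sym (sum-* z (conv a b) n)) (sum-cong conv-tail n))
    where
    product : (λ n → expSum n z * gaussSum n (- z)) ≋ sum (conv a b)
    product = ≋-trans (≋-reflexive λ n → cong (_* gaussSum n (- z)) (expSum≡ n))
      (≋-geometric (2ℚ * (K * K)) (*-nonneg 0≤2 (*-nonneg 0≤K 0≤K)) λ n →
        cauchy-product K b 0≤K
          (λ j → ≤-trans (∣gaussTerm∣≤ z 0≤z ∣-z∣≤z j) (≤-trans (a≤ j) (*-monoˡ K 0≤K (¼^≤½^ j))))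
          n K a 0≤K
          (λ i → ≤-trans (≤-reflexive (ℚ.0≤p⇒∣p∣≡p (expTerm-nonneg z 0≤z i))) (a≤ i)))

-- Casts and series of real numbers.

open import Defs
open RationalLemmas
open Approximations
open RationalTools
open Asymptotics

module Casts where

  ℤ→ℚ : ℤ → ℚ
  ℤ→ℚ i = i ℚ./ 1

  ℤ→ℚ-+ : ∀ i j → ℤ→ℚ (i ℤ.+ j) ≡ ℤ→ℚ i ℚ.+ ℤ→ℚ j
  ℤ→ℚ-+ i j = ℚ.toℚᵘ-injective (ℚᵘ.≃-trans (toℚᵘ-/ (i ℤ.+ j) 0)
    (ℚᵘ.≃-trans (ℚᵘ.*≡* eq)
    (ℚᵘ.≃-sym (ℚᵘ.≃-trans (ℚ.toℚᵘ-homo-+ (ℤ→ℚ i) (ℤ→ℚ j))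
      (ℚᵘ.+-cong (toℚᵘ-/ i 0) (toℚᵘ-/ j 0))))))
    where
    eq : (i ℤ.+ j) ℤ.* + 1 ≡ (i ℤ.* + 1 ℤ.+ j ℤ.* + 1) ℤ.* + 1
    eq = cong (ℤ._* + 1) (sym (cong₂ ℤ._+_ (ℤ.*-identityʳ i) (ℤ.*-identityʳ j)))

  ℤ→ℚ-* : ∀ i j → ℤ→ℚ (i ℤ.* j) ≡ ℤ→ℚ i ℚ.* ℤ→ℚ j
  ℤ→ℚ-* i j = ℚ.toℚᵘ-injective (ℚᵘ.≃-trans (toℚᵘ-/ (i ℤ.* j) 0)
    (ℚᵘ.≃-sym (ℚᵘ.≃-trans (ℚ.toℚᵘ-homo-* (ℤ→ℚ i) (ℤ→ℚ j))
      (ℚᵘ.*-cong (toℚᵘ-/ i 0) (toℚᵘ-/ j 0)))))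

  /-*-cancel : ∀ i n .{{_ : NonZero n}} → (i ℚ./ n) ℚ.* ℕ→ℚ n ≡ ℤ→ℚ i
  /-*-cancel i (suc n) = ℚ.toℚᵘ-injective (ℚᵘ.≃-trans (ℚ.toℚᵘ-homo-* (i ℚ./ suc n) (ℕ→ℚ (suc n)))
    (ℚᵘ.≃-trans (ℚᵘ.*-cong (toℚᵘ-/ i n) (toℚᵘ-/ (+ suc n) 0))
    (ℚᵘ.≃-trans (ℚᵘ.*≡* eq) (ℚᵘ.≃-sym (toℚᵘ-/ i 0)))))
    where
    eq : i ℤ.* + suc n ℤ.* + 1 ≡ i ℤ.* + (suc n ℕ.* 1)
    eq = trans (ℤ.*-identityʳ (i ℤ.* + suc n)) (cong (λ m → i ℤ.* + m) (sym (ℕ.*-identityʳ (suc n))))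

module Series where

  open +-*-Solver

  seq-∑ : ∀ n f j → seq (∑ n f) j ≡ sum (λ i → seq (f i) j) n
  seq-∑ zero    f j = refl
  seq-∑ (suc n) f j = cong (ℚ._+ seq (f n) j) (seq-∑ n f j)

  sum-≋ : ∀ {x y : ℕ → ℕ → ℚ} → (∀ i → x i ≋ y i) → ∀ n → (λ j → sum (λ i → x i j) n) ≋ (λ j → sum (λ i → y i j) n)
  sum-≋ h zero    = ≋-refl
  sum-≋ h (suc n) = ≋-+ (sum-≋ h n) (h n)

  -- N has to be found before j, hence the uniform last hypothesis. Replacing f by μ concerns only n
  -- terms at a time and costs an arbitrarily small η.
  hasSum : ∀ {f T} (μ : ℕ → ℕ → ℚ) (τ : ℕ → ℚ) → (∀ n → seq (f n) ≋ μ n) → seq T ≋ τ →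
    (∀ ε → 0ℚ ℚ.< ε → ∃ λ N → ∀ n → N ℕ.≤ n → ∀ j → ℚ.∣ sum (λ i → μ i j) n ℚ.- τ j ∣ ℚ.≤ ε) →
    HasSum f T
  hasSum {f} {T} μ τ hf hT converges ε 0<ε = proj₁ (converges ε 0<ε) , λ n N≤n →
    record { within = λ η 0<η → eventually₂ (bound n N≤n η)
      (close (sums n) (half η) (half-pos 0<η)) (close (≋-sym hT) (half η) (half-pos 0<η)) }
    where
    sums : ∀ n → seq (∑ n f) ≋ (λ j → sum (λ i → μ i j) n)
    sums n = ≋-trans (≋-reflexive (seq-∑ n f)) (sum-≋ hf n)
    bound : ∀ n → proj₁ (converges ε 0<ε) ℕ.≤ n → ∀ η j →
      ℚ.∣ seq (∑ n f) j ℚ.- sum (λ i → μ i j) n ∣ ℚ.≤ half η → ℚ.∣ τ j ℚ.- seq T j ∣ ℚ.≤ half η →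
      ℚ.∣ seq (∑ n f) j ℚ.- seq T j ∣ ℚ.≤ ε ℚ.+ η
    bound n N≤n η j p q = ℚ.≤-trans
      (triangle {seq (∑ n f) j} {sum (λ i → μ i j) n} {seq T j} {half η} {ε ℚ.+ half η} p
        (triangle {sum (λ i → μ i j) n} {τ j} {seq T j} {ε} {half η} (proj₂ (converges ε 0<ε) n N≤n j) q))
      (ℚ.≤-reflexive (solve 2 (λ ε η → con ½ :* η :+ (ε :+ con ½ :* η) := ε :+ η) refl ε η))

  -- A term is the difference of two consecutive partial sums, both near T.
  terms-vanish : ∀ {f T} → HasSum f T → ∀ ε → 0ℚ ℚ.< ε →
    Eventually λ n → ∀ η → 0ℚ ℚ.< η → Eventually λ j → ℚ.∣ seq (f n) j ∣ ℚ.≤ ε ℚ.+ η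
  terms-vanish {f} {T} h ε 0<ε = N , λ n N≤n η 0<η → eventually₂ (bound n η)
    (within (proj₂ sums (suc n) (ℕ.≤-trans N≤n (ℕ.n≤1+n n))) (half η) (half-pos 0<η))
    (within (proj₂ sums n N≤n) (half η) (half-pos 0<η))
    where
    sums : Eventually λ n → ∣ ∑ n f - T ∣ ≤ fromℚ (half ε)
    sums = h (half ε) (half-pos 0<ε)
    N : ℕ
    N = proj₁ sums
    bound : ∀ n η j → ℚ.∣ seq (∑ (suc n) f) j ℚ.- seq T j ∣ ℚ.≤ half ε ℚ.+ half η →
      ℚ.∣ seq (∑ n f) j ℚ.- seq T j ∣ ℚ.≤ half ε ℚ.+ half η → ℚ.∣ seq (f n) j ∣ ℚ.≤ ε ℚ.+ η
    bound n η j p q = ℚ.≤-trans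
      (ℚ.≤-reflexive (cong ℚ.∣_∣ (solve 3 (λ S f T → f := S :+ f :- T :- (S :- T)) refl
        (seq (∑ n f) j) (seq (f n) j) (seq T j))))
      (ℚ.≤-trans (∣-∣-≤ {seq (∑ (suc n) f) j ℚ.- seq T j} {seq (∑ n f) j ℚ.- seq T j}
          {half ε ℚ.+ half η} {half ε ℚ.+ half η} p q)
        (ℚ.≤-reflexive (solve 2 (λ ε η → let e = con ½ :* ε :+ con ½ :* η in e :+ e := ε :+ η) refl ε η)))

-- Errors of convergents.

module ContinuedFractions (c : RegularCF) (α : ℝ) where

  open +-*-Solver
  open Casts

  error : ℕ → ℝ
  error n = fromℤ (numerator c n) - α * fromℕ (denominator c n)

  δ : ℕ → ℕ → ℚ
  δ n = seq (error n)

  error-step : ∀ a p q p′ q′ x →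
    ℤ→ℚ (+ a ℤ.* p′ ℤ.+ p) ℚ.- x ℚ.* ℕ→ℚ (a ℕ.* q′ ℕ.+ q)
    ≡ ℕ→ℚ a ℚ.* (ℤ→ℚ p′ ℚ.- x ℚ.* ℕ→ℚ q′) ℚ.+ (ℤ→ℚ p ℚ.- x ℚ.* ℕ→ℚ q)
  error-step a p q p′ q′ x = trans
    (cong₂ (λ y w → y ℚ.- x ℚ.* w)
      (trans (ℤ→ℚ-+ (+ a ℤ.* p′) p) (cong (ℚ._+ ℤ→ℚ p) (ℤ→ℚ-* (+ a) p′)))
      (trans (ℕ→ℚ-+ (a ℕ.* q′) q) (cong (ℚ._+ ℕ→ℚ q) (ℕ→ℚ-* a q′))))
    (solve 6 (λ a p q p′ q′ x → a :* p′ :+ p :- x :* (a :* q′ :+ q) := a :* (p′ :- x :* q′) :+ (p :- x :* q))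
      refl (ℕ→ℚ a) (ℤ→ℚ p) (ℕ→ℚ q) (ℤ→ℚ p′) (ℕ→ℚ q′) x)

  -- The case n = 1 is the general step taken from p₋₁ = 1 and q₋₁ = 0.
  δ-first : ∀ j → δ 1 j ≡ ℕ→ℚ (tail c 0) ℚ.* δ 0 j ℚ.+ 1ℚ
  δ-first j = trans
    (cong (λ q → ℤ→ℚ (+ tail c 0 ℤ.* head c ℤ.+ + 1) ℚ.- seq α j ℚ.* ℕ→ℚ q)
      (sym (trans (ℕ.+-identityʳ (tail c 0 ℕ.* 1)) (ℕ.*-identityʳ (tail c 0)))))
    (trans (error-step (tail c 0) (+ 1) 0 (head c) 1 (seq α j))
      (cong (λ x → ℕ→ℚ (tail c 0) ℚ.* δ 0 j ℚ.+ x)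
        (solve 1 (λ x → con 1ℚ :- x :* con 0ℚ := con 1ℚ) refl (seq α j))))

  δ-step : ∀ n j → δ (suc (suc n)) j ≡ ℕ→ℚ (tail c (suc n)) ℚ.* δ (suc n) j ℚ.+ δ n j
  δ-step n j = error-step (tail c (suc n)) (numerator c n) (denominator c n)
    (numerator c (suc n)) (denominator c (suc n)) (seq α j)

  sign : ℕ → ℚ
  sign zero    = ℚ.- 1ℚ
  sign (suc n) = ℚ.- sign n

  ∣sign∣ : ∀ n → ℚ.∣ sign n ∣ ≡ 1ℚ
  ∣sign∣ zero    = refl
  ∣sign∣ (suc n) = trans (ℚ.∣-p∣≡∣p∣ (sign n)) (∣sign∣ n)

  module _ (a : ℕ → ℕ) (tail≡ : ∀ n → tail c n ≡ a n) (μ : ℕ → ℕ → ℚ)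
    (μ-nonneg : ∀ n j → 0ℚ ℚ.≤ μ n j)
    (start : δ 0 ≋ (λ j → ℚ.- μ 0 j))
    (next : μ 1 ≋ (λ j → 1ℚ ℚ.- ℕ→ℚ (a 0) ℚ.* μ 0 j))
    (recurrence : ∀ n → μ (suc (suc n)) ≋ (λ j → μ n j ℚ.- ℕ→ℚ (a (suc n)) ℚ.* μ (suc n) j)) where

    -- The alternating sign turns the sum in `δ-step` into the subtraction in the recurrence of μ;
    -- two indices are carried because the recurrence looks back twice.
    δ-signed : ∀ n → δ n ≋ (λ j → sign n ℚ.* μ n j) × δ (suc n) ≋ (λ j → sign (suc n) ℚ.* μ (suc n) j)
    δ-signed zero =
      ≋-trans start (≋-reflexive λ j → solve 1 (λ x → :- x := (:- con 1ℚ) :* x) refl (μ 0 j)) ,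
      ≋-trans (≋-reflexive λ j → trans (δ-first j)
          (cong (λ t → ℕ→ℚ t ℚ.* δ 0 j ℚ.+ 1ℚ) (tail≡ 0)))
        (≋-trans (≋-+ (≋-constant-scale (ℕ→ℚ (a 0)) start) (≋-refl {λ _ → 1ℚ}))
        (≋-trans (≋-reflexive λ j → solve 2 (λ t x → t :* (:- x) :+ con 1ℚ := con 1ℚ :- t :* x) refl
            (ℕ→ℚ (a 0)) (μ 0 j))
        (≋-trans (≋-sym next)
          (≋-reflexive λ j → solve 1 (λ x → x := (:- (:- con 1ℚ)) :* x) refl (μ 1 j)))))
    δ-signed (suc n) = proj₂ (δ-signed n) ,
      ≋-trans (≋-reflexive λ j → trans (δ-step n j)
          (cong (λ t → ℕ→ℚ t ℚ.* δ (suc n) j ℚ.+ δ n j) (tail≡ (suc n))))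
        (≋-trans (≋-+ (≋-constant-scale (ℕ→ℚ (a (suc n))) (proj₂ (δ-signed n))) (proj₁ (δ-signed n)))
        (≋-trans (≋-reflexive λ j → solve 4 (λ t σ x y → t :* ((:- σ) :* x) :+ σ :* y
              := (:- (:- σ)) :* (y :- t :* x)) refl (ℕ→ℚ (a (suc n))) (sign n) (μ (suc n) j) (μ n j))
          (≋-constant-scale (sign (suc (suc n))) (≋-sym (recurrence n)))))

    ∣error∣≋ : ∀ n → seq ∣ error n ∣ ≋ μ n
    ∣error∣≋ n = ≋-trans (≋-∣∣ (proj₁ (δ-signed n))) (≋-reflexive λ j →
      trans (ℚ.∣p*q∣≡∣p∣*∣q∣ (sign n) (μ n j))
      (trans (cong₂ ℚ._*_ (∣sign∣ n) (ℚ.0≤p⇒∣p∣≡p (μ-nonneg n j))) (ℚ.*-identityˡ (μ n j))))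

  -- Summable errors tend to 0, and dividing them by denominators of at least 1 keeps them small.
  expansion-of-summable : ∀ {T} → HasSum (λ n → ∣ error n ∣) T → c IsExpansionOf α
  expansion-of-summable {T} h ε 0<ε = proj₁ small , λ n N≤n →
    record { within = λ η 0<η → eventually₁ (bound n η) (proj₂ small n N≤n η 0<η) }
    where
    small : Eventually λ n → ∀ η → 0ℚ ℚ.< η → Eventually λ j → ℚ.∣ seq (∣ error n ∣) j ∣ ℚ.≤ ε ℚ.+ η
    small = Series.terms-vanish {λ n → ∣ error n ∣} {T} h ε 0<ε
    1≤q : ∀ n → 1ℚ ℚ.≤ ℕ→ℚ (denominator c n)
    1≤q n = ℕ→ℚ-mono (ℕ.>-nonZero⁻¹ (denominator c n) {{denominator-nonZero c n}})
    bound : ∀ n η j → ℚ.∣ ℚ.∣ δ n j ∣ ∣ ℚ.≤ ε ℚ.+ η → ℚ.∣ convergent c n ℚ.- seq α j ∣ ℚ.≤ ε ℚ.+ η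
    bound n η j p = ℚ.≤-trans
      (ℚ.≤-trans (ℚ.≤-reflexive (sym (ℚ.*-identityʳ ℚ.∣ x ∣))) (*-monoˡ ℚ.∣ x ∣ (ℚ.0≤∣p∣ x) (1≤q n)))
      (ℚ.≤-trans (ℚ.≤-reflexive (trans (cong (ℚ.∣ x ∣ ℚ.*_) (sym (ℚ.0≤p⇒∣p∣≡p (ℕ→ℚ-nonneg (denominator c n)))))
          (trans (sym (ℚ.∣p*q∣≡∣p∣*∣q∣ x q)) (cong ℚ.∣_∣ scaled))))
        (ℚ.≤-trans (p≤∣p∣ ℚ.∣ δ n j ∣) p))
      where
      x q : ℚ
      x = convergent c n ℚ.- seq α j
      q = ℕ→ℚ (denominator c n)
      scaled : x ℚ.* q ≡ δ n j
      scaled = trans (solve 3 (λ c a q → (c :- a) :* q := c :* q :- a :* q) refl (convergent c n) (seq α j) q)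
        (cong (ℚ._- seq α j ℚ.* q) (/-*-cancel (numerator c n) (denominator c n) {{denominator-nonZero c n}}))

infix 4 _↝_

-- A record rather than a synonym, so that comparing two instances compares the
-- real numbers without unfolding their terms.
record _↝_ (x : ℝ) (τ : ℕ → ℚ) : Set where
  constructor mk↝
  field seq-≋ : seq x ≋ τ
open _↝_ public

-- Quotients and square roots up to null sequences.

module RealOperations where

  open +-*-Solver

  -- `recipAbove` inverts the maximum of y and its gap, which is y itself once the entries of y have
  -- passed the gap.
  ÷-late : ∀ x y {{p : 0ℝ < y}} → Eventually λ j → seq (x ÷ y) j ℚ.* seq y j ≡ seq x j
  ÷-late x y {{p}} = eventually₁ late (apart p)
    where
    late : ∀ j → 0ℚ ℚ.+ gap p ℚ.≤ seq y j → seq (x ÷ y) j ℚ.* seq y j ≡ seq x j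
    late j h = combine₂ (seq x j)
      (ℚ.- (seq x j ℚ.* r)) (recipAbove-inverse (gap p) (gap-pos p) (seq y j))
      (ℚ.p≥q⇒p⊔q≡p (ℚ.≤-trans (ℚ.≤-reflexive (sym (ℚ.+-identityˡ (gap p)))) h))
      (solve 4 (λ x r y y⊔ → x :* r :* y :- x := x :* (y⊔ :* r :- con 1ℚ) :+ (:- (x :* r)) :* (y⊔ :- y))
        refl (seq x j) r (seq y j) (seq y j ℚ.⊔ gap p))
      where
      r : ℚ
      r = recipAbove (gap p) (gap-pos p) (seq y j)

  ÷-≋ : ∀ x y {{_ : 0ℝ < y}} → (λ j → seq (x ÷ y) j ℚ.* seq y j) ≋ seq x
  ÷-≋ x y = ≋-eventually (÷-late x y)

  1÷-nonneg : ∀ y {{p : 0ℝ < y}} j → 0ℚ ℚ.≤ seq (1ℝ ÷ y) j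
  1÷-nonneg y {{p}} j = *-nonneg 0≤1 (ℚ.<⇒≤ (recipAbove-positive (gap p) (gap-pos p) (seq y j)))

  √-nonneg : ∀ x j → 0ℚ ℚ.≤ seq (√ x) j
  √-nonneg x j = proj₁ (root-bounds j (seq x j))

  -- Bisection encloses the radicand between r² and (r + w)², so the error is at most w(2r + w), and
  -- the width w is O(½ʲ).
  √-square : ∀ x → (λ j → seq (√ x) j ℚ.* seq (√ x) j) ≋ (λ j → seq x j ℚ.⊔ 0ℚ)
  √-square x = ≋-geometric C (*-nonneg 0≤W (+-nonneg (+-nonneg 0≤R 0≤R) 0≤W)) bound
    where
    B R W C : ℚ
    B = proj₁ (bounded x)
    R = proj₁ (bounded (√ x))
    W = 1ℚ ℚ.+ ℚ.∣ B ∣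
    C = W ℚ.* (R ℚ.+ R ℚ.+ W)
    0≤R : 0ℚ ℚ.≤ R
    0≤R = proj₁ (proj₂ (bounded (√ x)))
    0≤W : 0ℚ ℚ.≤ W
    0≤W = +-nonneg 0≤1 (ℚ.0≤∣p∣ B)
    bound : ∀ j → ℚ.∣ seq (√ x) j ℚ.* seq (√ x) j ℚ.- (seq x j ℚ.⊔ 0ℚ) ∣ ℚ.≤ C ℚ.* ½^ j
    bound j = dist-lub {r ℚ.* r} {y} {C ℚ.* ½^ j}
      (ℚ.≤-trans (proj₁ (proj₂ (root-bounds j (seq x j))))
        (p+-nonneg {y} (*-nonneg (*-nonneg 0≤W (+-nonneg (+-nonneg 0≤R 0≤R) 0≤W)) (0≤½^ j))))
      (ℚ.≤-trans (proj₂ (proj₂ (root-bounds j (seq x j))))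
        (ℚ.≤-trans (ℚ.≤-reflexive (solve 2 (λ r w → (r :+ w) :* (r :+ w) := r :* r :+ w :* (r :+ r :+ w)) refl r w))
          (ℚ.+-monoʳ-≤ (r ℚ.* r) (ℚ.≤-trans
            (*-mono (*-nonneg 0≤W (0≤½^ j)) (+-nonneg (+-nonneg 0≤r 0≤r) 0≤w) w≤
              (ℚ.+-mono-≤ (ℚ.+-mono-≤ r≤ r≤) (ℚ.≤-trans w≤
                (ℚ.≤-trans (*-monoˡ W 0≤W (RationalTools.½^≤1 j)) (ℚ.≤-reflexive (ℚ.*-identityʳ W))))))
            (ℚ.≤-reflexive (solve 3 (λ W h S → W :* h :* S := W :* S :* h) refl W (½^ j) (R ℚ.+ R ℚ.+ W)))))))
      where
      r w y : ℚ
      r = seq (√ x) j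
      w = width j (seq x j)
      y = seq x j ℚ.⊔ 0ℚ
      0≤r : 0ℚ ℚ.≤ r
      0≤r = √-nonneg x j
      0≤w : 0ℚ ℚ.≤ w
      0≤w = width-nonneg j (seq x j)
      w≤ : w ℚ.≤ W ℚ.* ½^ j
      w≤ = width-bound {B} {seq x j} j (proj₂ (proj₂ (bounded x)) j)
      r≤ : r ℚ.≤ R
      r≤ = ℚ.≤-trans (p≤∣p∣ r) (proj₂ (proj₂ (bounded (√ x))) j)

  ≋-⊔0 : ∀ {x y} → x ≋ y → (λ j → x j ℚ.⊔ 0ℚ) ≋ (λ j → y j ℚ.⊔ 0ℚ)
  ≋-⊔0 {x} {y} h .close ε 0<ε = eventually₁ (λ j → ℚ.≤-trans (⊔-lipschitz 0ℚ (x j) (y j))) (close h ε 0<ε)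

  √-square-≋ : ∀ x {y} → seq x ≋ y → Eventually (λ j → 0ℚ ℚ.≤ y j) →
               (λ j → seq (√ x) j ℚ.* seq (√ x) j) ≋ y
  √-square-≋ x h late = ≋-trans (√-square x) (≋-trans (≋-⊔0 h)
    (≋-eventually (eventually₁ (λ j → ℚ.p≥q⇒p⊔q≡p) late)))

  positive-late : ∀ {x} → 0ℝ < x → Eventually λ j → 0ℚ ℚ.≤ seq x j
  positive-late {x} p = eventually₁
    (λ j h → ℚ.≤-trans (+-nonneg {0ℚ} {gap p} ℚ.≤-refl (ℚ.<⇒≤ (gap-pos p))) h) (apart p)

  √-square-positive : ∀ x → 0ℝ < x → (λ j → seq (√ x) j ℚ.* seq (√ x) j) ≋ seq x
  √-square-positive x p = √-square-≋ x ≋-refl (positive-late p)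

  -- From zy = 1 one gets u² = z·u²·y, and y may be replaced by (√y)², where u·√y = 1 late on.
  1÷√-square : ∀ y {{p : 0ℝ < y}} {z} → (∀ j → z ℚ.* seq y j ≡ 1ℚ) →
               (λ j → seq (1ℝ ÷ √ y) j ℚ.* seq (1ℝ ÷ √ y) j) ≋ (λ _ → z)
  1÷√-square y {{p}} {z} zy≡1 = ≋-trans
    (≋-reflexive λ j → combine₁ (ℚ.- (u j ℚ.* u j)) (zy≡1 j)
      (solve 3 (λ u z y → u :* u :- z :* (u :* u) :* y := (:- (u :* u)) :* (z :* y :- con 1ℚ)) refl (u j) z (seq y j)))
    (≋-trans (≋-scale {w = λ j → z ℚ.* (u j ℚ.* u j)}
        (*-bounded (constant-bounded z) (*-bounded (bounded (1ℝ ÷ √ y)) (bounded (1ℝ ÷ √ y))))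
        (≋-sym (√-square-positive y p)))
    (≋-eventually (eventually₁ late (÷-late 1ℝ (√ y)))))
    where
    u r : ℕ → ℚ
    u = seq (1ℝ ÷ √ y)
    r = seq (√ y)
    late : ∀ j → u j ℚ.* r j ≡ 1ℚ → z ℚ.* (u j ℚ.* u j) ℚ.* (r j ℚ.* r j) ≡ z
    late j h = combine₁ (z ℚ.* (u j ℚ.* r j ℚ.+ 1ℚ)) h
      (solve 3 (λ z u r → z :* (u :* u) :* (r :* r) :- z := z :* (u :* r :+ con 1ℚ) :* (u :* r :- con 1ℚ))
        refl z (u j) (r j))

-- The integral of the Gaussian as a power series.

module GaussianIntegral (x : ℝ) where

  open +-*-Solver
  open GaussianSeries
  open Series using (seq-∑)
  open Riemann 0ℝ x gaussian

  private
    antiderivative : ℕ → ℚ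
    antiderivative j = seq x j ℚ.* gaussSum j (ℚ.- (seq x j ℚ.* seq x j))

  riemannSum-seq : ∀ m j → seq (riemannSum m) j ≡ seq x j ℚ.*
    (unit m ℚ.* sum (λ i → expSum j (ℚ.- (seq x j ℚ.* seq x j) ℚ.* (node m i ℚ.* node m i))) (suc m))
  riemannSum-seq m j = trans
    (cong (λ s → unit m ℚ.* (seq x j ℚ.- 0ℚ) ℚ.* s)
      (trans (seq-∑ (suc m) (λ i → gaussian (point m i)) j) (sum-cong (λ i → cong (expSum j) (argument i)) (suc m))))
    (solve 3 (λ w x s → w :* (x :- con 0ℚ) :* s := x :* (w :* s)) refl (unit m) (seq x j)
      (sum (λ i → expSum j (ℚ.- (seq x j ℚ.* seq x j) ℚ.* (node m i ℚ.* node m i))) (suc m)))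
    where
    argument : ∀ i → seq (- (point m i * point m i)) j ≡ ℚ.- (seq x j ℚ.* seq x j) ℚ.* (node m i ℚ.* node m i)
    argument i = trans
      (cong (λ t → let p = 0ℚ ℚ.+ t ℚ.* (seq x j ℚ.- 0ℚ) in ℚ.- (p ℚ.* p)) (/-as-* i m))
      (solve 2 (λ x t → let p = con 0ℚ :+ t :* (x :- con 0ℚ) in :- (p :* p) := (:- (x :* x)) :* (t :* t))
        refl (seq x j) (node m i))

  private
    B : ℚ
    B = proj₁ (bounded x)
    0≤B : 0ℚ ℚ.≤ B
    0≤B = proj₁ (proj₂ (bounded x))
    ∣x∣≤B : ∀ j → ℚ.∣ seq x j ∣ ℚ.≤ B
    ∣x∣≤B = proj₂ (proj₂ (bounded x))
    0≤BB : 0ℚ ℚ.≤ B ℚ.* B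
    0≤BB = *-nonneg 0≤B 0≤B
    C : ∃ λ C → 0ℚ ℚ.≤ C × ∀ n → expSum n (B ℚ.* B) ℚ.≤ C
    C = expSum-bounded (B ℚ.* B) 0≤BB

  expSum-mono-≤ : ∀ {p q} → 0ℚ ℚ.≤ p → p ℚ.≤ q → ∀ n → expSum n p ℚ.≤ expSum n q
  expSum-mono-≤ {p} {q} 0≤p p≤q zero    = ℚ.≤-refl
  expSum-mono-≤ {p} {q} 0≤p p≤q (suc n) = ℚ.+-mono-≤ (expSum-mono-≤ 0≤p p≤q n)
    (ℚ.≤-trans (p≤∣p∣ (expTerm p n)) (expTerm-bound q (ℚ.≤-trans 0≤p p≤q)
      (ℚ.≤-trans (ℚ.≤-reflexive (ℚ.0≤p⇒∣p∣≡p 0≤p)) p≤q) n))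

  -- Uniform in j, because one constant bounds all truncations of exp(B²); this lets a single
  -- subdivision serve every late entry.
  riemannSum-close : ∀ m j → ℚ.∣ seq (riemannSum m) j ℚ.- antiderivative j ∣ ℚ.≤ B ℚ.* proj₁ C ℚ.* unit m
  riemannSum-close m j = ℚ.≤-trans
    (ℚ.≤-reflexive (cong ℚ.∣_∣ (trans (cong (ℚ._- antiderivative j) (riemannSum-seq m j))
      (solve 3 (λ x s g → x :* s :- x :* g := x :* (s :- g)) refl (seq x j) s (gaussSum j c)))))
    (ℚ.≤-trans (∣*∣-≤ {seq x j} {s ℚ.- gaussSum j c} {B} {unit m ℚ.* proj₁ C} (∣x∣≤B j)
        (ℚ.≤-trans (riemann-gauss m c j) (*-monoˡ (unit m) (unit-nonneg m)
          (ℚ.≤-trans (expSum-mono-≤ (ℚ.0≤∣p∣ c) ∣c∣≤ j) (proj₂ (proj₂ C) j)))))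
      (ℚ.≤-reflexive (solve 3 (λ B u C → B :* (u :* C) := B :* C :* u) refl B (unit m) (proj₁ C))))
    where
    c s : ℚ
    c = ℚ.- (seq x j ℚ.* seq x j)
    s = unit m ℚ.* sum (λ i → expSum j (c ℚ.* (node m i ℚ.* node m i))) (suc m)
    ∣c∣≤ : ℚ.∣ c ∣ ℚ.≤ B ℚ.* B
    ∣c∣≤ = ℚ.≤-trans (ℚ.≤-reflexive (ℚ.∣-p∣≡∣p∣ (seq x j ℚ.* seq x j)))
      (∣*∣-≤ {seq x j} {seq x j} {B} {B} (∣x∣≤B j) (∣x∣≤B j))

  -- Stated for any limit I, so that the definition of the integral stays folded. A fixed fine
  -- subdivision links I to the series at all late j.
  integral-limit : ∀ {I} → riemannSum ⟶ I → seq I ≋ antiderivative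
  integral-limit {I} conv .close ε 0<ε = eventually₁ bound (within near e 0<e)
    where
    e D : ℚ
    -- A quarter of ε, because `within` adds a tolerance of its own, again e.
    e = half (half ε)
    D = B ℚ.* proj₁ C
    0<e : 0ℚ ℚ.< e
    0<e = half-pos (half-pos 0<ε)
    limit : Eventually λ m → ∣ riemannSum m - I ∣ ≤ fromℚ e
    limit = conv e 0<e
    fine : ∃ λ N → ∀ n → N ℕ.≤ n → D ℚ.* unit n ℚ.≤ half ε
    fine = 1/n-small D (*-nonneg 0≤B (proj₁ (proj₂ C))) (half-pos 0<ε)
    m : ℕ
    m = proj₁ limit ℕ.⊔ proj₁ fine
    near : ∣ riemannSum m - I ∣ ≤ fromℚ e
    near = proj₂ limit m (ℕ.m≤m⊔n (proj₁ limit) (proj₁ fine))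
    bound : ∀ j → ℚ.∣ seq (riemannSum m) j ℚ.- seq I j ∣ ℚ.≤ e ℚ.+ e → ℚ.∣ seq I j ℚ.- antiderivative j ∣ ℚ.≤ ε
    bound j h = ℚ.≤-trans
      (triangle {seq I j} {seq (riemannSum m) j} {antiderivative j} {e ℚ.+ e} {half ε}
        (ℚ.≤-trans (ℚ.≤-reflexive (dist-sym (seq I j) (seq (riemannSum m) j))) h)
        (ℚ.≤-trans (riemannSum-close m j) (proj₂ fine m (ℕ.m≤n⊔m (proj₁ limit) (proj₁ fine)))))
      (ℚ.≤-reflexive (trans (cong (ℚ._+ half ε) (half+half (half ε))) (half+half ε)))

  integral-series : seq (integral 0ℝ x gaussian gaussian-continuous) ≋ antiderivative
  integral-series = integral-limit
    (lim-converges riemannSum (riemannSum-cauchy gaussian-continuous))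

π-positive : 0ℝ < π
π-positive = *-positive-ℝ

-- The closed form with erf.

module ErfValue (ℓ s : ℕ) (z : ℚ) (0≤z : 0ℚ ℚ.≤ z) (z≤1 : z ℚ.≤ 1ℚ) (1≤ℓ : 1 ℕ.≤ ℓ) (1≤s : 1 ℕ.≤ s)
  (zℓs≡1 : z ℚ.* (ℕ→ℚ ℓ ℚ.* ℕ→ℚ s) ≡ 1ℚ) where

  open +-*-Solver
  open RealOperations
  open GaussianSeries
  open ExpGaussProduct z 0≤z z≤1
  open Magnitudes ℓ s z 0≤z z≤1 1≤ℓ 1≤s zℓs≡1

  module _ (E X R P I u : ℝ)
    (hE : ∀ j → seq E j ≡ expSum j z)
    (hX : seq X ≋ (λ j → seq P j ℚ.* (S ℚ.* seq u j)))
    (hR : (λ j → seq R j ℚ.* seq P j) ≋ (λ _ → 2ℚ))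
    (hI : seq I ≋ (λ j → seq u j ℚ.* gaussSum j (ℚ.- (seq u j ℚ.* seq u j))))
    (hu : (λ j → seq u j ℚ.* seq u j) ≋ (λ _ → z)) where

    private
      g : ℕ → ℚ
      g j = gaussSum j (ℚ.- z)

    integral-at-z : seq I ≋ (λ j → seq u j ℚ.* g j)
    integral-at-z = ≋-trans hI (≋-scale (bounded u)
      (gaussSum-≋ (bounded (- (u * u)))
        (≋-trans (≋-reflexive λ j → solve 1 (λ x → :- x := (:- con 1ℚ) :* x) refl (seq u j ℚ.* seq u j))
        (≋-trans (≋-constant-scale (ℚ.- 1ℚ) hu)
        (≋-reflexive λ j → solve 1 (λ x → (:- con 1ℚ) :* x := :- x) refl z)))))

    -- X stands for √(πs/ℓ), P for √π, R for 2/√π and I for the integral up to u. The factors are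
    -- regrouped until only R·P = 2 and u² = z have to be replaced.
    erf-value : seq (E * X * (R * I)) ≋ total 0
    erf-value =
      ≋-trans (≋-reflexive λ j → solve 4 (λ E X R I → E :* X :* (R :* I) := E :* (R :* I) :* X) refl
        (seq E j) (seq X j) (seq R j) (seq I j))
      (≋-trans (≋-scale (bounded (E * (R * I))) hX)
      (≋-trans (≋-reflexive λ j → solve 6 (λ E R I P S u → E :* (R :* I) :* (P :* (S :* u)) := E :* (I :* (S :* u)) :* (R :* P))
        refl (seq E j) (seq R j) (seq I j) (seq P j) S (seq u j))
      (≋-trans (≋-scale (bounded (E * (I * (fromℚ S * u)))) hR)
      (≋-trans (≋-reflexive λ j → solve 4 (λ E I S u → E :* (I :* (S :* u)) :* con 2ℚ := con 2ℚ :* (E :* (S :* u)) :* I)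
        refl (seq E j) (seq I j) S (seq u j))
      (≋-trans (≋-scale (bounded (fromℚ 2ℚ * (E * (fromℚ S * u)))) integral-at-z)
      (≋-trans (≋-reflexive λ j → solve 4 (λ E S u g → con 2ℚ :* (E :* (S :* u)) :* (u :* g) := con 2ℚ :* (S :* E) :* g :* (u :* u))
        refl (seq E j) S (seq u j) (g j))
      (≋-trans (≋-scale (*-bounded (bounded (fromℚ 2ℚ * (fromℚ S * E))) gaussSum-bounded) hu)
      (≋-trans (≋-reflexive λ j → trans (cong (λ e → 2ℚ ℚ.* (S ℚ.* e) ℚ.* g j ℚ.* z) (hE j))
        (solve 4 (λ E S g z → con 2ℚ :* (S :* E) :* g :* z := con 2ℚ :* S :* (z :* (E :* g)))
        refl (expSum j z) S (g j) z))
      (≋-constant-scale (2ℚ ℚ.* S) exp-gauss)))))))))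

  -- Since s/ℓ = s²z, both sides are nonnegative with the same square.
  √-scaled : ∀ D u → (∀ j → 0ℚ ℚ.≤ seq u j) → (λ j → seq u j ℚ.* seq u j) ≋ (λ _ → z) →
    seq D ≋ (λ j → seq π j ℚ.* (S ℚ.* S ℚ.* z)) →
    seq (√ D) ≋ (λ j → seq (√ π) j ℚ.* (S ℚ.* seq u j))
  √-scaled D u 0≤u hu hD = ≋-square⁻¹ (√-nonneg D)
    (λ j → *-nonneg (√-nonneg π j) (*-nonneg 0≤S (0≤u j)))
    (≋-trans (√-square-≋ D hD (eventually₁ (λ j 0≤π → *-nonneg 0≤π (*-nonneg (*-nonneg 0≤S 0≤S) 0≤z))
        (positive-late π-positive)))
    (≋-trans (≋-reflexive λ j → solve 3 (λ p S z → p :* (S :* S :* z) := S :* S :* p :* z) refl (seq π j) S z)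
    (≋-trans (≋-scale (*-bounded (constant-bounded (S ℚ.* S)) (bounded π)) (≋-sym hu))
    (≋-trans (≋-reflexive λ j → solve 3 (λ p S u → S :* S :* p :* (u :* u) := S :* S :* (u :* u) :* p) refl
      (seq π j) S (seq u j))
    (≋-trans (≋-scale (*-bounded (constant-bounded (S ℚ.* S)) (bounded (u * u))) (≋-sym (√-square-positive π π-positive)))
    (≋-reflexive λ j → solve 3 (λ p S u → S :* S :* (u :* u) :* (p :* p) := p :* (S :* u) :* (p :* (S :* u))) refl
      (seq (√ π) j) S (seq u j)))))))

  erf-sum : ∀ E D x → (∀ j → seq E j ≡ expSum j z) → (∀ j → 0ℚ ℚ.≤ seq x j) →
    (λ j → seq x j ℚ.* seq x j) ≋ (λ _ → z) → seq D ≋ (λ j → seq π j ℚ.* (ℕ→ℚ s ℚ.* ℕ→ℚ s ℚ.* z)) →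
    E * √ D * erf x ↝ total 0
  erf-sum E D x hE 0≤x hx hD = mk↝ (erf-value E (√ D) (fromℕ 2 ÷ √ π) (√ π)
    (integral 0ℝ x gaussian gaussian-continuous) x hE (√-scaled D x 0≤x hx hD)
    (÷-≋ (fromℕ 2) (√ π)) (GaussianIntegral.integral-series x) hx)

-- The functions of which the tails of the two expansions are the instances at
-- k = 0 and k = 1 are local to their definitions; unification recovers them
-- from the goals in which that argument has been generalised to k.
module ExpansionTails where

  open Quotients

  mutual

    local-ℓs : (ℓ s : ℕ) .{{_ : NonTrivial ℓ}} .{{_ : NonZero s}} → ℕ → ℕ → ℕ
    local-ℓs ℓ s = _

    tail-ℓs : (ℓ s : ℕ) .{{_ : NonTrivial ℓ}} .{{_ : NonZero s}} →
              ∀ n → tail (expansion-ℓs ℓ s) n ≡ quotient ℓ s 0 n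
    tail-ℓs ℓ s n with 0
    ... | k = local-ℓs≡ ℓ s k n

    local-ℓs≡ : (ℓ s : ℕ) .{{_ : NonTrivial ℓ}} .{{_ : NonZero s}} →
                ∀ k n → local-ℓs ℓ s k n ≡ quotient ℓ s k n
    local-ℓs≡ ℓ s k 0 = refl
    local-ℓs≡ ℓ s k 1 = refl
    local-ℓs≡ ℓ s k 2 = refl
    local-ℓs≡ ℓ s k (suc (suc (suc n))) = local-ℓs≡ ℓ s (suc k) n

  quotient-s : ℕ → ℕ → ℕ → ℕ
  quotient-s s k 0 = 2 ℕ.* s ℕ.∸ 1
  quotient-s s k 1 = 2 ℕ.* k
  quotient-s s k 2 = 1
  quotient-s s k (suc (suc (suc n))) = quotient-s s (suc k) n

  mutual

    local-s : (s : ℕ) .{{_ : NonZero s}} → ℕ → ℕ → ℕ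
    local-s s = _

    tail≡quotient-s : (s : ℕ) .{{_ : NonZero s}} → ∀ n → tail (expansion-s s) n ≡ quotient-s s 1 n
    tail≡quotient-s s n with 1
    ... | k = local-s≡ s k n

    local-s≡ : (s : ℕ) .{{_ : NonZero s}} → ∀ k n → local-s s k n ≡ quotient-s s k n
    local-s≡ s k 0 = refl
    local-s≡ s k 1 = refl
    local-s≡ s k 2 = refl
    local-s≡ s k (suc (suc (suc n))) = local-s≡ s (suc k) n

  -- With ℓ = 1 the quotients (2k + 1)ℓ - 1 are the even numbers 2k, and skipping the initial 0 and
  -- 1 makes every group begin with 2s - 1.
  quotient-s-shift : ∀ s k n → quotient-s s (suc k) n ≡ quotient 1 s k (2 ℕ.+ n)
  quotient-s-shift s k 0 = refl
  quotient-s-shift s k 1 = sym (cong (ℕ._∸ 1) (ℕ.*-identityʳ (1 ℕ.+ 2 ℕ.* suc k)))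
  quotient-s-shift s k 2 = refl
  quotient-s-shift s k (suc (suc (suc n))) = quotient-s-shift s (suc k) n

  tail-s : (s : ℕ) .{{_ : NonZero s}} → ∀ n → tail (expansion-s s) n ≡ quotient 1 s 0 (2 ℕ.+ n)
  tail-s s n = trans (tail≡quotient-s s n) (quotient-s-shift s 0 n)

-- From error series to both expansions and their sums.

module _ (c : RegularCF) (α : ℝ) where

  open ContinuedFractions c α

  summable-expansion : ∀ (a : ℕ → ℕ) (μ : ℕ → ℕ → ℚ) (τ : ℕ → ℚ) T → (∀ n → tail c n ≡ a n) →
    (∀ n j → 0ℚ ℚ.≤ μ n j) → δ 0 ≋ (λ j → ℚ.- μ 0 j) →
    μ 1 ≋ (λ j → 1ℚ ℚ.- ℕ→ℚ (a 0) ℚ.* μ 0 j) →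
    (∀ n → μ (suc (suc n)) ≋ (λ j → μ n j ℚ.- ℕ→ℚ (a (suc n)) ℚ.* μ (suc n) j)) →
    (∀ ε → 0ℚ ℚ.< ε → ∃ λ N → ∀ n → N ℕ.≤ n → ∀ j → ℚ.∣ sum (λ i → μ i j) n ℚ.- τ j ∣ ℚ.≤ ε) →
    seq T ≋ τ → c IsExpansionOf α × HasSum (λ n → ∣ error n ∣) T
  summable-expansion a μ τ T tail≡ 0≤μ start next recurrence converges hT =
    expansion-of-summable {T} summable , summable
    where
    summable : HasSum (λ n → ∣ error n ∣) T
    summable = Series.hasSum {λ n → ∣ error n ∣} {T} μ τ
      (∣error∣≋ a tail≡ μ 0≤μ start next recurrence) hT converges

module _ (y : ℝ) {{p : 0ℝ < y}} (q z : ℚ) (seq-y : ∀ j → seq y j ≡ q) (seq-z : ∀ j → seq (1ℝ ÷ y) j ≡ z) where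

  -- Both sequences are constant, so the product can be read off at a single late index.
  reciprocal-inverse : z ℚ.* q ≡ 1ℚ
  reciprocal-inverse = trans (sym (cong₂ ℚ._*_ (seq-z N) (seq-y N))) (proj₂ late N ℕ.≤-refl)
    where
    late : Eventually λ j → seq (1ℝ ÷ y) j ℚ.* seq y j ≡ 1ℚ
    late = RealOperations.÷-late 1ℝ y
    N : ℕ
    N = proj₁ late

  reciprocal-nonneg : 0ℚ ℚ.≤ z
  reciprocal-nonneg = ℚ.≤-trans (RealOperations.1÷-nonneg y 0) (ℚ.≤-reflexive (seq-z 0))

  reciprocal≤1 : 1ℚ ℚ.≤ q → z ℚ.≤ 1ℚ
  reciprocal≤1 1≤q = ℚ.≤-trans (ℚ.≤-reflexive (sym (ℚ.*-identityʳ z)))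
    (ℚ.≤-trans (*-monoˡ z reciprocal-nonneg 1≤q) (ℚ.≤-reflexive reciprocal-inverse))

module ExpansionErrors (ℓ s : ℕ) (z : ℚ) (0≤z : 0ℚ ℚ.≤ z) (z≤1 : z ℚ.≤ 1ℚ) (1≤ℓ : 1 ℕ.≤ ℓ) (1≤s : 1 ℕ.≤ s)
  (zℓs≡1 : z ℚ.* (ℕ→ℚ ℓ ℚ.* ℕ→ℚ s) ≡ 1ℚ) where

  open +-*-Solver
  open Magnitudes ℓ s z 0≤z z≤1 1≤ℓ 1≤s zℓs≡1
  open Quotients

  module _ (E : ℝ) (hE : ∀ j → seq E j ≡ expSum j z) where

    α : ℝ
    α = fromℕ s * E

    α≋ : seq α ≋ (λ j → S ℚ.+ B 0 j)
    α≋ = ≋-trans (≋-reflexive λ j → cong (S ℚ.*_) (hE j)) B-exp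

    sum-ℓs : ∀ c T → head c ≡ + s → (∀ n → tail c n ≡ quotient ℓ s 0 n) → T ↝ total 0 →
      c IsExpansionOf α × HasSum (λ n → ∣ fromℤ (numerator c n) - α * fromℕ (denominator c n) ∣) T
    sum-ℓs c T head≡ tail≡ hT = summable-expansion c α (quotient ℓ s 0) (magnitude 0) (total 0) T tail≡
      (magnitude-nonneg 0) start (C-recurrence 0) (magnitude-recurrence 0) partial-sum-close (seq-≋ hT)
      where
      start : ContinuedFractions.δ c α 0 ≋ (λ j → ℚ.- B 0 j)
      start = ≋-trans
        (≋-reflexive λ j → trans (cong (λ h → h ℚ./ 1 ℚ.- seq α j ℚ.* 1ℚ) head≡)
          (solve 2 (λ S α → S :- α :* con 1ℚ := S :- α) refl S (seq α j)))
        (≋-trans (≋-minus (≋-refl {λ _ → S}) α≋)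
        (≋-reflexive λ j → solve 2 (λ S B → S :- (S :+ B) := :- B) refl S (B 0 j)))

    -- For ℓ = 1 the second partial quotient ℓ - 1 vanishes, and the expansion
    -- is obtained by dropping the first two convergents.
    module _ (ℓ≡1 : ℓ ≡ 1) where

      B-first : B 0 ≋ (λ j → A 1 j ℚ.+ 1ℚ)
      B-first = ≋-trans
        (≋-reflexive λ j → trans
          (solve 1 (λ B → B := (con 1ℚ :+ con 2ℚ :* con 0ℚ) :* con 1ℚ :* B) refl (B 0 j))
          (cong (λ l → (1ℚ ℚ.+ 2ℚ ℚ.* 0ℚ) ℚ.* ℕ→ℚ l ℚ.* B 0 j) (sym ℓ≡1)))
        (B-odd 0)

      -- With ℓ - 1 = 0 as its partial quotient, the formal convergent for n = 1 is 1/0, and its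
      -- error is 1.
      C-first : C 0 ≋ (λ _ → 1ℚ)
      C-first = ≋-trans (≋-minus B-first (≋-refl {A 1}))
        (≋-reflexive λ j → solve 1 (λ A → A :+ con 1ℚ :- A := con 1ℚ) refl (A 1 j))

      sum-s : ∀ c V → head c ≡ + (s ℕ.+ 1) → (∀ n → tail c n ≡ quotient ℓ s 0 (2 ℕ.+ n)) → V ↝ total 0 →
        c IsExpansionOf α × HasSum (λ n → ∣ fromℤ (numerator c n) - α * fromℕ (denominator c n) ∣)
          (V + fromℕ s * (1ℝ - E) - 1ℝ)
      sum-s c V head≡ tail≡ hV = summable-expansion c α (λ n → quotient ℓ s 0 (2 ℕ.+ n))
        (λ n → magnitude 0 (2 ℕ.+ n)) τ T tail≡
        (λ n → magnitude-nonneg 0 (2 ℕ.+ n)) start next (λ n → magnitude-recurrence 0 (2 ℕ.+ n)) converges hT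
        where
        T : ℝ
        T = V + fromℕ s * (1ℝ - E) - 1ℝ
        τ : ℕ → ℚ
        τ j = total 0 j ℚ.- B 0 j ℚ.- C 0 j
        start : ContinuedFractions.δ c α 0 ≋ (λ j → ℚ.- A 1 j)
        start = ≋-trans
          (≋-reflexive λ j → trans
            (cong (λ h → h ℚ.- seq α j ℚ.* 1ℚ) (trans (cong (ℚ._/ 1) head≡) (ℕ→ℚ-+ s 1)))
            (solve 2 (λ S α → S :+ con 1ℚ :- α :* con 1ℚ := S :+ con 1ℚ :- α) refl S (seq α j)))
          (≋-trans (≋-minus (≋-refl {λ _ → S ℚ.+ 1ℚ}) (≋-trans α≋ (≋-+ (≋-refl {λ _ → S}) B-first)))
          (≋-reflexive λ j → solve 2 (λ S A → S :+ con 1ℚ :- (S :+ (A :+ con 1ℚ)) := :- A) refl S (A 1 j)))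
        next : B 1 ≋ (λ j → 1ℚ ℚ.- ℕ→ℚ (quotient ℓ s 0 2) ℚ.* A 1 j)
        next = ≋-trans (magnitude-recurrence 0 1)
          (≋-minus C-first (≋-refl {λ j → ℕ→ℚ (quotient ℓ s 0 2) ℚ.* A 1 j}))
        -- The correction s(1 - E) - 1 removes the two dropped errors: s(1 - E) is the negative of
        -- `B 0`, and 1 is `C 0`.
        hT : seq T ≋ τ
        hT = ≋-minus (≋-trans (≋-+ (seq-≋ hV)
              (≋-trans (≋-reflexive λ j → solve 2 (λ S E → S :* (con 1ℚ :- E) := S :- S :* E) refl S (seq E j))
              (≋-trans (≋-minus (≋-refl {λ _ → S}) α≋)
              (≋-reflexive λ j → solve 2 (λ S B → S :- (S :+ B) := :- B) refl S (B 0 j)))))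
            ≋-refl) (≋-sym C-first)
        converges : ∀ ε → 0ℚ ℚ.< ε → ∃ λ N → ∀ n → N ℕ.≤ n → ∀ j →
          ℚ.∣ sum (λ i → magnitude 0 (2 ℕ.+ i) j) n ℚ.- τ j ∣ ℚ.≤ ε
        converges ε 0<ε = proj₁ full , λ n N≤n j → ℚ.≤-trans
          (ℚ.≤-reflexive (cong ℚ.∣_∣ (combine₁ (ℚ.- 1ℚ)
            (trans (sum-peel (λ i → magnitude 0 i j) (suc n))
              (cong (λ x → B 0 j ℚ.+ x) (sum-peel (λ i → magnitude 0 (suc i) j) n)))
            (solve 5 (λ s T B C f → s :- (T :- B :- C) :- (f :- T) := (:- con 1ℚ) :* (f :- (B :+ (C :+ s))))
              refl (sum (λ i → magnitude 0 (2 ℕ.+ i) j) n) (total 0 j) (B 0 j) (C 0 j)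
              (sum (λ i → magnitude 0 i j) (2 ℕ.+ n))))))
          (proj₂ full (2 ℕ.+ n) (ℕ.≤-trans N≤n (ℕ.m≤n+m n 2)) j)
          where
          full : ∃ λ N → ∀ n → N ℕ.≤ n → ∀ j → ℚ.∣ sum (λ i → magnitude 0 i j) n ℚ.- total 0 j ∣ ℚ.≤ ε
          full = partial-sum-close ε 0<ε

-- Specialisation to z = 1/(ℓs).

module Reciprocal (ℓ s : ℕ) (1≤ℓ : 1 ℕ.≤ ℓ) (1≤s : 1 ℕ.≤ s) (y : ℝ) {{p : 0ℝ < y}}
  (seq-y : ∀ j → seq y j ≡ ℕ→ℚ ℓ ℚ.* ℕ→ℚ s) where

  -- The sequence of 1 ÷ y is constant, so its entry 0 is the rational number 1/(ℓs).
  z L S : ℚ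
  z = seq (1ℝ ÷ y) 0
  L = ℕ→ℚ ℓ
  S = ℕ→ℚ s

  seq-z : ∀ j → seq (1ℝ ÷ y) j ≡ z
  seq-z j = cong (λ q → 1ℚ ℚ.* recipAbove (gap p) (gap-pos p) q) (trans (seq-y j) (sym (seq-y 0)))

  zℓs≡1 : z ℚ.* (L ℚ.* S) ≡ 1ℚ
  zℓs≡1 = reciprocal-inverse y (L ℚ.* S) z seq-y seq-z

  0≤z : 0ℚ ℚ.≤ z
  0≤z = reciprocal-nonneg y (L ℚ.* S) z seq-y seq-z

  z≤1 : z ℚ.≤ 1ℚ
  z≤1 = reciprocal≤1 y (L ℚ.* S) z seq-y seq-z
    (ℚ.≤-trans (ℚ.≤-reflexive (sym (ℚ.*-identityʳ 1ℚ)))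
      (*-mono (ℕ→ℚ-nonneg ℓ) 0≤1 (ℕ→ℚ-mono 1≤ℓ) (ℕ→ℚ-mono 1≤s)))

  open Magnitudes ℓ s z 0≤z z≤1 1≤ℓ 1≤s zℓs≡1 using (total)
  module Errors = ExpansionErrors ℓ s z 0≤z z≤1 1≤ℓ 1≤s zℓs≡1

  exp-seq : ∀ j → seq (exp (1ℝ ÷ y)) j ≡ expSum j z
  exp-seq j = cong (expSum j) (seq-z j)

  -- `hD` ranges over every inverse z of ℓs, so that the radicand can be evaluated apart from the
  -- reciprocal of y.
  module _ (D : ℝ)
    (hD : ∀ z → z ℚ.* (ℕ→ℚ ℓ ℚ.* ℕ→ℚ s) ≡ 1ℚ → D ↝ (λ j → seq π j ℚ.* (ℕ→ℚ s ℚ.* ℕ→ℚ s ℚ.* z)))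
    (c : RegularCF) where

    value : exp (1ℝ ÷ y) * √ D * erf (1ℝ ÷ √ y) ↝ total 0
    value = ErfValue.erf-sum ℓ s z 0≤z z≤1 1≤ℓ 1≤s zℓs≡1 _ _ _ exp-seq
      (RealOperations.1÷-nonneg (√ y))
      (RealOperations.1÷√-square y (λ j → trans (cong (z ℚ.*_) (seq-y j)) zℓs≡1)) (seq-≋ (hD z zℓs≡1))

    sum-ℓs : head c ≡ + s → (∀ n → tail c n ≡ Quotients.quotient ℓ s 0 n) →
      c IsExpansionOf (fromℕ s * exp (1ℝ ÷ y)) ×
      HasSum (λ n → ∣ fromℤ (numerator c n) - fromℕ s * exp (1ℝ ÷ y) * fromℕ (denominator c n) ∣)
        (exp (1ℝ ÷ y) * √ D * erf (1ℝ ÷ √ y))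
    sum-ℓs head≡ tail≡ = Errors.sum-ℓs _ exp-seq c _ head≡ tail≡ value

    sum-s : ℓ ≡ 1 → head c ≡ + (s ℕ.+ 1) → (∀ n → tail c n ≡ Quotients.quotient ℓ s 0 (2 ℕ.+ n)) →
      c IsExpansionOf (fromℕ s * exp (1ℝ ÷ y)) ×
      HasSum (λ n → ∣ fromℤ (numerator c n) - fromℕ s * exp (1ℝ ÷ y) * fromℕ (denominator c n) ∣)
        (exp (1ℝ ÷ y) * √ D * erf (1ℝ ÷ √ y) + fromℕ s * (1ℝ - exp (1ℝ ÷ y)) - 1ℝ)
    sum-s ℓ≡1 head≡ tail≡ = Errors.sum-s _ exp-seq ℓ≡1 c _ head≡ tail≡ value

module Radicands where

  open +-*-Solver

  -- The quotient d satisfies d = zs·(dℓ), and dℓ agrees with πs up to a null sequence.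
  radicand-÷ : ∀ ℓ s .{{_ : NonZero ℓ}} z → z ℚ.* (ℕ→ℚ ℓ ℚ.* ℕ→ℚ s) ≡ 1ℚ →
    π * fromℕ s ÷ fromℕ ℓ ↝ (λ j → seq π j ℚ.* (ℕ→ℚ s ℚ.* ℕ→ℚ s ℚ.* z))
  radicand-÷ ℓ s z zℓs≡1 = mk↝ (≋-trans
    (≋-reflexive λ j → combine₁ (ℚ.- d j) zℓs≡1
      (solve 4 (λ d z L S → d :- z :* S :* (d :* L) := (:- d) :* (z :* (L :* S) :- con 1ℚ)) refl (d j) z (ℕ→ℚ ℓ) S))
    (≋-trans (≋-constant-scale (z ℚ.* S) (RealOperations.÷-≋ (π * fromℕ s) (fromℕ ℓ)))
    (≋-reflexive λ j → solve 3 (λ z S p → z :* S :* (p :* S) := p :* (S :* S :* z)) refl z S (seq π j))))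
    where
    S : ℚ
    S = ℕ→ℚ s
    d : ℕ → ℚ
    d = seq (π * fromℕ s ÷ fromℕ ℓ)

  radicand : ∀ s z → z ℚ.* (ℕ→ℚ 1 ℚ.* ℕ→ℚ s) ≡ 1ℚ →
    π * fromℕ s ↝ (λ j → seq π j ℚ.* (ℕ→ℚ s ℚ.* ℕ→ℚ s ℚ.* z))
  radicand s z zs≡1 = mk↝ (≋-reflexive λ j → combine₁ (ℚ.- (seq π j ℚ.* ℕ→ℚ s)) zs≡1
    (solve 3 (λ p S z → p :* S :- p :* (S :* S :* z) := (:- (p :* S)) :* (z :* (con 1ℚ :* S) :- con 1ℚ))
      refl (seq π j) (ℕ→ℚ s) z))

theorem3 :
    ((ℓ s : ℕ) .{{_ : NonTrivial ℓ}} .{{_ : NonZero s}} →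
      let E = exp (1ℝ ÷ (fromℕ ℓ * fromℕ s))
          α = fromℕ s * E
          c = expansion-ℓs ℓ s
      in c IsExpansionOf α ×
         HasSum (λ n → ∣ fromℤ (numerator c n) - α * fromℕ (denominator c n) ∣)
                (E * √ (π * fromℕ s ÷ fromℕ ℓ) * erf (1ℝ ÷ √ (fromℕ ℓ * fromℕ s))))
    ×
    ((s : ℕ) .{{_ : NonZero s}} →
      let E = exp (1ℝ ÷ fromℕ s)
          α = fromℕ s * E
          c = expansion-s s
      in c IsExpansionOf α ×
         HasSum (λ n → ∣ fromℤ (numerator c n) - α * fromℕ (denominator c n) ∣)
                (E * √ (π * fromℕ s) * erf (1ℝ ÷ √ (fromℕ s))
                  + fromℕ s * (1ℝ - E) - 1ℝ))
theorem3 =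
  (λ ℓ s {{nt}} {{nz}} → Reciprocal.sum-ℓs ℓ s (ℕ.>-nonZero⁻¹ ℓ) (ℕ.>-nonZero⁻¹ s) (fromℕ ℓ * fromℕ s)
    {{*-positive-ℝ {{fromℕ-positive {ℓ} {{nonTrivial-nonZero {ℓ} {{nt}}}}}} {{fromℕ-positive {s} {{nz}}}}}}
    (λ _ → refl)
    (_÷_ (π * fromℕ s) (fromℕ ℓ) {{fromℕ-positive {ℓ} {{nonTrivial-nonZero {ℓ} {{nt}}}}}})
    (Radicands.radicand-÷ ℓ s {{nonTrivial-nonZero {ℓ} {{nt}}}})
    (expansion-ℓs ℓ s {{nt}} {{nz}}) refl (ExpansionTails.tail-ℓs ℓ s {{nt}} {{nz}})) ,
  (λ s {{nz}} → Reciprocal.sum-s 1 s ℕ.≤-refl (ℕ.>-nonZero⁻¹ s) (fromℕ s) {{fromℕ-positive {s} {{nz}}}}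
    (λ _ → sym (ℚ.*-identityˡ (ℕ→ℚ s)))
    (π * fromℕ s) (Radicands.radicand s) (expansion-s s {{nz}}) refl refl (ExpansionTails.tail-s s {{nz}}))
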